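{- Let $G$ be a finite simple graph of order $n \ge 2$, and let $\overline{G}$ denote its complement. Then $$\max\left\{\lambda_2(G), \lambda_2(\overline{G})\right\} \ge \frac{2}{5}.$$
   Context: All graphs are finite and simple (no loops and no multiple edges). The order of a graph is its number of vertices. The Laplacian of a graph $G$ is $L(G) = D(G) - A(G)$, where $A(G)$ is the adjacency matrix and $D(G)$ is the diagonal matrix of vertex degrees. The eigenvalues of $L(G)$, listed with multiplicity, are denoted $0 = \lambda_1(G) \le \lambda_2(G) \le \cdots \le \lambda_n(G)$, so $\lambda_2(G)$ is the second smallest Laplacian eigenvalue (the algebraic connectivity). The complement $\overline{G}$ has the same vertex set as $G$, and two distinct vertices are adjacent in $\overline{G}$ if and only if they are not adjacent in $G$. -}

module Defs where

open import Algebra.Bundles.Raw using (RawRing)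
import Algebra.Definitions.RawSemiring as RawSemiringDefs
open import Data.Bool.Base using (if_then_else_)
open import Data.Fin.Base as Fin using (Fin; zero; suc; toℕ; fromℕ<; punchIn)
import Data.Fin.Properties as Fin
open import Data.Integer.Base using (+_)
open import Data.List.Base using (allFin; filter; length)
open import Data.Nat.Base as ℕ using (ℕ)
import Data.Nat.Properties as ℕ
open import Data.Product.Base using (∃-syntax; _×_; _,_; map₂)
open import Data.Rational.Base as ℚ using (ℚ; 0ℚ; 1ℚ; ½)
import Data.Rational.Properties as ℚ
open import Data.Rational.Solver using (module +-*-Solver)
open import Data.Sum.Base using (inj₁; inj₂)
open import Data.Vec.Functional using (Vector)
open import Function.Base using (_∘_; flip)
open import Level using (0ℓ)
open import Relation.Binary.Core using (Rel)
open import Relation.Binary.Definitions using (Decidable; Symmetric; Irreflexive; Monotonic₁)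
open import Relation.Binary.PropositionalEquality
  using (_≡_; _≢_; refl; sym; ≢-sym; trans; cong; subst; module ≡-Reasoning)
open import Relation.Nullary.Decidable using (does; ¬?; _×-dec_)
open import Relation.Nullary.Negation using (¬_)

------------------------------------------------------------------------
-- Real numbers: Cauchy sequences of rationals with a modulus, considered
-- up to the setoid equality _≈_ below.

IsCauchy : (ℕ → ℚ) → Set
IsCauchy x = ∀ ε → 0ℚ ℚ.< ε →
  ∃[ N ] (∀ m n → N ℕ.≤ m → N ℕ.≤ n → ℚ.∣ x m ℚ.- x n ∣ ℚ.< ε)

record ℝ : Set where
  constructor mkℝ
  field
    seq    : ℕ → ℚ
    cauchy : IsCauchy seq

open ℝ public

infix 4 _≤_ _≥_ _≈_

_≤_ : Rel ℝ 0ℓ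
x ≤ y = ∀ ε → 0ℚ ℚ.< ε → ∃[ N ] (∀ n → N ℕ.≤ n → seq x n ℚ.≤ seq y n ℚ.+ ε)

_≥_ : Rel ℝ 0ℓ
_≥_ = flip _≤_

_≈_ : Rel ℝ 0ℓ
x ≈ y = x ≤ y × y ≤ x

-- The arithmetic of ℝ is termwise. The proofs that it preserves the Cauchy
-- property are abstract: unfolding them makes type checking very slow.

private
  open +-*-Solver

  EventuallyBounded : (ℕ → ℚ) → Set
  EventuallyBounded x = ∃[ B ] (ℚ.Positive B × ∃[ N ] (∀ n → N ℕ.≤ n → ℚ.∣ x n ∣ ℚ.≤ B))

  abstract
    0<½* : ∀ {ε} → 0ℚ ℚ.< ε → 0ℚ ℚ.< ½ ℚ.* ε
    0<½* {ε} 0<ε = subst (ℚ._< ½ ℚ.* ε) (ℚ.*-zeroʳ ½) (ℚ.*-monoʳ-<-pos ½ 0<ε)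

    ½+½ : ∀ ε → ½ ℚ.* ε ℚ.+ ½ ℚ.* ε ≡ ε
    ½+½ = solve 1 (λ e → con ½ :* e :+ con ½ :* e := e) refl

    const-cauchy : ∀ q → IsCauchy (λ _ → q)
    const-cauchy q ε 0<ε = 0 , λ _ _ _ _ →
      subst (ℚ._< ε) (cong ℚ.∣_∣ (sym (ℚ.+-inverseʳ q))) 0<ε

    -‿cauchy : ∀ {x} → IsCauchy x → IsCauchy (ℚ.-_ ∘ x)
    -‿cauchy {x} cx ε 0<ε = map₂ (λ h m n N≤m N≤n →
        subst (ℚ._< ε) (sym (eq (x m) (x n))) (h m n N≤m N≤n))
      (cx ε 0<ε)
      where
      eq : ∀ p q → ℚ.∣ ℚ.- p ℚ.- ℚ.- q ∣ ≡ ℚ.∣ p ℚ.- q ∣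
      eq p q = trans
        (cong ℚ.∣_∣ (solve 2 (λ a b → :- a :- (:- b) := :- (a :- b)) refl p q))
        (ℚ.∣-p∣≡∣p∣ (p ℚ.- q))

    +-cauchy : ∀ {x y} → IsCauchy x → IsCauchy y → IsCauchy (λ n → x n ℚ.+ y n)
    +-cauchy {x} {y} cx cy ε 0<ε
      with M , hx ← cx (½ ℚ.* ε) (0<½* 0<ε)
         | N , hy ← cy (½ ℚ.* ε) (0<½* 0<ε)
      = M ℕ.⊔ N , λ m n ≤m ≤n → begin-strict
        ℚ.∣ (x m ℚ.+ y m) ℚ.- (x n ℚ.+ y n) ∣
          ≡⟨ cong ℚ.∣_∣ (solve 4 (λ a b c d → (a :+ b) :- (c :+ d) := (a :- c) :+ (b :- d))
                                 refl (x m) (y m) (x n) (y n)) ⟩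
        ℚ.∣ (x m ℚ.- x n) ℚ.+ (y m ℚ.- y n) ∣
          ≤⟨ ℚ.∣p+q∣≤∣p∣+∣q∣ (x m ℚ.- x n) (y m ℚ.- y n) ⟩
        ℚ.∣ x m ℚ.- x n ∣ ℚ.+ ℚ.∣ y m ℚ.- y n ∣
          <⟨ ℚ.+-mono-< (hx m n (ℕ.m⊔n≤o⇒m≤o M N ≤m) (ℕ.m⊔n≤o⇒m≤o M N ≤n))
                        (hy m n (ℕ.m⊔n≤o⇒n≤o M N ≤m) (ℕ.m⊔n≤o⇒n≤o M N ≤n)) ⟩
        ½ ℚ.* ε ℚ.+ ½ ℚ.* ε
          ≡⟨ ½+½ ε ⟩
        ε ∎
      where open ℚ.≤-Reasoning

    bounded : ∀ {x} → IsCauchy x → EventuallyBounded x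
    bounded {x} cx with N , h ← cx 1ℚ (ℚ.positive⁻¹ 1ℚ)
      = ℚ.∣ x N ∣ ℚ.+ 1ℚ
      , ℚ.nonNeg+pos⇒pos ℚ.∣ x N ∣ {{ℚ.∣-∣-nonNeg (x N)}} 1ℚ
      , N , λ n N≤n → begin
        ℚ.∣ x n ∣
          ≡⟨ cong ℚ.∣_∣ (solve 2 (λ a b → a := b :+ (a :- b)) refl (x n) (x N)) ⟩
        ℚ.∣ x N ℚ.+ (x n ℚ.- x N) ∣
          ≤⟨ ℚ.∣p+q∣≤∣p∣+∣q∣ (x N) (x n ℚ.- x N) ⟩
        ℚ.∣ x N ∣ ℚ.+ ℚ.∣ x n ℚ.- x N ∣
          ≤⟨ ℚ.+-monoʳ-≤ ℚ.∣ x N ∣ (ℚ.<⇒≤ (h n N N≤n ℕ.≤-refl)) ⟩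
        ℚ.∣ x N ∣ ℚ.+ 1ℚ ∎
      where open ℚ.≤-Reasoning

    divide : ∀ C ε → ℚ.Positive C → 0ℚ ℚ.< ε → ∃[ δ ] (0ℚ ℚ.< δ × C ℚ.* δ ≡ ε)
    divide C ε C>0 0<ε = 1/C ℚ.* ε
      , subst (ℚ._< 1/C ℚ.* ε) (ℚ.*-zeroʳ 1/C)
          (ℚ.*-monoʳ-<-pos 1/C {{ℚ.1/pos⇒pos C {{C>0}}}} 0<ε)
      , trans (sym (ℚ.*-assoc C 1/C ε))
          (trans (cong (ℚ._* ε) (ℚ.*-inverseʳ C {{ℚ.pos⇒nonZero C {{C>0}}}}))
            (ℚ.*-identityˡ ε))
      where
      1/C : ℚ
      1/C = (ℚ.1/ C) {{ℚ.pos⇒nonZero C {{C>0}}}}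

    *-bound : ∀ D δ p q → ℚ.Positive D →
      ℚ.∣ p ∣ ℚ.≤ D → ℚ.∣ q ∣ ℚ.< δ → ℚ.∣ p ℚ.* q ∣ ℚ.< D ℚ.* δ
    *-bound D δ p q D>0 p≤D q<δ = subst (ℚ._< D ℚ.* δ) (sym (ℚ.∣p*q∣≡∣p∣*∣q∣ p q))
      (ℚ.≤-<-trans (ℚ.*-monoʳ-≤-nonNeg ℚ.∣ q ∣ {{ℚ.∣-∣-nonNeg q}} p≤D)
                   (ℚ.*-monoʳ-<-pos D {{D>0}} q<δ))

    products-close : ∀ A B δ ε p q r s → ℚ.Positive A → ℚ.Positive B →
      (A ℚ.+ B) ℚ.* δ ≡ ε → ℚ.∣ p ∣ ℚ.≤ A → ℚ.∣ s ∣ ℚ.≤ B →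
      ℚ.∣ p ℚ.- r ∣ ℚ.< δ → ℚ.∣ q ℚ.- s ∣ ℚ.< δ →
      ℚ.∣ p ℚ.* q ℚ.- r ℚ.* s ∣ ℚ.< ε
    products-close A B δ ε p q r s A>0 B>0 eq p≤A s≤B pr qs =
      subst (ℚ.∣ p ℚ.* q ℚ.- r ℚ.* s ∣ ℚ.<_) (trans (sym (ℚ.*-distribʳ-+ δ A B)) eq)
        (subst (λ t → ℚ.∣ t ∣ ℚ.< A ℚ.* δ ℚ.+ B ℚ.* δ) (sym (split p q r s))
          (ℚ.≤-<-trans (ℚ.∣p+q∣≤∣p∣+∣q∣ (p ℚ.* (q ℚ.- s)) (s ℚ.* (p ℚ.- r)))
            (ℚ.+-mono-< (*-bound A δ p (q ℚ.- s) A>0 p≤A qs)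
                        (*-bound B δ s (p ℚ.- r) B>0 s≤B pr))))
      where
      split : ∀ a b c d → a ℚ.* b ℚ.- c ℚ.* d ≡ a ℚ.* (b ℚ.- d) ℚ.+ d ℚ.* (a ℚ.- c)
      split = solve 4 (λ a b c d → a :* b :- c :* d := a :* (b :- d) :+ d :* (a :- c)) refl

    *-cauchy : ∀ {x y} → IsCauchy x → IsCauchy y → IsCauchy (λ n → x n ℚ.* y n)
    *-cauchy {x} {y} cx cy ε 0<ε = scale (bounded {x} cx) (bounded {y} cy)
      where
      Goal : Set
      Goal = ∃[ N ] (∀ m n → N ℕ.≤ m → N ℕ.≤ n → ℚ.∣ x m ℚ.* y m ℚ.- x n ℚ.* y n ∣ ℚ.< ε)

      combine : ∀ A B δ → ℚ.Positive A → ℚ.Positive B → (A ℚ.+ B) ℚ.* δ ≡ ε →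
        ∃[ K ] (∀ n → K ℕ.≤ n → ℚ.∣ x n ∣ ℚ.≤ A) →
        ∃[ L ] (∀ n → L ℕ.≤ n → ℚ.∣ y n ∣ ℚ.≤ B) →
        ∃[ M ] (∀ m n → M ℕ.≤ m → M ℕ.≤ n → ℚ.∣ x m ℚ.- x n ∣ ℚ.< δ) →
        ∃[ N ] (∀ m n → N ℕ.≤ m → N ℕ.≤ n → ℚ.∣ y m ℚ.- y n ∣ ℚ.< δ) →
        Goal
      combine A B δ A>0 B>0 eq (K , hA) (L , hB) (M , hx) (N , hy) =
        (K ℕ.⊔ L) ℕ.⊔ (M ℕ.⊔ N) , λ m n ≤m ≤n →
        let KL≤m = ℕ.m⊔n≤o⇒m≤o (K ℕ.⊔ L) (M ℕ.⊔ N) ≤m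
            MN≤m = ℕ.m⊔n≤o⇒n≤o (K ℕ.⊔ L) (M ℕ.⊔ N) ≤m
            KL≤n = ℕ.m⊔n≤o⇒m≤o (K ℕ.⊔ L) (M ℕ.⊔ N) ≤n
            MN≤n = ℕ.m⊔n≤o⇒n≤o (K ℕ.⊔ L) (M ℕ.⊔ N) ≤n
        in products-close A B δ ε (x m) (y m) (x n) (y n) A>0 B>0 eq
             (hA m (ℕ.m⊔n≤o⇒m≤o K L KL≤m))
             (hB n (ℕ.m⊔n≤o⇒n≤o K L KL≤n))
             (hx m n (ℕ.m⊔n≤o⇒m≤o M N MN≤m) (ℕ.m⊔n≤o⇒m≤o M N MN≤n))
             (hy m n (ℕ.m⊔n≤o⇒n≤o M N MN≤m) (ℕ.m⊔n≤o⇒n≤o M N MN≤n))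

      scale : EventuallyBounded x → EventuallyBounded y → Goal
      scale (A , A>0 , hA) (B , B>0 , hB) =
        let δ , 0<δ , eq = divide (A ℚ.+ B) ε (ℚ.pos+pos⇒pos A {{A>0}} B {{B>0}}) 0<ε
        in combine A B δ A>0 B>0 eq hA hB (cx δ 0<δ) (cy δ 0<δ)

    ∣p-q∣<ε⇒p<q+ε : ∀ p q {ε} → ℚ.∣ p ℚ.- q ∣ ℚ.< ε → p ℚ.< q ℚ.+ ε
    ∣p-q∣<ε⇒p<q+ε p q {ε} h = begin-strict
      p                        ≡⟨ solve 2 (λ a b → a := b :+ (a :- b)) refl p q ⟩
      q ℚ.+ (p ℚ.- q)          ≤⟨ ℚ.+-monoʳ-≤ q (p≤∣p∣ (p ℚ.- q)) ⟩
      q ℚ.+ ℚ.∣ p ℚ.- q ∣      <⟨ ℚ.+-monoʳ-< q h ⟩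
      q ℚ.+ ε ∎
      where
      open ℚ.≤-Reasoning
      p≤∣p∣ : ∀ r → r ℚ.≤ ℚ.∣ r ∣
      p≤∣p∣ r with ℚ.≤-total 0ℚ r
      ... | inj₁ 0≤r = ℚ.≤-reflexive (sym (ℚ.0≤p⇒∣p∣≡p 0≤r))
      ... | inj₂ r≤0 = ℚ.≤-trans r≤0 (ℚ.0≤∣p∣ r)

    p<q+ε∧q<p+ε⇒∣p-q∣<ε : ∀ p q {ε} → p ℚ.< q ℚ.+ ε → q ℚ.< p ℚ.+ ε → ℚ.∣ p ℚ.- q ∣ ℚ.< ε
    p<q+ε∧q<p+ε⇒∣p-q∣<ε p q {ε} h k with ℚ.∣p∣≡p∨∣p∣≡-p (p ℚ.- q)
    ... | inj₁ eq = begin-strict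
      ℚ.∣ p ℚ.- q ∣    ≡⟨ eq ⟩
      p ℚ.- q          <⟨ ℚ.+-monoˡ-< (ℚ.- q) h ⟩
      q ℚ.+ ε ℚ.- q    ≡⟨ solve 2 (λ b e → b :+ e :- b := e) refl q ε ⟩
      ε ∎
      where open ℚ.≤-Reasoning
    ... | inj₂ eq = begin-strict
      ℚ.∣ p ℚ.- q ∣    ≡⟨ eq ⟩
      ℚ.- (p ℚ.- q)    ≡⟨ solve 2 (λ a b → :- (a :- b) := b :- a) refl p q ⟩
      q ℚ.- p          <⟨ ℚ.+-monoˡ-< (ℚ.- p) k ⟩
      p ℚ.+ ε ℚ.- p    ≡⟨ solve 2 (λ b e → b :+ e :- b := e) refl p ε ⟩
      ε ∎
      where open ℚ.≤-Reasoning

    ⊔-<-+ : ∀ p q p′ q′ {ε} → p ℚ.< p′ ℚ.+ ε → q ℚ.< q′ ℚ.+ ε → p ℚ.⊔ q ℚ.< (p′ ℚ.⊔ q′) ℚ.+ ε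
    ⊔-<-+ p q p′ q′ {ε} h k with ℚ.⊔-sel p q
    ... | inj₁ eq = subst (ℚ._< (p′ ℚ.⊔ q′) ℚ.+ ε) (sym eq)
      (ℚ.<-≤-trans h (ℚ.+-monoˡ-≤ ε (ℚ.p≤p⊔q p′ q′)))
    ... | inj₂ eq = subst (ℚ._< (p′ ℚ.⊔ q′) ℚ.+ ε) (sym eq)
      (ℚ.<-≤-trans k (ℚ.+-monoˡ-≤ ε (ℚ.p≤q⊔p p′ q′)))

    ∣p-q∣≡∣q-p∣ : ∀ p q → ℚ.∣ p ℚ.- q ∣ ≡ ℚ.∣ q ℚ.- p ∣
    ∣p-q∣≡∣q-p∣ p q = trans
      (cong ℚ.∣_∣ (solve 2 (λ a b → a :- b := :- (b :- a)) refl p q))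
      (ℚ.∣-p∣≡∣p∣ (q ℚ.- p))

    ⊔-cauchy : ∀ {x y} → IsCauchy x → IsCauchy y → IsCauchy (λ n → x n ℚ.⊔ y n)
    ⊔-cauchy {x} {y} cx cy ε 0<ε
      with M , hx ← cx ε 0<ε | N , hy ← cy ε 0<ε
      = M ℕ.⊔ N , λ m n ≤m ≤n →
        let M≤m = ℕ.m⊔n≤o⇒m≤o M N ≤m
            M≤n = ℕ.m⊔n≤o⇒m≤o M N ≤n
            N≤m = ℕ.m⊔n≤o⇒n≤o M N ≤m
            N≤n = ℕ.m⊔n≤o⇒n≤o M N ≤n
        in p<q+ε∧q<p+ε⇒∣p-q∣<ε (x m ℚ.⊔ y m) (x n ℚ.⊔ y n)
          (⊔-<-+ (x m) (y m) (x n) (y n)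
            (∣p-q∣<ε⇒p<q+ε (x m) (x n) (hx m n M≤m M≤n))
            (∣p-q∣<ε⇒p<q+ε (y m) (y n) (hy m n N≤m N≤n)))
          (⊔-<-+ (x n) (y n) (x m) (y m)
            (∣p-q∣<ε⇒p<q+ε (x n) (x m) (hx n m M≤n M≤m))
            (∣p-q∣<ε⇒p<q+ε (y n) (y m) (hy n m N≤n N≤m)))

fromℚ : ℚ → ℝ
fromℚ q = mkℝ (λ _ → q) (const-cauchy q)

fromℕ : ℕ → ℝ
fromℕ n = fromℚ (+ n ℚ./ 1)

infix  8 -_
infixl 7 _*_
infixl 6 _+_ _-_ _⊔_

_+_ : ℝ → ℝ → ℝ
x + y = mkℝ (λ n → seq x n ℚ.+ seq y n) (+-cauchy {seq x} {seq y} (cauchy x) (cauchy y))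

_*_ : ℝ → ℝ → ℝ
x * y = mkℝ (λ n → seq x n ℚ.* seq y n) (*-cauchy {seq x} {seq y} (cauchy x) (cauchy y))

-_ : ℝ → ℝ
- x = mkℝ (λ n → ℚ.- seq x n) (-‿cauchy {seq x} (cauchy x))

_-_ : ℝ → ℝ → ℝ
x - y = x + - y

_⊔_ : ℝ → ℝ → ℝ
x ⊔ y = mkℝ (λ n → seq x n ℚ.⊔ seq y n) (⊔-cauchy {seq x} {seq y} (cauchy x) (cauchy y))

0ℝ 1ℝ : ℝ
0ℝ = fromℚ 0ℚ
1ℝ = fromℚ 1ℚ

ℝ-rawRing : RawRing 0ℓ 0ℓ
ℝ-rawRing = record
  { Carrier = ℝ
  ; _≈_     = _≈_
  ; _+_     = _+_
  ; _*_     = _*_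
  ; -_      = -_
  ; 0#      = 0ℝ
  ; 1#      = 1ℝ
  }

------------------------------------------------------------------------
-- Square matrices and spectra

Matrix : Set → ℕ → Set
Matrix A n = Fin n → Fin n → A

module Determinant (R : RawRing 0ℓ 0ℓ) where
  private
    module R = RawRing R
    open RawSemiringDefs R.rawSemiring using (sum; _^_)

  -- Laplace expansion along the first row.
  det : ∀ {n} → Matrix R.Carrier n → R.Carrier
  det {ℕ.zero}  M = R.1#
  det {ℕ.suc n} M = sum λ j →
    ((R.- R.1#) ^ toℕ j) R.* M zero j R.* det (λ i k → M (suc i) (punchIn j k))

open Determinant ℝ-rawRing public using (det)
open RawSemiringDefs (RawRing.rawSemiring ℝ-rawRing) public using (product)

diagonal : ∀ {n} → Vector ℝ n → Matrix ℝ n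
diagonal d i j = if does (i Fin.≟ j) then d i else 0ℝ

characteristic : ∀ {n} → Matrix ℝ n → ℝ → ℝ
characteristic M x = det (λ i j → diagonal (λ _ → x) i j - M i j)

-- ev lists the eigenvalues of M with multiplicity, in nondecreasing order.
-- Equality of the polynomials det (X I − M) and ∏ᵢ (X − evᵢ) is expressed by
-- equality at every real, which is the same thing since ℝ is infinite.
record IsSpectrum {n : ℕ} (M : Matrix ℝ n) (ev : Vector ℝ n) : Set where
  field
    sorted : Monotonic₁ Fin._≤_ _≤_ ev
    roots  : ∀ x → characteristic M x ≈ product (λ i → x - ev i)

-- Fin is 0-based, so λ₂ has index 1; note that 2 ≤ n unfolds to 1 < n.
second : ∀ {n} → n ℕ.≥ 2 → Vector ℝ n → ℝ
second n≥2 ev = ev (fromℕ< n≥2)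

------------------------------------------------------------------------
-- Graphs

-- The vertex set is Fin n, so n is the order.
record Graph (n : ℕ) : Set₁ where
  infix 4 _~_ _~?_
  field
    _~_      : Rel (Fin n) 0ℓ
    _~?_     : Decidable _~_
    ~-sym    : Symmetric _~_
    ~-irrefl : Irreflexive _≡_ _~_

  degree : Fin n → ℕ
  degree i = length (filter (i ~?_) (allFin n))

  adjacency : Matrix ℝ n
  adjacency i j = if does (i ~? j) then 1ℝ else 0ℝ

  laplacian : Matrix ℝ n
  laplacian i j = diagonal (fromℕ ∘ degree) i j - adjacency i j

open Graph public using (laplacian)

complement : ∀ {n} → Graph n → Graph n
complement G = record
  { _~_      = λ i j → i ≢ j × ¬ (i ~ j)
  ; _~?_     = λ i j → ¬? (i Fin.≟ j) ×-dec ¬? (i ~? j)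
  ; ~-sym    = λ (i≢j , i≁j) → ≢-sym i≢j , i≁j ∘ Graph.~-sym G
  ; ~-irrefl = λ i≡j (i≢j , _) → i≢j i≡j
  }
  where open Graph G using (_~_; _~?_)

{-# OPTIONS --safe #-}
-- Let λ₂(G) and λ₂(Ḡ) both be below 2/5. By the Rayleigh principle there are mean-zero
-- vectors of small Dirichlet energy on G and on Ḡ, and lowering extreme entries that are
-- too steep makes the slopes at their extremes as gentle as those of an eigenvector: x
-- with maximum a and minimum b for G, and y with maximum c and minimum d for Ḡ. Hence x
-- stays within 2/5 of its extreme value on the neighbours of a and of b, so that no vertex
-- is adjacent to both, and likewise for y, c, d in Ḡ. This forces the induced path
-- a – d – c – b in G, and every vertex pays a constant share of energy for its pairs with
-- these four hubs. The total exceeds what the ranges of x and y allow.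
--
-- The Rayleigh principle is obtained from the characteristic polynomial alone. If
-- xᵀ L x ≥ q |x|² for all mean-zero x, then r I − L − (q / n) J is negative definite for
-- r < q, and elimination gives |det (r I − L)| ≥ (q − r)ⁿ⁻¹ |r|. A root below q is
-- therefore 0, and not a double one.
module Submission where

import Defs
open import Algebra.Bundles using (CommutativeRing)
open import Algebra.Bundles.Raw using (RawRing)
import Algebra.Definitions.RawSemiring as RawSemiringDefs
open import Data.Bool.Base using (if_then_else_; true; false)
open import Data.Empty using (⊥; ⊥-elim)
open import Data.Fin.Base as Fin using (Fin; zero; suc; toℕ; punchIn; punchOut)
import Data.Fin.Properties as Fin
open import Data.Integer.Base as ℤ using (+_)
import Data.Integer.Properties as ℤ
open import Data.List.Base using (filter; length; tabulate)
open import Data.Nat.Base as ℕ using (ℕ; zero; suc)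
import Data.Nat.Properties as ℕ
open import Data.Product.Base using (∃-syntax; _×_; _,_; proj₁; proj₂)
open import Data.Rational.Base as ℚ hiding (_≥_; _⊔_)
open import Data.Rational.Properties as ℚ
open import Data.Rational.Unnormalised.Base as ℚᵘ using (mkℚᵘ; *<*)
import Data.Rational.Unnormalised.Properties as ℚᵘ
open import Data.Sum.Base using (_⊎_; inj₁; inj₂)
open import Data.Vec.Functional using (Vector; updateAt)
open import Data.Vec.Functional.Properties using (updateAt-updates; updateAt-minimal)
open import Function.Base using (_∘_; _$_; const)
open import Level using (0ℓ)
open import Relation.Binary.PropositionalEquality
open import Relation.Nullary.Decidable using (Dec; does; yes; no; dec⇒maybe; dec-true; dec-false)
open import Relation.Nullary.Negation using (¬_; contradiction)
open import Relation.Unary using (Pred; Decidable)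
open import Tactic.RingSolver using (solve-∀)
open import Tactic.RingSolver.Core.AlmostCommutativeRing using (AlmostCommutativeRing; fromCommutativeRing)

open import Algebra.Definitions.RawSemiring +-*-rawSemiring using (_^_)
open import Algebra.Properties.Semiring.Sum (CommutativeRing.semiring +-*-commutativeRing)
  using (sum; sum-cong-≗; ∑-distrib-+; ∑-comm; *-distribˡ-sum; *-distribʳ-sum; sum-remove; sum-replicate-zero)
open Defs using (ℝ; seq; cauchy; Matrix; characteristic; ℝ-rawRing; IsSpectrum; Graph; laplacian; complement)
open Defs.Determinant +-*-rawRing using (det)

-- Rational arithmetic and finite sums

-- Every pair of vertices is an edge of exactly one of the two graphs. An extreme vertex holds its
-- neighbours on its own side of 0, so a pair that the signs of `x` or `y` keep apart in one graph
-- is an edge of the other and is charged for there. The constants come from this count. A mode has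
-- range 1 and mean 0, hence |x|² ≤ n/4 and energy below n/5; the two energies together stay below
-- 2n/5. A neighbour of an extreme keeps 3/5 of its value, so an edge between such values at
-- opposite ends costs at least (3/5)² = 9/25. Since `energy` counts edges twice, n payments of 9/25
-- are worth 18n/25. The pairs c d and a b are charged by both of their ends, which is why the hubs
-- are counted separately. Eigenvectors need not be rational. The argument about vertices uses only
-- a bound on the quotient and the two slope inequalities, and rational vectors can satisfy these.
-- Keeping the quotient a fixed η below 2/5 gives every descent step a uniform gain, so the descent
-- ends.

ℚ-ring : AlmostCommutativeRing 0ℓ 0ℓ
ℚ-ring = fromCommutativeRing +-*-commutativeRing (λ x → dec⇒maybe (0ℚ ≟ x))

2ℚ : ℚ
2ℚ = 1ℚ + 1ℚ

-- Polynomial inequalities are proved by certificates: the difference `d` is given in a form whose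
-- sign is visible, and the equation is left to the ring solver.
≤-by : ∀ {p q} d → 0ℚ ≤ d → p + d ≡ q → p ≤ q
≤-by {p} d 0≤d eq = subst₂ _≤_ (+-identityʳ p) eq (+-monoʳ-≤ p 0≤d)

<-by : ∀ {p q} d → 0ℚ < d → p + d ≡ q → p < q
<-by {p} d 0<d eq = subst₂ _<_ (+-identityʳ p) eq (+-monoʳ-< p 0<d)

p≤q⇒0≤q-p : ∀ {p q} → p ≤ q → 0ℚ ≤ q - p
p≤q⇒0≤q-p {p} {q} p≤q = subst (_≤ q - p) (+-inverseʳ p) (+-monoˡ-≤ (- p) p≤q)

p<q⇒0<q-p : ∀ {p q} → p < q → 0ℚ < q - p
p<q⇒0<q-p {p} {q} p<q = subst (_< q - p) (+-inverseʳ p) (+-monoˡ-< (- p) p<q)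

+-nonneg : ∀ {p q} → 0ℚ ≤ p → 0ℚ ≤ q → 0ℚ ≤ p + q
+-nonneg = +-mono-≤

+-pos-nonneg : ∀ {p q} → 0ℚ < p → 0ℚ ≤ q → 0ℚ < p + q
+-pos-nonneg = +-mono-<-≤

*-nonneg : ∀ {p q} → 0ℚ ≤ p → 0ℚ ≤ q → 0ℚ ≤ p * q
*-nonneg {p} {q} 0≤p 0≤q = nonNegative⁻¹ (p * q)
  {{nonNeg*nonNeg⇒nonNeg p {{nonNegative 0≤p}} q {{nonNegative 0≤q}}}}

*-pos : ∀ {p q} → 0ℚ < p → 0ℚ < q → 0ℚ < p * q
*-pos {p} {q} 0<p 0<q = positive⁻¹ (p * q) {{pos*pos⇒pos p {{positive 0<p}} q {{positive 0<q}}}}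

infix 9 _²
_² : ℚ → ℚ
p ² = p * p

²-nonneg : ∀ p → 0ℚ ≤ p ²
²-nonneg p with ≤-total 0ℚ p
... | inj₁ 0≤p = *-nonneg 0≤p 0≤p
... | inj₂ p≤0 = subst (0ℚ ≤_) (neg-sq p) (*-nonneg 0≤-p 0≤-p)
  where
  0≤-p : 0ℚ ≤ - p
  0≤-p = neg-antimono-≤ p≤0
  neg-sq : ∀ p → - p * - p ≡ p * p
  neg-sq = solve-∀ ℚ-ring

sum-nonneg : ∀ {n} {f : Vector ℚ n} → (∀ i → 0ℚ ≤ f i) → 0ℚ ≤ sum f
sum-nonneg {zero}  0≤f = ≤-refl
sum-nonneg {suc n} 0≤f = +-nonneg (0≤f zero) (sum-nonneg (0≤f ∘ suc))

sum-mono : ∀ {n} {f g : Vector ℚ n} → (∀ i → f i ≤ g i) → sum f ≤ sum g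
sum-mono {zero}  f≤g = ≤-refl
sum-mono {suc n} f≤g = +-mono-≤ (f≤g zero) (sum-mono (f≤g ∘ suc))

sum-zero : ∀ {n} {f : Vector ℚ n} → (∀ i → f i ≡ 0ℚ) → sum f ≡ 0ℚ
sum-zero {n} f≡0 = trans (sum-cong-≗ f≡0) (sum-replicate-zero n)

sum-*ˡ : ∀ {n} c (f : Vector ℚ n) → sum (λ i → c * f i) ≡ c * sum f
sum-*ˡ c f = sym (*-distribˡ-sum c f)

sum-*ʳ : ∀ {n} c (f : Vector ℚ n) → sum (λ i → f i * c) ≡ sum f * c
sum-*ʳ c f = sym (*-distribʳ-sum c f)

sum-neg : ∀ {n} (f : Vector ℚ n) → sum (λ i → - f i) ≡ - sum f
sum-neg {zero}  f = refl
sum-neg {suc n} f = trans (cong (λ s → - f zero + s) (sum-neg (f ∘ suc))) (sym (neg-distrib-+ (f zero) _))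

sum-minus : ∀ {n} (f g : Vector ℚ n) → sum (λ i → f i - g i) ≡ sum f - sum g
sum-minus f g = trans (∑-distrib-+ f (λ i → - g i)) (cong (λ s → sum f + s) (sum-neg g))

δ : ∀ {n} → Fin n → Fin n → ℚ
δ i j = if does (i Fin.≟ j) then 1ℚ else 0ℚ

δ-refl : ∀ {n} (i : Fin n) → δ i i ≡ 1ℚ
δ-refl i rewrite dec-true (i Fin.≟ i) refl = refl

δ-≢ : ∀ {n} {i j : Fin n} → i ≢ j → δ i j ≡ 0ℚ
δ-≢ {i = i} {j} i≢j rewrite dec-false (i Fin.≟ j) i≢j = refl

sum-δ : ∀ {n} (i : Fin n) (f : Vector ℚ n) → sum (λ j → δ i j * f j) ≡ f i
sum-δ {suc n} zero f = trans
  (cong₂ _+_ (*-identityˡ (f zero)) (sum-zero (λ j → *-zeroˡ (f (suc j)))))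
  (+-identityʳ (f zero))
sum-δ {suc n} (suc i) f = trans
  (cong₂ _+_ (*-zeroˡ (f zero)) (sum-δ i (f ∘ suc)))
  (+-identityˡ (f (suc i)))

erase : ∀ {n} → Fin n → Vector ℚ n → Vector ℚ n
erase i f j = (1ℚ - δ i j) * f j

erase-≢ : ∀ {n} {i j : Fin n} (f : Vector ℚ n) → i ≢ j → erase i f j ≡ f j
erase-≢ {j = j} f i≢j = trans (cong (λ d → (1ℚ - d) * f j) (δ-≢ i≢j)) (*-identityˡ (f j))

erase-nonneg : ∀ {n} (i : Fin n) {f : Vector ℚ n} → (∀ j → 0ℚ ≤ f j) → ∀ j → 0ℚ ≤ erase i f j
erase-nonneg i {f} 0≤f j = *-nonneg 0≤1-δ (0≤f j)
  where
  0≤1-δ : 0ℚ ≤ 1ℚ - δ i j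
  0≤1-δ with does (i Fin.≟ j)
  ... | true  = ≤-refl
  ... | false = nonNegative⁻¹ 1ℚ

sum-extract : ∀ {n} (i : Fin n) (f : Vector ℚ n) → sum f ≡ f i + sum (erase i f)
sum-extract i f = begin
  sum f                                          ≡⟨ sum-cong-≗ (λ j → split (δ i j) (f j)) ⟩
  sum (λ j → δ i j * f j + erase i f j)          ≡⟨ ∑-distrib-+ (λ j → δ i j * f j) (erase i f) ⟩
  sum (λ j → δ i j * f j) + sum (erase i f)      ≡⟨ cong (_+ sum (erase i f)) (sum-δ i f) ⟩
  f i + sum (erase i f)                          ∎
  where
  open ≡-Reasoning
  split : ∀ d p → p ≡ d * p + (1ℚ - d) * p
  split = solve-∀ ℚ-ring

term≤sum : ∀ {n} {f : Vector ℚ n} → (∀ i → 0ℚ ≤ f i) → ∀ i → f i ≤ sum f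
term≤sum {f = f} 0≤f i = ≤-by (sum (erase i f)) (sum-nonneg (erase-nonneg i 0≤f)) (sym (sum-extract i f))

two-terms≤sum : ∀ {n} {f : Vector ℚ n} → (∀ i → 0ℚ ≤ f i) →
  ∀ {i j} → i ≢ j → f i + f j ≤ sum f
two-terms≤sum {f = f} 0≤f {i} {j} i≢j = begin
  f i + f j               ≡⟨ cong (λ s → f i + s) (sym (erase-≢ f i≢j)) ⟩
  f i + erase i f j       ≤⟨ +-monoʳ-≤ (f i) (term≤sum (erase-nonneg i 0≤f) j) ⟩
  f i + sum (erase i f)   ≡⟨ sym (sum-extract i f) ⟩
  sum f                   ∎
  where open ≤-Reasoning

four-terms≤sum : ∀ {n} {f : Vector ℚ n} → (∀ i → 0ℚ ≤ f i) →
  ∀ {i j k l} → i ≢ j → i ≢ k → i ≢ l → j ≢ k → j ≢ l → k ≢ l →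
  f i + (f j + (f k + f l)) ≤ sum f
four-terms≤sum {n} {f} 0≤f {i} {j} {k} {l} i≢j i≢k i≢l j≢k j≢l k≢l = begin
  f i + (f j + (f k + f l))      ≡⟨ cong (λ s → f i + s) (sym (cong₂ _+_ (erase-≢ f i≢j)
                                      (cong₂ _+_ (erase² j≢k i≢k) (erase² j≢l i≢l)))) ⟩
  f i + (g j + (h k + h l))      ≤⟨ +-monoʳ-≤ (f i) (+-monoʳ-≤ (g j)
                                      (two-terms≤sum (erase-nonneg j (erase-nonneg i 0≤f)) k≢l)) ⟩
  f i + (g j + sum h)            ≡⟨ cong (λ s → f i + s) (sym (sum-extract j g)) ⟩
  f i + sum g                    ≡⟨ sym (sum-extract i f) ⟩
  sum f                          ∎
  where
  open ≤-Reasoning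
  g = erase i f
  h = erase j g
  erase² : ∀ {m} → j ≢ m → i ≢ m → h m ≡ f m
  erase² j≢m i≢m = trans (erase-≢ g j≢m) (erase-≢ f i≢m)

argmax : ∀ {n} (f : Vector ℚ (suc n)) → ∃[ i ] (∀ j → f j ≤ f i)
argmax {zero}  f = zero , λ { zero → ≤-refl }
argmax {suc n} f with argmax (f ∘ suc)
... | i , f≤fi with ≤-total (f zero) (f (suc i))
...   | inj₁ f0≤fi = suc i , λ { zero → f0≤fi ; (suc j) → f≤fi j }
...   | inj₂ fi≤f0 = zero , λ { zero → ≤-refl ; (suc j) → ≤-trans (f≤fi j) fi≤f0 }

-- Dirichlet energy of a graph

2/5 3/5 4/5 9/25 : ℚ
2/5 = + 2 / 5
3/5 = + 3 / 5
4/5 = + 4 / 5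
9/25 = + 9 / 25

-- Written as a sum of ones because this is what sums of constants produce; `size≡fromℕ` links it to
-- the cast from ℕ.
size : ℕ → ℚ
size n = sum {n} (λ _ → 1ℚ)

norm² : ∀ {n} → Vector ℚ n → ℚ
norm² x = sum (λ i → (x i) ²)

module _ {n : ℕ} (G : Graph n) where
  open Graph G

  weight : Fin n → Fin n → ℚ
  weight i j = if does (i ~? j) then 1ℚ else 0ℚ

  weight-adj : ∀ {i j} → i ~ j → weight i j ≡ 1ℚ
  weight-adj {i} {j} i~j rewrite dec-true (i ~? j) i~j = refl

  weight-nonadj : ∀ {i j} → ¬ i ~ j → weight i j ≡ 0ℚ
  weight-nonadj {i} {j} i≁j rewrite dec-false (i ~? j) i≁j = refl

  weight-nonneg : ∀ i j → 0ℚ ≤ weight i j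
  weight-nonneg i j with does (i ~? j)
  ... | true  = nonNegative⁻¹ 1ℚ
  ... | false = ≤-refl

  weight-≤1 : ∀ i j → weight i j ≤ 1ℚ
  weight-≤1 i j with does (i ~? j)
  ... | true  = ≤-refl
  ... | false = nonNegative⁻¹ 1ℚ

  weight-sym : ∀ i j → weight i j ≡ weight j i
  weight-sym i j with i ~? j
  ... | yes i~j = sym (weight-adj (~-sym i~j))
  ... | no  i≁j = sym (weight-nonadj (i≁j ∘ ~-sym))

  edge-energy : Vector ℚ n → Fin n → Fin n → ℚ
  edge-energy x i j = weight i j * (x i - x j) ²

  -- Every edge is counted twice: energy x = 2 xᵀ L x.
  energy : Vector ℚ n → ℚ
  energy x = sum λ i → sum λ j → edge-energy x i j

  -- The i-th entry of L x.
  slope : Vector ℚ n → Fin n → ℚ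
  slope x i = sum λ j → weight i j * (x i - x j)

  edge-energy-nonneg : ∀ x i j → 0ℚ ≤ edge-energy x i j
  edge-energy-nonneg x i j = *-nonneg (weight-nonneg i j) (²-nonneg (x i - x j))

  edge-energy-adj : ∀ x {i j} → i ~ j → edge-energy x i j ≡ (x i - x j) ²
  edge-energy-adj x {i} {j} i~j = trans (cong (_* (x i - x j) ²) (weight-adj i~j)) (*-identityˡ _)

  edge-energy-refl : ∀ x i → edge-energy x i i ≡ 0ℚ
  edge-energy-refl x i = trans (cong (_* (x i - x i) ²) (weight-nonadj (~-irrefl refl))) (*-zeroˡ ((x i - x i) ²))

  edge-energy-sym : ∀ x i j → edge-energy x i j ≡ edge-energy x j i
  edge-energy-sym x i j = trans (cong (_* (x i - x j) ²) (weight-sym i j)) (flip-sq (weight j i) (x i) (x j))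
    where
    flip-sq : ∀ w p q → w * ((p - q) * (p - q)) ≡ w * ((q - p) * (q - p))
    flip-sq = solve-∀ ℚ-ring

  energy-nonneg : ∀ x → 0ℚ ≤ energy x
  energy-nonneg x = sum-nonneg λ i → sum-nonneg λ j → edge-energy-nonneg x i j

  -- By symmetry columns `i` and `j` of the energy table weigh as much as rows `i` and `j`. Rows and
  -- columns together are part of the table, except that the two entries for the pair `i`, `j` are
  -- then counted twice.
  energy≥two-rows : ∀ x {i j} → i ≢ j →
    2ℚ * sum (λ v → edge-energy x v i + edge-energy x v j) ≤ energy x + 2ℚ * edge-energy x i j
  energy≥two-rows x {i} {j} i≢j = ≤-by _ (p≤q⇒0≤q-p rest≥) (trans
      (cong₂ (λ s t → 2ℚ * s + (t - (rest i + rest j))) both-rows sum-rest)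
      (trans (cong₂ (λ p q → 2ℚ * (row i + row j) + ((energy x - (row i + row j)) - (p + q))) rest-i rest-j)
        (identity (row i) (row j) (energy x) (edge-energy x i j))))
    where
    row : Fin n → ℚ
    row v = sum λ u → edge-energy x v u

    column≡row : ∀ u → sum (λ v → edge-energy x v u) ≡ row u
    column≡row u = sum-cong-≗ λ v → edge-energy-sym x v u

    both-rows : sum (λ v → edge-energy x v i + edge-energy x v j) ≡ row i + row j
    both-rows = trans (∑-distrib-+ (λ v → edge-energy x v i) (λ v → edge-energy x v j))
      (cong₂ _+_ (column≡row i) (column≡row j))

    rest : Fin n → ℚ
    rest v = row v - (edge-energy x v i + edge-energy x v j)

    sum-rest : sum rest ≡ energy x - (row i + row j)
    sum-rest = trans (sum-minus row (λ v → edge-energy x v i + edge-energy x v j)) (cong (λ s → energy x - s) both-rows)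

    rest-nonneg : ∀ v → 0ℚ ≤ rest v
    rest-nonneg v = p≤q⇒0≤q-p (two-terms≤sum (edge-energy-nonneg x v) i≢j)

    rest≥ : rest i + rest j ≤ sum rest
    rest≥ = two-terms≤sum rest-nonneg i≢j

    rest-i : rest i ≡ row i - edge-energy x i j
    rest-i = cong (λ t → row i - t) (trans (cong (_+ edge-energy x i j) (edge-energy-refl x i)) (+-identityˡ _))

    rest-j : rest j ≡ row j - edge-energy x i j
    rest-j = cong (λ t → row j - t) (trans (cong₂ _+_ (edge-energy-sym x j i) (edge-energy-refl x j)) (+-identityʳ _))

    identity : ∀ a b e t → 2ℚ * (a + b) + ((e - (a + b)) - ((a - t) + (b - t))) ≡ e + 2ℚ * t
    identity = solve-∀ ℚ-ring

slope-neg : ∀ {n} (G : Graph n) (x : Vector ℚ n) i → slope G (λ i → - x i) i ≡ - slope G x i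
slope-neg G x i = trans (sum-cong-≗ λ j → odd (weight G i j) (x i) (x j)) (sum-neg (λ j → weight G i j * (x i - x j)))
  where
  odd : ∀ w p q → w * (- p - - q) ≡ - (w * (p - q))
  odd = solve-∀ ℚ-ring

energy-neg : ∀ {n} (G : Graph n) (x : Vector ℚ n) → energy G (λ i → - x i) ≡ energy G x
energy-neg G x = sum-cong-≗ λ i → sum-cong-≗ λ j → even (weight G i j) (x i) (x j)
  where
  even : ∀ w p q → w * ((- p - - q) * (- p - - q)) ≡ w * ((p - q) * (p - q))
  even = solve-∀ ℚ-ring

norm²-neg : ∀ {n} (x : Vector ℚ n) → norm² (λ i → - x i) ≡ norm² x
norm²-neg x = sum-cong-≗ λ i → even (x i)
  where
  even : ∀ p → - p * - p ≡ p * p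
  even = solve-∀ ℚ-ring

neg-neg : ∀ p → - (- p) ≡ p
neg-neg = solve-∀ ℚ-ring

-- A test vector of range 1 and of Rayleigh quotient below 2/5, whose
-- extreme entries obey the inequality that an eigenvector would satisfy there.
record Mode {n : ℕ} (G : Graph n) : Set where
  field
    x          : Vector ℚ n
    top bot    : Fin n
    mean-zero  : sum x ≡ 0ℚ
    ≤top       : ∀ i → x i ≤ x top
    bot≤       : ∀ i → x bot ≤ x i
    range      : x top ≡ x bot + 1ℚ
    top-pos    : 0ℚ < x top
    bot-neg    : x bot < 0ℚ
    top-slope  : slope G x top ≤ 2/5 * x top
    bot-slope  : 2/5 * x bot ≤ slope G x bot
    low-energy : energy G x < 4/5 * norm² x

  -- Summing (a - xᵢ)(xᵢ - b) ≥ 0 over a mean-zero vector gives |x|² ≤ -ab n, and -ab = (1 - (a +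
  -- b)²)/4 because a - b = 1.
  norm²≤ : 4/5 * norm² x ≤ + 1 / 5 * size n
  norm²≤ = ≤-by d 0≤d eq
    where
    a b : ℚ
    a = x top
    b = x bot
    defect : ∀ i → ℚ
    defect i = (a - x i) * (x i - b)
    gap : ℚ
    gap = (a + b) ²
    d : ℚ
    d = 4/5 * sum defect + + 1 / 5 * (gap * size n)
    0≤d : 0ℚ ≤ d
    0≤d = +-nonneg
      (*-nonneg (nonNegative⁻¹ 4/5) (sum-nonneg λ i →
        *-nonneg (p≤q⇒0≤q-p (≤top i)) (p≤q⇒0≤q-p (bot≤ i))))
      (*-nonneg (nonNegative⁻¹ (+ 1 / 5)) (*-nonneg (²-nonneg (a + b)) (sum-nonneg {n} λ _ → nonNegative⁻¹ 1ℚ)))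
    expand : ∀ i → x i ² + defect i ≡ (a + b) * x i + (- (a * b)) * 1ℚ
    expand i = identity (x i) a b
      where
      identity : ∀ p a b → p * p + (a - p) * (p - b) ≡ (a + b) * p + (- (a * b)) * 1ℚ
      identity = solve-∀ ℚ-ring
    total : norm² x + sum defect ≡ - (a * b) * size n
    total = begin
      norm² x + sum defect                                   ≡⟨ sym (∑-distrib-+ (λ i → x i ²) defect) ⟩
      sum (λ i → x i ² + defect i)                           ≡⟨ sum-cong-≗ expand ⟩
      sum (λ i → (a + b) * x i + - (a * b) * 1ℚ)             ≡⟨ ∑-distrib-+ (λ i → (a + b) * x i) (λ i → - (a * b) * 1ℚ) ⟩
      sum (λ i → (a + b) * x i) + sum {n} (λ i → - (a * b) * 1ℚ) ≡⟨ cong₂ _+_ (sum-*ˡ (a + b) x) (sum-*ˡ {n} (- (a * b)) (λ _ → 1ℚ)) ⟩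
      (a + b) * sum x + - (a * b) * size n                   ≡⟨ cong (λ s → (a + b) * s + - (a * b) * size n) mean-zero ⟩
      (a + b) * 0ℚ + - (a * b) * size n                      ≡⟨ cong (_+ - (a * b) * size n) (*-zeroʳ (a + b)) ⟩
      0ℚ + - (a * b) * size n                                ≡⟨ +-identityˡ _ ⟩
      - (a * b) * size n                                     ∎
      where open ≡-Reasoning
    eq : 4/5 * norm² x + d ≡ + 1 / 5 * size n
    eq = algebra (norm² x) (sum defect) (size n) a b range total
      where
      pull : ∀ p q m a b → 4/5 * p + (4/5 * q + + 1 / 5 * ((a + b) * (a + b) * m)) ≡ 4/5 * (p + q) + + 1 / 5 * ((a + b) * (a + b) * m)
      pull = solve-∀ ℚ-ring
      close : ∀ m b → 4/5 * (- ((b + 1ℚ) * b) * m) + + 1 / 5 * (((b + 1ℚ) + b) * ((b + 1ℚ) + b) * m) ≡ + 1 / 5 * m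
      close = solve-∀ ℚ-ring
      algebra : ∀ p q m a b → a ≡ b + 1ℚ → p + q ≡ - (a * b) * m →
        4/5 * p + (4/5 * q + + 1 / 5 * ((a + b) * (a + b) * m)) ≡ + 1 / 5 * m
      algebra p q m _ b refl e = trans (pull p q m (b + 1ℚ) b)
        (trans (cong (λ s → 4/5 * s + + 1 / 5 * (((b + 1ℚ) + b) * ((b + 1ℚ) + b) * m)) e) (close m b))

  open Graph G

  -- At a maximum all summands of the slope are nonnegative, so the drop to a single neighbour is at
  -- most the whole slope.
  near-top : ∀ {i} → top ~ i → 3/5 * x top ≤ x i
  near-top {i} top~i = ≤-by (2/5 * x top - (x top - x i)) (p≤q⇒0≤q-p drop) (identity (x top) (x i))
    where
    drop : x top - x i ≤ 2/5 * x top
    drop = begin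
      x top - x i                     ≡⟨ sym (*-identityˡ _) ⟩
      1ℚ * (x top - x i)              ≡⟨ cong (_* (x top - x i)) (sym (weight-adj G top~i)) ⟩
      weight G top i * (x top - x i)  ≤⟨ term≤sum (λ j → *-nonneg (weight-nonneg G top j) (p≤q⇒0≤q-p (≤top j))) i ⟩
      slope G x top                   ≤⟨ top-slope ⟩
      2/5 * x top                     ∎
      where open ≤-Reasoning
    identity : ∀ a p → 3/5 * a + (2/5 * a - (a - p)) ≡ p
    identity = solve-∀ ℚ-ring

-- The symmetry x ↦ -x yields each fact about `bot` from the one about `top`, and later lets the
-- sign of one of two modes be chosen.
reverse : ∀ {n} {G : Graph n} → Mode G → Mode G
reverse {n} {G} X = record
  { x          = λ i → - x i
  ; top        = bot
  ; bot        = top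
  ; mean-zero  = trans (sum-neg x) (cong -_ mean-zero)
  ; ≤top       = λ i → neg-antimono-≤ (bot≤ i)
  ; bot≤       = λ i → neg-antimono-≤ (≤top i)
  ; range      = trans (range′ (x bot)) (cong (λ p → - p + 1ℚ) (sym range))
  ; top-pos    = neg-antimono-< bot-neg
  ; bot-neg    = neg-antimono-< top-pos
  ; top-slope  = subst₂ _≤_ (sym (slope-neg G x bot)) (neg-distribʳ-* 2/5 (x bot)) (neg-antimono-≤ bot-slope)
  ; bot-slope  = subst₂ _≤_ (neg-distribʳ-* 2/5 (x top)) (sym (slope-neg G x top)) (neg-antimono-≤ top-slope)
  ; low-energy = subst₂ _<_ (sym (energy-neg G x)) (cong (λ s → 4/5 * s) (sym (norm²-neg x))) low-energy
  }
  where
  open Mode X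
  range′ : ∀ p → - p ≡ - (p + 1ℚ) + 1ℚ
  range′ = solve-∀ ℚ-ring

module _ {n : ℕ} {G : Graph n} (X : Mode G) where
  open Mode X
  open Graph G using (_~_)

  reflect-bot : ∀ {p} → 3/5 * - x bot ≤ - p → p ≤ 3/5 * x bot
  reflect-bot {p} h = subst₂ _≤_ (neg-neg p)
    (trans (cong -_ (sym (neg-distribʳ-* 3/5 (x bot)))) (neg-neg (3/5 * x bot))) (neg-antimono-≤ h)

  near-bot : ∀ {i} → bot ~ i → x i ≤ 3/5 * x bot
  near-bot bot~i = reflect-bot (Mode.near-top (reverse X) bot~i)

-- The modes of a graph and of its complement

-- Here p - q = 3/5 + u with u ≥ 0, and the certificate is the expanded square.
square-gap : ∀ {p q a b} → 3/5 * a ≤ p → q ≤ 3/5 * b → a ≡ b + 1ℚ → 9/25 ≤ (p - q) ²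
square-gap {p} {q} {a} {b} lo hi refl =
  ≤-by _ (+-nonneg (²-nonneg u) (*-nonneg (nonNegative⁻¹ (+ 6 / 5)) 0≤u)) (identity p q b)
  where
  u : ℚ
  u = (p - 3/5 * (b + 1ℚ)) + (3/5 * b - q)
  0≤u : 0ℚ ≤ u
  0≤u = +-nonneg (p≤q⇒0≤q-p lo) (p≤q⇒0≤q-p hi)
  identity : ∀ p q b → let u = (p - 3/5 * (b + 1ℚ)) + (3/5 * b - q) in
    9/25 + (u * u + + 6 / 5 * u) ≡ (p - q) * (p - q)
  identity = solve-∀ ℚ-ring

square-flip : ∀ p q → (p - q) ² ≡ (q - p) ²
square-flip p q = identity p q
  where
  identity : ∀ p q → (p - q) * (p - q) ≡ (q - p) * (q - p)
  identity = solve-∀ ℚ-ring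

-- The cost of a path a – p – q – b of height 1 whose middle step is at least 3/5.
path-cost : ∀ {a b p q} → 3/5 * a ≤ p → q ≤ 3/5 * b → a ≡ b + 1ℚ →
  + 11 / 25 ≤ (p - q) ² + ((a - p) ² + (b - q) ²)
path-cost {a} {b} {p} {q} lo hi refl = ≤-by _
  (+-nonneg (*-nonneg (nonNegative⁻¹ ½) (²-nonneg v))
    (+-nonneg (*-nonneg (nonNegative⁻¹ (+ 3 / 2)) (²-nonneg u)) (*-nonneg (nonNegative⁻¹ 4/5) 0≤u)))
  (identity p q b)
  where
  -- The middle step is 3/5 + u, so the outer steps add up to 2/5 - u; with `v` their difference,
  -- their squares sum to ((2/5 - u)² + v²)/2.
  u v : ℚ
  u = (p - 3/5 * (b + 1ℚ)) + (3/5 * b - q)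
  v = ((b + 1ℚ) - p) - (q - b)
  0≤u : 0ℚ ≤ u
  0≤u = +-nonneg (p≤q⇒0≤q-p lo) (p≤q⇒0≤q-p hi)
  identity : ∀ p q b → let u = (p - 3/5 * (b + 1ℚ)) + (3/5 * b - q); v = ((b + 1ℚ) - p) - (q - b) in
    + 11 / 25 + (½ * (v * v) + (+ 3 / 2 * (u * u) + 4/5 * u)) ≡
    (p - q) * (p - q) + (((b + 1ℚ) - p) * ((b + 1ℚ) - p) + (b - q) * (b - q))
  identity = solve-∀ ℚ-ring

-- Parallelogram law: the sum of squares is smallest at the midpoint, where it is (p - q)²/2.
detour : ∀ {p q} v → 9/25 ≤ (p - q) ² → + 9 / 50 ≤ (v - p) ² + (v - q) ²
detour {p} {q} v h = ≤-by _
  (+-nonneg (*-nonneg (nonNegative⁻¹ ½) (p≤q⇒0≤q-p h))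
    (*-nonneg (nonNegative⁻¹ ½) (²-nonneg ((v - p) + (v - q)))))
  (identity p q v)
  where
  identity : ∀ p q v → + 9 / 50 + (½ * ((p - q) * (p - q) - 9/25) + ½ * (((v - p) + (v - q)) * ((v - p) + (v - q))))
    ≡ (v - p) * (v - p) + (v - q) * (v - q)
  identity = solve-∀ ℚ-ring

3/5-pos : ∀ {p} → 0ℚ < p → 0ℚ < 3/5 * p
3/5-pos = *-pos (positive⁻¹ 3/5)

3/5-neg : ∀ {p} → p < 0ℚ → 3/5 * p < 0ℚ
3/5-neg {p} p<0 = subst (3/5 * p <_) (*-zeroʳ 3/5) (*-monoʳ-<-pos 3/5 p<0)

below≢above : ∀ {n} (f : Vector ℚ n) {i j} → f i < 0ℚ → 0ℚ < f j → j ≢ i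
below≢above f fi<0 0<fj refl = <-asym fi<0 0<fj

-- The two assumptions fix the sign of `Y` relative to `X`; the opposite sign is covered by passing
-- to `reverse Y`.
module Conflict {n : ℕ} (G : Graph n) (X : Mode G) (Y : Mode (complement G))
  (y-a : 3/5 * Mode.x Y (Mode.top Y) ≤ Mode.x Y (Mode.top X))
  (y-b : Mode.x Y (Mode.bot X) ≤ 3/5 * Mode.x Y (Mode.bot Y)) where

  open Mode X using (x) renaming (top to a; bot to b)
  open Mode Y using () renaming (x to y; top to c; bot to d)
  module X = Mode X
  module Y = Mode Y
  H : Graph n
  H = complement G
  open Graph G using (_~_; _~?_; ~-sym)
  open Graph H using () renaming (_~_ to _≈_; ~-sym to ≈-sym)

  0<ya : 0ℚ < y a
  0<ya = <-≤-trans (3/5-pos Y.top-pos) y-a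

  yb<0 : y b < 0ℚ
  yb<0 = ≤-<-trans y-b (3/5-neg Y.bot-neg)

  a≢b : a ≢ b
  a≢b = below≢above x X.bot-neg X.top-pos

  c≢d : c ≢ d
  c≢d = below≢above y Y.bot-neg Y.top-pos

  c≢b : c ≢ b
  c≢b = below≢above y yb<0 Y.top-pos

  a≢d : a ≢ d
  a≢d = below≢above y Y.bot-neg 0<ya

  ≁⇒~ : ∀ {i j} → i ≢ j → ¬ i ≈ j → i ~ j
  ≁⇒~ {i} {j} i≢j i≉j with i ~? j
  ... | yes i~j = i~j
  ... | no  i≁j = contradiction (i≢j , i≁j) i≉j

  between : ∀ {z p q} → p < 0ℚ → 0ℚ < q → 3/5 * q ≤ z → z ≤ 3/5 * p → ⊥
  between p<0 0<q lo hi = <-asym (≤-<-trans (≤-trans lo hi) (3/5-neg p<0)) (3/5-pos 0<q)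

  -- If the pair were joined in `H`, then `c` would force `y b` to be positive. Each of the
  -- following hub pairs is likewise excluded from one graph by a sign, and so lies in the other.
  b~c : b ~ c
  b~c = ~-sym (≁⇒~ c≢b λ c≈b →
    <-asym yb<0 (<-≤-trans (3/5-pos Y.top-pos) (Y.near-top c≈b)))

  a~d : a ~ d
  a~d = ~-sym (≁⇒~ (a≢d ∘ sym) λ d≈a →
    <-asym (≤-<-trans (near-bot Y d≈a) (3/5-neg Y.bot-neg)) 0<ya)

  x-d : 3/5 * x a ≤ x d
  x-d = X.near-top a~d

  x-c : x c ≤ 3/5 * x b
  x-c = near-bot X b~c

  0<xd : 0ℚ < x d
  0<xd = <-≤-trans (3/5-pos X.top-pos) x-d

  xc<0 : x c < 0ℚ
  xc<0 = ≤-<-trans x-c (3/5-neg X.bot-neg)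

  a≢c : a ≢ c
  a≢c = below≢above x xc<0 X.top-pos

  d≢b : d ≢ b
  d≢b = below≢above x X.bot-neg 0<xd

  a≈b : a ≈ b
  a≈b = a≢b , λ a~b → <-asym X.bot-neg (<-≤-trans (3/5-pos X.top-pos) (X.near-top a~b))

  c~d : c ~ d
  c~d = ≁⇒~ c≢d λ c≈d → <-asym Y.bot-neg (<-≤-trans (3/5-pos Y.top-pos) (Y.near-top c≈d))

  a≈c : a ≈ c
  a≈c = a≢c , λ a~c → <-asym xc<0 (<-≤-trans (3/5-pos X.top-pos) (X.near-top a~c))

  b≈d : b ≈ d
  b≈d = d≢b ∘ sym , λ b~d → <-asym (≤-<-trans (near-bot X b~d) (3/5-neg X.bot-neg)) 0<xd

  f g : Fin n → Fin n → ℚ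
  f = edge-energy G x
  g = edge-energy H y

  -- `x` differs by at least 3/5 between `c` and `d`, and `y` between `a` and `b`. Hence a vertex
  -- cannot be cheaply joined to both `c` and `d` in `G`, nor to both `a` and `b` in `H`.
  pay : Fin n → ℚ
  pay v = (f v c + f v d) + (g v a + g v b)

  f-nonneg : ∀ i j → 0ℚ ≤ f i j
  f-nonneg = edge-energy-nonneg G x

  g-nonneg : ∀ i j → 0ℚ ≤ g i j
  g-nonneg = edge-energy-nonneg H y

  f-adj : ∀ {i j} → i ~ j → f i j ≡ (x i - x j) ²
  f-adj = edge-energy-adj G x

  g-adj : ∀ {i j} → i ≈ j → g i j ≡ (y i - y j) ²
  g-adj = edge-energy-adj H y

  pay≥f : ∀ {v p} → p ≤ f v c + f v d → p ≤ pay v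
  pay≥f {v} h = ≤-trans h (≤-by (g v a + g v b) (+-nonneg (g-nonneg v a) (g-nonneg v b)) refl)

  pay≥g : ∀ {v p} → p ≤ g v a + g v b → p ≤ pay v
  pay≥g {v} h = ≤-trans h (≤-by (f v c + f v d) (+-nonneg (f-nonneg v c) (f-nonneg v d))
    (+-comm (g v a + g v b) (f v c + f v d)))

  pay≥fc : ∀ {v p} → p ≤ f v c → p ≤ pay v
  pay≥fc {v} h = pay≥f {v} (≤-trans h (≤-by (f v d) (f-nonneg v d) refl))

  pay≥fd : ∀ {v p} → p ≤ f v d → p ≤ pay v
  pay≥fd {v} h = pay≥f {v} (≤-trans h (≤-by (f v c) (f-nonneg v c) (+-comm (f v d) (f v c))))

  pay≥ga : ∀ {v p} → p ≤ g v a → p ≤ pay v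
  pay≥ga {v} h = pay≥g {v} (≤-trans h (≤-by (g v b) (g-nonneg v b) refl))

  pay≥gb : ∀ {v p} → p ≤ g v b → p ≤ pay v
  pay≥gb {v} h = pay≥g {v} (≤-trans h (≤-by (g v a) (g-nonneg v a) (+-comm (g v b) (g v a))))

  x-gap : ∀ {p q} → 3/5 * x a ≤ p → q ≤ 3/5 * x b → 9/25 ≤ (p - q) ²
  x-gap lo hi = square-gap {a = x a} {b = x b} lo hi X.range

  y-gap : ∀ {p q} → 3/5 * y c ≤ p → q ≤ 3/5 * y d → 9/25 ≤ (p - q) ²
  y-gap lo hi = square-gap {a = y c} {b = y d} lo hi Y.range

  xd-xc : 9/25 ≤ (x d - x c) ²
  xd-xc = x-gap x-d x-c

  ya-yb : 9/25 ≤ (y a - y b) ²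
  ya-yb = y-gap y-a y-b

  -- In this and the next three lemmas one edge suffices: `v` lies near one extreme and is joined to
  -- a hub near the opposite one.
  pay-fc : ∀ {v} → v ~ c → 3/5 * x a ≤ x v → 9/25 ≤ pay v
  pay-fc {v} v~c lo = pay≥fc {v} (subst (9/25 ≤_) (sym (f-adj v~c)) (x-gap lo x-c))

  pay-fd : ∀ {v} → v ~ d → x v ≤ 3/5 * x b → 9/25 ≤ pay v
  pay-fd {v} v~d hi = pay≥fd {v} (subst (9/25 ≤_)
    (trans (square-flip (x d) (x v)) (sym (f-adj v~d))) (x-gap x-d hi))

  pay-gb : ∀ {v} → v ≈ b → 3/5 * y c ≤ y v → 9/25 ≤ pay v
  pay-gb {v} v≈b lo = pay≥gb {v} (subst (9/25 ≤_) (sym (g-adj v≈b)) (y-gap lo y-b))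

  pay-ga : ∀ {v} → v ≈ a → y v ≤ 3/5 * y d → 9/25 ≤ pay v
  pay-ga {v} v≈a hi = pay≥ga {v} (subst (9/25 ≤_)
    (trans (square-flip (y a) (y v)) (sym (g-adj v≈a))) (y-gap y-a hi))

  -- Here no single edge need be expensive; each graph contributes half of 9/25 through a detour
  -- between two distant hubs.
  pay-mid : ∀ {v} → v ~ c → v ~ d → v ≈ a → v ≈ b → 9/25 ≤ pay v
  pay-mid {v} v~c v~d v≈a v≈b = +-mono-≤
    (subst (+ 9 / 50 ≤_) (trans (+-comm ((x v - x d) ²) ((x v - x c) ²))
      (sym (cong₂ _+_ (f-adj v~c) (f-adj v~d)))) (detour (x v) xd-xc))
    (subst (+ 9 / 50 ≤_) (sym (cong₂ _+_ (g-adj v≈a) (g-adj v≈b))) (detour (y v) ya-yb))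

  -- A vertex outside the four hubs to which none of the first four cases applies
  -- is joined to a and b in H and to c and d in G.
  pay-outside : ∀ v → v ≢ a → v ≢ b → v ≢ c → v ≢ d → 9/25 ≤ pay v
  pay-outside v v≢a v≢b v≢c v≢d = cases (v ~? a) (v ~? b) (v ~? c) (v ~? d)
    where
    cases : Dec (v ~ a) → Dec (v ~ b) → Dec (v ~ c) → Dec (v ~ d) → 9/25 ≤ pay v
    cases (yes va) _        (yes vc) _        = pay-fc vc (X.near-top (~-sym va))
    cases _        (yes vb) _        (yes vd) = pay-fd vd (near-bot X (~-sym vb))
    cases _        (no vb)  (no vc)  _        = pay-gb (v≢b , vb) (Y.near-top (≈-sym (v≢c , vc)))
    cases (no va)  _        _        (no vd)  = pay-ga (v≢a , va) (near-bot Y (≈-sym (v≢d , vd)))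
    cases (yes va) (yes vb) (no _)   (no _)   =
      ⊥-elim (between X.bot-neg X.top-pos (X.near-top (~-sym va)) (near-bot X (~-sym vb)))
    cases (no va)  (no vb)  (yes vc) (yes vd) = pay-mid vc vd (v≢a , va) (v≢b , vb)

  η≤gab : 9/25 ≤ g a b
  η≤gab = subst (9/25 ≤_) (sym (g-adj a≈b)) ya-yb

  ξ≤fcd : 9/25 ≤ f c d
  ξ≤fcd = subst (9/25 ≤_) (trans (square-flip (x d) (x c)) (sym (f-adj c~d))) xd-xc

  f-dc : f d c ≡ f c d
  f-dc = edge-energy-sym G x d c

  g-ba : g b a ≡ g a b
  g-ba = edge-energy-sym H y b a

  pay≥9/25 : ∀ v → 9/25 ≤ pay v
  pay≥9/25 v = cases (v Fin.≟ a) (v Fin.≟ b) (v Fin.≟ c) (v Fin.≟ d)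
    where
    cases : Dec (v ≡ a) → Dec (v ≡ b) → Dec (v ≡ c) → Dec (v ≡ d) → 9/25 ≤ pay v
    cases (yes refl) _ _ _ = pay≥gb {a} η≤gab
    cases _ (yes refl) _ _ = pay≥ga {b} (subst (9/25 ≤_) (sym g-ba) η≤gab)
    cases _ _ (yes refl) _ = pay≥fd {c} ξ≤fcd
    cases _ _ _ (yes refl) = pay≥fc {d} (subst (9/25 ≤_) (sym f-dc) ξ≤fcd)
    cases (no va) (no vb) (no vc) (no vd) = pay-outside v va vb vc vd

  x-path : + 11 / 25 ≤ f c d + (f a d + f b c)
  x-path = subst (+ 11 / 25 ≤_)
    (sym (cong₂ _+_ (trans (f-adj c~d) (square-flip (x c) (x d))) (cong₂ _+_ (f-adj a~d) (f-adj b~c))))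
    (path-cost {x a} {x b} x-d x-c X.range)

  -- The complement of a path on four vertices is again such a path: in `H` the hubs form c - a - b
  -- - d.
  y-path : + 11 / 25 ≤ g a b + (g c a + g d b)
  y-path = subst (+ 11 / 25 ≤_)
    (sym (cong₂ _+_ (g-adj a≈b) (cong₂ _+_ (g-adj (≈-sym a≈c)) (g-adj (≈-sym b≈d)))))
    (path-cost {y c} {y d} y-a y-b Y.range)

  -- The bound 9/25 is used only away from the hubs; the payments of the hubs are kept exactly for
  -- the final count.
  four-pays : (pay a - 9/25) + ((pay b - 9/25) + ((pay c - 9/25) + (pay d - 9/25)))
    ≤ sum pay - 9/25 * size n
  four-pays = subst (((pay a - 9/25) + ((pay b - 9/25) + ((pay c - 9/25) + (pay d - 9/25)))) ≤_)
    (trans (sum-minus pay (λ _ → 9/25)) (cong (λ s → sum pay - s) (sum-*ˡ {n} 9/25 (λ _ → 1ℚ))))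
    (four-terms≤sum {f = λ v → pay v - 9/25} (p≤q⇒0≤q-p ∘ pay≥9/25)
      a≢b a≢c a≢d (c≢b ∘ sym) (d≢b ∘ sym) c≢d)

  four≤size : + 4 / 1 ≤ size n
  four≤size = four-terms≤sum {f = λ _ → 1ℚ} (λ _ → nonNegative⁻¹ 1ℚ)
    a≢b a≢c a≢d (c≢b ∘ sym) (d≢b ∘ sym) c≢d

  sum-pay : sum pay ≡ sum (λ v → f v c + f v d) + sum (λ v → g v a + g v b)
  sum-pay = ∑-distrib-+ (λ v → f v c + f v d) (λ v → g v a + g v b)

  -- Both energies together are at least 2 ∑ pay - 2 (f c d + g a b). The hub payments contain f c d
  -- and g a b twice, and the outer steps of both paths once, so after the subtraction the hubs
  -- still contribute 2 (11/25 + 11/25) = 44/25. The total is at least 18/25 (n - 4) + 44/25, which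
  -- for n ≥ 4 exceeds 2n/5 by at least 4/25.
  impossible : ⊥
  impossible = <-asym (negative⁻¹ (- (+ 4 / 25))) (subst (0ℚ <_)
    (algebra (energy G x) (energy H y)
      (sum (λ v → f v c + f v d)) (sum (λ v → g v a + g v b)) (sum pay) (size n)
      (f a c) (f a d) (g a a) (g a b) (f b c) (f b d) (g b a) (g b b)
      (f c c) (f c d) (g c a) (g c b) (f d c) (f d d) (g d a) (g d b)
      sum-pay f-dc g-ba)
    (+-pos-nonneg (p<q⇒0<q-p (<-≤-trans X.low-energy X.norm²≤))
    (+-nonneg (p≤q⇒0≤q-p (<⇒≤ (<-≤-trans Y.low-energy Y.norm²≤)))
    (+-nonneg (p≤q⇒0≤q-p (energy≥two-rows G x c≢d))
    (+-nonneg (p≤q⇒0≤q-p (energy≥two-rows H y a≢b))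
    (+-nonneg (*-nonneg 0≤2 (p≤q⇒0≤q-p four-pays))
    (+-nonneg (*-nonneg 0≤2 (p≤q⇒0≤q-p x-path))
    (+-nonneg (*-nonneg 0≤2 (p≤q⇒0≤q-p y-path))
    (+-nonneg (*-nonneg (nonNegative⁻¹ (+ 8 / 25)) (p≤q⇒0≤q-p four≤size))
    (*-nonneg 0≤2 (+-nonneg (+-nonneg (f-nonneg a c) (g-nonneg a a)) (+-nonneg (+-nonneg (f-nonneg b d) (g-nonneg b b))
      (+-nonneg (+-nonneg (f-nonneg c c) (g-nonneg c b)) (+-nonneg (f-nonneg d d) (g-nonneg d a)))))))))))))))
    where
    0≤2 : 0ℚ ≤ 2ℚ
    0≤2 = nonNegative⁻¹ 2ℚ
    identity : ∀ e e′ s s′ n ac ad aa ab bc bd bb cc cd ca cb dd da db →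
      (+ 1 / 5 * n - e) + ((+ 1 / 5 * n - e′) + (((e + 2ℚ * cd) - 2ℚ * s) + (((e′ + 2ℚ * ab) - 2ℚ * s′) +
      (2ℚ * (((s + s′) - 9/25 * n) - (((ac + ad) + (aa + ab) - 9/25) + (((bc + bd) + (ab + bb) - 9/25) +
        (((cc + cd) + (ca + cb) - 9/25) + ((cd + dd) + (da + db) - 9/25))))) +
      (2ℚ * ((cd + (ad + bc)) - + 11 / 25) + (2ℚ * ((ab + (ca + db)) - + 11 / 25) +
      (+ 8 / 25 * (n - + 4 / 1) +
      2ℚ * ((ac + aa) + ((bd + bb) + ((cc + cb) + (dd + da)))))))))))
      ≡ - (+ 4 / 25)
    identity = solve-∀ ℚ-ring
    -- All quantities are generalised to variables, so that the three equations can be matched as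
    -- `refl` before the ring solver is applied.
    algebra : ∀ e e′ s s′ t n ac ad aa ab bc bd ba bb cc cd ca cb dc dd da db →
      t ≡ s + s′ → dc ≡ cd → ba ≡ ab →
      (+ 1 / 5 * n - e) + ((+ 1 / 5 * n - e′) + (((e + 2ℚ * cd) - 2ℚ * s) + (((e′ + 2ℚ * ab) - 2ℚ * s′) +
      (2ℚ * ((t - 9/25 * n) - (((ac + ad) + (aa + ab) - 9/25) + (((bc + bd) + (ba + bb) - 9/25) +
        (((cc + cd) + (ca + cb) - 9/25) + ((dc + dd) + (da + db) - 9/25))))) +
      (2ℚ * ((cd + (ad + bc)) - + 11 / 25) + (2ℚ * ((ab + (ca + db)) - + 11 / 25) +
      (+ 8 / 25 * (n - + 4 / 1) +
      2ℚ * ((ac + aa) + ((bd + bb) + ((cc + cb) + (dd + da)))))))))))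
      ≡ - (+ 4 / 25)
    algebra e e′ s s′ t n ac ad aa ab bc bd ba bb cc cd ca cb dc dd da db refl refl refl =
      identity e e′ s s′ n ac ad aa ab bc bd bb cc cd ca cb dd da db

module _ {n : ℕ} {G : Graph n} (X : Mode G) where
  open Mode X
  open Graph G using (_~_; _~?_; ~-sym)
  open Graph (complement G) using () renaming (_~_ to _≈_; ~-sym to ≈-sym)

  within-top : ∀ {i} → top ≡ i ⊎ top ~ i → 3/5 * x top ≤ x i
  within-top (inj₁ refl)  = ≤-by (2/5 * x top) (*-nonneg (nonNegative⁻¹ 2/5) (<⇒≤ top-pos)) (identity (x top))
    where
    identity : ∀ p → 3/5 * p + 2/5 * p ≡ p
    identity = solve-∀ ℚ-ring
  within-top (inj₂ top~i) = near-top top~i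

  -- A common neighbour of `top` and `bot` would have a value that is both positive and negative.
  top-or-bot : ∀ v → (v ≡ top ⊎ v ≈ top) ⊎ (v ≡ bot ⊎ v ≈ bot)
  top-or-bot v with v Fin.≟ top | v Fin.≟ bot | v ~? top | v ~? bot
  ... | yes v≡t | _       | _       | _       = inj₁ (inj₁ v≡t)
  ... | no _    | yes v≡b | _       | _       = inj₂ (inj₁ v≡b)
  ... | no v≢t  | no _    | no v≁t  | _       = inj₁ (inj₂ (v≢t , v≁t))
  ... | no _    | no v≢b  | yes _   | no v≁b  = inj₂ (inj₂ (v≢b , v≁b))
  ... | no _    | no _    | yes v~t | yes v~b = ⊥-elim (<-asym
    (≤-<-trans (≤-trans (near-top (~-sym v~t)) (near-bot X (~-sym v~b))) (3/5-neg bot-neg))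
    (3/5-pos top-pos))

within-bot : ∀ {n} {G : Graph n} (X : Mode G) → let open Mode X in
  ∀ {i} → bot ≡ i ⊎ Graph._~_ G bot i → x i ≤ 3/5 * x bot
within-bot X h = reflect-bot X (within-top (reverse X) h)

-- Each extreme of `Y` equals or is `H`-adjacent to an extreme of `X`. Both cannot be near the same
-- one, as `y` would have both signs there; so they are matched with the extremes of `X` in one of
-- two ways.
modes-incompatible : ∀ {n} {G : Graph n} → Mode G → Mode (complement G) → ⊥
modes-incompatible {n} {G} X Y = orient (sides Y.top) (sides Y.bot)
  where
  module X = Mode X
  module Y = Mode Y
  H : Graph n
  H = complement G
  open Graph H using (~-sym) renaming (_~_ to _≈_)

  Near : Fin n → Fin n → Set
  Near v u = v ≡ u ⊎ v ≈ u

  sides : ∀ v → Near v X.top ⊎ Near v X.bot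
  sides = top-or-bot X

  clash : ∀ u → Near Y.top u → Near Y.bot u → ⊥
  clash u t b = <-asym (<-≤-trans (3/5-pos Y.top-pos) (within-top Y t))
    (≤-<-trans (within-bot Y b) (3/5-neg Y.bot-neg))

  orient : Near Y.top X.top ⊎ Near Y.top X.bot → Near Y.bot X.top ⊎ Near Y.bot X.bot → ⊥
  orient (inj₁ t) (inj₁ b) = clash X.top t b
  orient (inj₂ t) (inj₂ b) = clash X.bot t b
  orient (inj₁ t) (inj₂ b) = Conflict.impossible G X Y (within-top Y t) (within-bot Y b)
  orient (inj₂ t) (inj₁ b) = Conflict.impossible G X (reverse Y)
    (within-top (reverse Y) b) (within-bot (reverse Y) t)

-- Descent to a mode

inverse : ∀ {p} → 0ℚ < p → ∃[ q ] (0ℚ < q × p * q ≡ 1ℚ)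
inverse {p} 0<p = (1/ p) {{p≢0}} , positive⁻¹ _ {{1/pos⇒pos p {{positive 0<p}}}} , *-inverseʳ p {{p≢0}}
  where
  p≢0 : ℚ.NonZero p
  p≢0 = pos⇒nonZero p {{positive 0<p}}

fromℕ-suc : ∀ n → + suc n / 1 ≡ 1ℚ + + n / 1
fromℕ-suc n = toℚᵘ-injective (begin
  toℚᵘ (+ suc n / 1)              ≈⟨ toℚᵘ-fromℚᵘ (mkℚᵘ (+ suc n) 0) ⟩
  mkℚᵘ (+ suc n) 0                ≈⟨ ℚᵘ.*≡* (cong (λ i → (+ 1 ℤ.+ i) ℤ.* + 1) (sym (ℤ.*-identityʳ (+ n)))) ⟩
  ℚᵘ.1ℚᵘ ℚᵘ.+ mkℚᵘ (+ n) 0        ≈⟨ ℚᵘ.+-congʳ ℚᵘ.1ℚᵘ (ℚᵘ.≃-sym (toℚᵘ-fromℚᵘ (mkℚᵘ (+ n) 0))) ⟩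
  ℚᵘ.1ℚᵘ ℚᵘ.+ toℚᵘ (+ n / 1)      ≈⟨ ℚᵘ.≃-sym (toℚᵘ-homo-+ 1ℚ (+ n / 1)) ⟩
  toℚᵘ (1ℚ + + n / 1)             ∎)
  where open ℚᵘ.≃-Reasoning

size≡fromℕ : ∀ n → size n ≡ + n / 1
size≡fromℕ zero    = refl
size≡fromℕ (suc n) = trans (cong (λ s → 1ℚ + s) (size≡fromℕ n)) (sym (fromℕ-suc n))

archimedean : ∀ p → ∃[ k ] p < size k
archimedean p@(mkℚ _ _ _) = k , subst (p <_) (sym (size≡fromℕ k)) (toℚᵘ-cancel-< (begin-strict
  toℚᵘ p             <⟨ *<* bound ⟩
  mkℚᵘ (+ k) 0       ≃⟨ ℚᵘ.≃-sym (toℚᵘ-fromℚᵘ (mkℚᵘ (+ k) 0)) ⟩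
  toℚᵘ (+ k / 1)     ∎))
  where
  open ℚᵘ.≤-Reasoning
  k : ℕ
  k = suc ℤ.∣ ↥ p ∣
  i≤∣i∣ : ∀ i → i ℤ.≤ + ℤ.∣ i ∣
  i≤∣i∣ (+ _)        = ℤ.≤-refl
  i≤∣i∣ (ℤ.-[1+ _ ]) = ℤ.-≤+
  bound : ↥ p ℤ.* + 1 ℤ.< + k ℤ.* ↧ p
  bound = ℤ.≤-<-trans
    (ℤ.≤-trans (ℤ.≤-reflexive (ℤ.*-identityʳ (↥ p))) (i≤∣i∣ (↥ p)))
    (ℤ.<-≤-trans (ℤ.+<+ (ℕ.n<1+n _)) (ℤ.+≤+ (ℕ.m≤m*n k (↧ₙ p))))

size-pos : ∀ n → 1ℚ ≤ size (suc n)
size-pos n = ≤-by (size n) (sum-nonneg {n} (λ _ → nonNegative⁻¹ 1ℚ)) refl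

sum-δ-1 : ∀ {n} (a : Fin n) → sum (δ a) ≡ 1ℚ
sum-δ-1 a = trans (sum-cong-≗ λ i → sym (*-identityʳ (δ a i))) (sum-δ a (λ _ → 1ℚ))

sum-const : ∀ n c → sum {n} (λ _ → c) ≡ c * size n
sum-const n c = trans (sum-cong-≗ {n} λ _ → sym (*-identityʳ c)) (sum-*ˡ {n} c (λ _ → 1ℚ))

sum-linear₃ : ∀ {n} c d (f g h : Vector ℚ n) →
  sum (λ i → f i + (c * g i + d * h i)) ≡ sum f + (c * sum g + d * sum h)
sum-linear₃ c d f g h = trans (∑-distrib-+ f (λ i → c * g i + d * h i))
  (cong (λ s → sum f + s) (trans (∑-distrib-+ (λ i → c * g i) (λ i → d * h i))
    (cong₂ _+_ (sum-*ˡ c g) (sum-*ˡ d h))))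

δ-gap : ∀ {n} (a i j : Fin n) → (δ a i - δ a j) ² ≤ δ a i + δ a j
δ-gap a i j with does (a Fin.≟ i) | does (a Fin.≟ j)
... | true  | true  = ≤ᵇ⇒≤ _
... | true  | false = ≤ᵇ⇒≤ _
... | false | true  = ≤ᵇ⇒≤ _
... | false | false = ≤ᵇ⇒≤ _

δ-idem : ∀ {n} (a i : Fin n) → δ a i * δ a i ≡ δ a i
δ-idem a i with does (a Fin.≟ i)
... | true  = refl
... | false = refl

module _ {n : ℕ} (G : Graph n) where

  private
    w : Fin n → Fin n → ℚ
    w = weight G

  -- Summation by parts: the product splits into a `v i` half and a `v j` half, and exchanging the
  -- indices turns one into the other because the weights are symmetric.
  green : ∀ (x v : Vector ℚ n) →
    sum (λ i → sum λ j → w i j * ((x i - x j) * (v i - v j))) ≡ 2ℚ * sum (λ i → v i * slope G x i)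
  green x v = begin
    sum (λ i → sum λ j → w i j * ((x i - x j) * (v i - v j)))
      ≡⟨ sum-cong-≗ (λ i → sum-cong-≗ λ j → trans
          (split (w i j) (x i) (x j) (v i) (v j))
          (cong (λ u → v i * t i j + v j * (u * (x j - x i))) (weight-sym G i j))) ⟩
    sum (λ i → sum λ j → v i * t i j + v j * t j i)
      ≡⟨ sum-cong-≗ (λ i → ∑-distrib-+ (λ j → v i * t i j) (λ j → v j * t j i)) ⟩
    sum (λ i → sum (λ j → v i * t i j) + sum (λ j → v j * t j i))
      ≡⟨ ∑-distrib-+ (λ i → sum λ j → v i * t i j) (λ i → sum λ j → v j * t j i) ⟩
    sum (λ i → sum λ j → v i * t i j) + sum (λ i → sum λ j → v j * t j i)
      ≡⟨ cong₂ _+_ half (trans (∑-comm (λ i j → v j * t j i)) half) ⟩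
    s + s
      ≡⟨ double s ⟩
    2ℚ * s ∎
    where
    open ≡-Reasoning
    t : Fin n → Fin n → ℚ
    t i j = w i j * (x i - x j)
    s : ℚ
    s = sum (λ i → v i * slope G x i)
    half : sum (λ i → sum λ j → v i * t i j) ≡ s
    half = sum-cong-≗ λ i → sum-*ˡ (v i) (t i)
    split : ∀ w p q d e → w * ((p - q) * (d - e)) ≡ d * (w * (p - q)) + e * (w * (q - p))
    split = solve-∀ ℚ-ring
    double : ∀ p → p + p ≡ 2ℚ * p
    double = solve-∀ ℚ-ring

  slope-by-parts : ∀ x a →
    sum (λ i → sum λ j → w i j * ((x i - x j) * (δ a i - δ a j))) ≡ 2ℚ * slope G x a
  slope-by-parts x a = trans (green x (δ a)) (cong (λ s → 2ℚ * s) (sum-δ a (slope G x)))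

  -- The direction δ a - c is a translate of δ a, which the energy cannot distinguish from δ a, and
  -- the first variation along it is the slope at `a`.
  energy-shift : ∀ x a s c → energy G (λ i → x i - s * (δ a i - c)) ≡
    energy G x + (- (2ℚ * s) * (2ℚ * slope G x a) + s ² * energy G (δ a))
  energy-shift x a s c = begin
    energy G (λ i → x i - s * (δ a i - c))
      ≡⟨ sum-cong-≗ (λ i → trans
          (sum-cong-≗ λ j → expand (w i j) (x i) (x j) (δ a i) (δ a j) s c)
          (sum-linear₃ k (s ²) (edge-energy G x i) (mixed i) (edge-energy G (δ a) i))) ⟩
    sum (λ i → sum (edge-energy G x i) + (k * sum (mixed i) + s ² * sum (edge-energy G (δ a) i)))
      ≡⟨ sum-linear₃ k (s ²) (sum ∘ edge-energy G x) (sum ∘ mixed) (sum ∘ edge-energy G (δ a)) ⟩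
    energy G x + (k * sum (sum ∘ mixed) + s ² * energy G (δ a))
      ≡⟨ cong (λ m → energy G x + (k * m + s ² * energy G (δ a))) (slope-by-parts x a) ⟩
    energy G x + (k * (2ℚ * slope G x a) + s ² * energy G (δ a)) ∎
    where
    open ≡-Reasoning
    k : ℚ
    k = - (2ℚ * s)
    mixed : Fin n → Fin n → ℚ
    mixed i j = w i j * ((x i - x j) * (δ a i - δ a j))
    expand : ∀ w p q d e s c →
      w * (((p - s * (d - c)) - (q - s * (e - c))) * ((p - s * (d - c)) - (q - s * (e - c)))) ≡
      w * ((p - q) * (p - q)) + (- (2ℚ * s) * (w * ((p - q) * (d - e))) + (s * s) * (w * ((d - e) * (d - e))))
    expand = solve-∀ ℚ-ring

  energy-δ≤ : ∀ a → energy G (δ a) ≤ 2ℚ * size n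
  energy-δ≤ a = begin
    energy G (δ a)
      ≤⟨ sum-mono (λ i → sum-mono λ j → ≤-trans (shrink i j) (δ-gap a i j)) ⟩
    sum (λ i → sum λ j → δ a i + δ a j)
      ≡⟨ sum-cong-≗ (λ i → trans (∑-distrib-+ (λ _ → δ a i) (δ a))
          (cong₂ _+_ (sum-const n (δ a i)) (sum-δ-1 a))) ⟩
    sum (λ i → δ a i * size n + 1ℚ)
      ≡⟨ ∑-distrib-+ (λ i → δ a i * size n) (λ _ → 1ℚ) ⟩
    sum (λ i → δ a i * size n) + size n
      ≡⟨ cong (_+ size n) (trans (sum-*ʳ (size n) (δ a)) (cong (_* size n) (sum-δ-1 a))) ⟩
    1ℚ * size n + size n
      ≡⟨ double (size n) ⟩
    2ℚ * size n ∎
    where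
    open ≤-Reasoning
    double : ∀ p → 1ℚ * p + p ≡ 2ℚ * p
    double = solve-∀ ℚ-ring
    shrink : ∀ i j → edge-energy G (δ a) i j ≤ (δ a i - δ a j) ²
    shrink i j = ≤-by ((1ℚ - w i j) * (δ a i - δ a j) ²)
      (*-nonneg (p≤q⇒0≤q-p (weight-≤1 G i j)) (²-nonneg (δ a i - δ a j)))
      (identity (w i j) ((δ a i - δ a j) ²))
      where
      identity : ∀ w s → w * s + (1ℚ - w) * s ≡ s
      identity = solve-∀ ℚ-ring

norm²-shift : ∀ {n} (x : Vector ℚ n) a s c → norm² (λ i → x i - s * (δ a i - c)) ≡
  norm² x + (- (2ℚ * s) * (x a - c * sum x) + s ² * norm² (λ i → δ a i - c))
norm²-shift x a s c = begin
  norm² (λ i → x i - s * (δ a i - c))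
    ≡⟨ sum-cong-≗ (λ i → expand (x i) (δ a i) s c) ⟩
  sum (λ i → x i ² + (- (2ℚ * s) * (δ a i * x i - c * x i) + s ² * (δ a i - c) ²))
    ≡⟨ sum-linear₃ (- (2ℚ * s)) (s ²) (λ i → x i ²) (λ i → δ a i * x i - c * x i) (λ i → (δ a i - c) ²) ⟩
  norm² x + (- (2ℚ * s) * sum (λ i → δ a i * x i - c * x i) + s ² * norm² (λ i → δ a i - c))
    ≡⟨ cong (λ m → norm² x + (- (2ℚ * s) * m + s ² * norm² (λ i → δ a i - c)))
        (trans (sum-minus (λ i → δ a i * x i) (λ i → c * x i)) (cong₂ _-_ (sum-δ a x) (sum-*ˡ c x))) ⟩
  norm² x + (- (2ℚ * s) * (x a - c * sum x) + s ² * norm² (λ i → δ a i - c)) ∎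
  where
  open ≡-Reasoning
  expand : ∀ p d s c → (p - s * (d - c)) * (p - s * (d - c)) ≡
    p * p + (- (2ℚ * s) * (d * p - c * p) + s * s * ((d - c) * (d - c)))
  expand = solve-∀ ℚ-ring

norm²-centred-δ : ∀ {n} (a : Fin n) c → size n * c ≡ 1ℚ → norm² (λ i → δ a i - c) ≡ 1ℚ - c
norm²-centred-δ {n} a c nc≡1 = begin
  norm² (λ i → δ a i - c)
    ≡⟨ sum-cong-≗ (λ i → trans (expand (δ a i) c) (cong (λ e → e + (- (2ℚ * c) * δ a i + c ² * 1ℚ)) (δ-idem a i))) ⟩
  sum (λ i → δ a i + (- (2ℚ * c) * δ a i + c ² * 1ℚ))
    ≡⟨ sum-linear₃ (- (2ℚ * c)) (c ²) (δ a) (δ a) (λ _ → 1ℚ) ⟩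
  sum (δ a) + (- (2ℚ * c) * sum (δ a) + c ² * size n)
    ≡⟨ cong (λ s → s + (- (2ℚ * c) * s + c ² * size n)) (sum-δ-1 a) ⟩
  1ℚ + (- (2ℚ * c) * 1ℚ + c ² * size n)
    ≡⟨ collect c (size n) ⟩
  1ℚ - 2ℚ * c + c * (size n * c)
    ≡⟨ cong (λ s → 1ℚ - 2ℚ * c + c * s) nc≡1 ⟩
  1ℚ - 2ℚ * c + c * 1ℚ
    ≡⟨ finish c ⟩
  1ℚ - c ∎
  where
  open ≡-Reasoning
  expand : ∀ d c → (d - c) * (d - c) ≡ d * d + (- (2ℚ * c) * d + c * c * 1ℚ)
  expand = solve-∀ ℚ-ring
  collect : ∀ c m → 1ℚ + (- (2ℚ * c) * 1ℚ + c * c * m) ≡ 1ℚ - 2ℚ * c + c * (m * c)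
  collect = solve-∀ ℚ-ring
  finish : ∀ c → 1ℚ - 2ℚ * c + c * 1ℚ ≡ 1ℚ - c
  finish = solve-∀ ℚ-ring

module Maximum {n : ℕ} (x : Vector ℚ n) (a : Fin n) (x≤xa : ∀ i → x i ≤ x a)
  (mean-zero : sum x ≡ 0ℚ) (1≤size : 1ℚ ≤ size n) where

  spread : sum (λ i → x a - x i) ≡ x a * size n
  spread = trans (sum-minus (λ _ → x a) x) (trans (cong₂ _-_ (sum-const n (x a)) mean-zero) (+-identityʳ (x a * size n)))

  drop≤ : ∀ i → x a - x i ≤ x a * size n
  drop≤ i = subst (x a - x i ≤_) spread (term≤sum (λ j → p≤q⇒0≤q-p (x≤xa j)) i)

  0<size : 0ℚ < size n
  0<size = <-≤-trans (positive⁻¹ 1ℚ) 1≤size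

  0≤xa : 0ℚ ≤ x a
  0≤xa = *-cancelʳ-≤-pos (size n) {{positive 0<size}} (subst₂ _≤_ (sym (*-zeroˡ (size n))) spread
    (sum-nonneg λ j → p≤q⇒0≤q-p (x≤xa j)))

  -- The distances below the maximum sum to n times the maximum, so the maximum controls every
  -- entry. This makes the gain from moving one entry comparable with the whole norm, uniformly in
  -- `x`.
  norm²≤xa : norm² x ≤ (x a * size n) ² * size n
  norm²≤xa = subst (norm² x ≤_) (sum-const n ((x a * size n) ²)) (sum-mono square≤)
    where
    xa≤ : x a ≤ x a * size n
    xa≤ = ≤-by (x a * (size n - 1ℚ)) (*-nonneg 0≤xa (p≤q⇒0≤q-p 1≤size)) (identity (x a) (size n))
      where
      identity : ∀ p m → p + p * (m - 1ℚ) ≡ p * m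
      identity = solve-∀ ℚ-ring
    square≤ : ∀ i → x i ² ≤ (x a * size n) ²
    square≤ i = ≤-by (((m - x a) + (x a - x i)) * ((m - (x a - x i)) + x a))
      (*-nonneg (+-nonneg (p≤q⇒0≤q-p xa≤) (p≤q⇒0≤q-p (x≤xa i))) (+-nonneg (p≤q⇒0≤q-p (drop≤ i)) 0≤xa))
      (identity (x i) (x a) m)
      where
      m : ℚ
      m = x a * size n
      identity : ∀ p a m → p * p + ((m - a) + (a - p)) * ((m - (a - p)) + a) ≡ m * m
      identity = solve-∀ ℚ-ring

  0<xa : 0ℚ < norm² x → 0ℚ < x a
  0<xa 0<norm = ≰⇒> λ xa≤0 → <-irrefl refl (<-≤-trans 0<norm
    (subst (norm² x ≤_) (trans (cong (λ p → (p * size n) ² * size n) (≤-antisym xa≤0 0≤xa)) (zero² (size n))) norm²≤xa))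
    where
    zero² : ∀ m → (0ℚ * m) * (0ℚ * m) * m ≡ 0ℚ
    zero² = solve-∀ ℚ-ring

-- Moving the maximal entry of x towards the mean lowers the Rayleigh quotient by at
-- least ε when the slope there is too steep for a quotient of at most 2/5 − η.
module Improve {n : ℕ} (G : Graph n) (c η : ℚ) (0<η : 0ℚ < η) (0<c : 0ℚ < c)
  (nc≡1 : size n * c ≡ 1ℚ) (1≤n : 1ℚ ≤ size n) where

  -- With p = x a and c = 1/n, the norm is at most n³ p², so 2 ε |x|² ≤ η² p² c. This is two of the
  -- three units s p η of gain that remain in `improve`.
  ε : ℚ
  ε = ½ * (η ² * (c ² * c ²))

  0<ε : 0ℚ < ε
  0<ε = *-pos (positive⁻¹ ½) (*-pos (*-pos 0<η 0<η) (*-pos (*-pos 0<c 0<c) (*-pos 0<c 0<c)))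

  c≤1 : c ≤ 1ℚ
  c≤1 = ≤-by ((size n - 1ℚ) * c) (*-nonneg (p≤q⇒0≤q-p 1≤n) (<⇒≤ 0<c))
    (trans (identity (size n) c) nc≡1)
    where
    identity : ∀ m c → c + (m - 1ℚ) * c ≡ m * c
    identity = solve-∀ ℚ-ring

  improve : ∀ x a ρ → sum x ≡ 0ℚ → (∀ i → x i ≤ x a) → 0ℚ < norm² x → 0ℚ ≤ ρ → ρ ≤ 2/5 - η →
    energy G x ≤ 2ℚ * ρ * norm² x → 2/5 * x a < slope G x a →
    ∃[ z ] (sum z ≡ 0ℚ × 0ℚ < norm² z × energy G z ≤ 2ℚ * (ρ - ε) * norm² z)
  improve x a ρ mean-zero x≤xa 0<norm 0≤ρ ρ≤ low steep = z , sum-z , norm-z , low-z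
    where
    open Maximum x a x≤xa mean-zero 1≤n using (norm²≤xa) renaming (0<xa to 0<xa′)
    p s : ℚ
    p = x a
    -- Moving along the mean-zero vector δ a - c gains at least 4 s p η to first order, and the
    -- second-order cost of the energy is at most 2 n s². This `s` makes that cost exactly one unit
    -- s p η.
    s = ½ * (η * p * c)
    z : Vector ℚ n
    z i = x i - s * (δ a i - c)

    0<p : 0ℚ < p
    0<p = 0<xa′ 0<norm

    0<s : 0ℚ < s
    0<s = *-pos (positive⁻¹ ½) (*-pos (*-pos 0<η 0<p) 0<c)

    η≤1 : η ≤ 1ℚ
    η≤1 = ≤-by (3/5 + ((2/5 - η - ρ) + ρ))
      (+-nonneg (nonNegative⁻¹ 3/5) (+-nonneg (p≤q⇒0≤q-p ρ≤) 0≤ρ)) (identity η ρ)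
      where
      identity : ∀ η ρ → η + (3/5 + ((2/5 - η - ρ) + ρ)) ≡ 1ℚ
      identity = solve-∀ ℚ-ring

    0<p-s : 0ℚ < p - s
    0<p-s = subst (0ℚ <_) (identity p η c)
      (*-pos 0<p (+-pos-nonneg (positive⁻¹ ½) (*-nonneg (nonNegative⁻¹ ½)
        (+-nonneg (*-nonneg (<⇒≤ 0<η) (p≤q⇒0≤q-p c≤1)) (p≤q⇒0≤q-p η≤1)))))
      where
      identity : ∀ p η c → p * (½ + ½ * (η * (1ℚ - c) + (1ℚ - η))) ≡ p - ½ * (η * p * c)
      identity = solve-∀ ℚ-ring

    sum-z : sum z ≡ 0ℚ
    sum-z = begin
      sum z                                                ≡⟨ sum-minus x (λ i → s * (δ a i - c)) ⟩
      sum x - sum (λ i → s * (δ a i - c))                  ≡⟨ cong₂ _-_ mean-zero (sum-*ˡ s (λ i → δ a i - c)) ⟩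
      0ℚ - s * sum (λ i → δ a i - c)                       ≡⟨ cong (λ t → 0ℚ - s * t) (sum-minus (δ a) (λ _ → c)) ⟩
      0ℚ - s * (sum (δ a) - sum {n} (λ _ → c))             ≡⟨ cong₂ (λ t u → 0ℚ - s * (t - u)) (sum-δ-1 a) (trans (sum-const n c) (trans (*-comm c (size n)) nc≡1)) ⟩
      0ℚ - s * (1ℚ - 1ℚ)                                   ≡⟨ identity s ⟩
      0ℚ                                                   ∎
      where
      open ≡-Reasoning
      identity : ∀ s → 0ℚ - s * (1ℚ - 1ℚ) ≡ 0ℚ
      identity = solve-∀ ℚ-ring

    0<za : 0ℚ < z a
    0<za = subst (0ℚ <_) (trans (identity p s c) (cong (λ d → p - s * (d - c)) (sym (δ-refl a))))
      (+-pos-nonneg 0<p-s (*-nonneg (<⇒≤ 0<s) (<⇒≤ 0<c)))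
      where
      identity : ∀ p s c → (p - s) + s * c ≡ p - s * (1ℚ - c)
      identity = solve-∀ ℚ-ring

    norm-z : 0ℚ < norm² z
    norm-z = <-≤-trans (*-pos 0<za 0<za) (term≤sum (λ i → ²-nonneg (z i)) a)

    E N g V W : ℚ
    E = energy G x
    N = norm² x
    g = slope G x a
    V = energy G (δ a)
    W = norm² (λ i → δ a i - c)

    W≡ : W ≡ 1ℚ - c
    W≡ = norm²-centred-δ a c nc≡1

    N-small : 0ℚ ≤ + 3 / 1 * (s * p * η) - 2ℚ * ε * N
    N-small = subst (0ℚ ≤_) (trans (substitute 1ℚ η p c N (size n) (sym nc≡1)) (collect η p c (2ℚ * ε * N)))
      (+-nonneg (*-nonneg (*-nonneg (²-nonneg η) (*-nonneg (²-nonneg c) (²-nonneg c))) (p≤q⇒0≤q-p norm²≤xa))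
        (*-nonneg (nonNegative⁻¹ ½) (*-nonneg (*-nonneg (²-nonneg η) (²-nonneg p)) (<⇒≤ 0<c))))
      where
      -- With 1 written as a variable `e` equal to `m * c`, the ring solver can collapse n³ c⁴ to
      -- `c`.
      substitute : ∀ e η p c N m → e ≡ m * c →
        (η * η * (c * c * (c * c))) * ((p * m) * (p * m) * m - N) + ½ * (η * η * (p * p) * c) ≡
        η * η * (p * p) * c * (e * (e * e)) + ½ * (η * η * (p * p) * c) - 2ℚ * (½ * (η * η * (c * c * (c * c)))) * N
      substitute _ η p c N m refl = expand η p c N m
        where
        expand : ∀ η p c N m →
          (η * η * (c * c * (c * c))) * ((p * m) * (p * m) * m - N) + ½ * (η * η * (p * p) * c) ≡
          η * η * (p * p) * c * ((m * c) * ((m * c) * (m * c))) + ½ * (η * η * (p * p) * c) - 2ℚ * (½ * (η * η * (c * c * (c * c)))) * N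
        expand = solve-∀ ℚ-ring
      collect : ∀ η p c q → η * η * (p * p) * c * (1ℚ * (1ℚ * 1ℚ)) + ½ * (η * η * (p * p) * c) - q ≡
        + 3 / 1 * (½ * (η * p * c) * p * η) - q
      collect = solve-∀ ℚ-ring

    low-z : energy G z ≤ 2ℚ * (ρ - ε) * norm² z
    low-z = ≤-by d 0≤d (begin
      energy G z + d                                         ≡⟨ cong (_+ d) (energy-shift G x a s c) ⟩
      (E + (- (2ℚ * s) * (2ℚ * g) + s ² * V)) + d            ≡⟨ identity E N g V W p s ρ η ε (size n) ⟩
      2ℚ * (ρ - ε) * (N + (- (2ℚ * s) * p + s ² * W))        ≡⟨ cong (λ t → 2ℚ * (ρ - ε) * (N + (- (2ℚ * s) * t + s ² * W)))
                                                                  (sym (trans (cong (λ m → p - c * m) mean-zero) (no-shift p c))) ⟩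
      2ℚ * (ρ - ε) * (N + (- (2ℚ * s) * (p - c * sum x) + s ² * W))
                                                             ≡⟨ cong (λ t → 2ℚ * (ρ - ε) * t) (sym (norm²-shift x a s c)) ⟩
      2ℚ * (ρ - ε) * norm² z                                 ∎)
      where
      open ≡-Reasoning
      no-shift : ∀ p c → p - c * 0ℚ ≡ p
      no-shift = solve-∀ ℚ-ring
      balance : s * (η * p) - s * (2ℚ * size n * s) ≡ 0ℚ
      balance = trans (factor s η p c (size n)) (trans (cong (λ t → s * (η * p) * (1ℚ - t)) nc≡1) (*-zeroʳ (s * (η * p))))
        where
        factor : ∀ s η p c m → s * (η * p) - s * (2ℚ * m * (½ * (η * p * c))) ≡ s * (η * p) * (1ℚ - m * c)
        factor = solve-∀ ℚ-ring
      -- The slack, grouped so that each summand has a visible sign. The last summand vanishes by n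
      -- c = 1, a relation that the ring solver cannot see.
      d : ℚ
      d = (2ℚ * ρ * N - E) + (+ 4 / 1 * s * (g - 2/5 * p) + (s ² * (2ℚ * size n - V) +
        (+ 4 / 1 * (s * p) * (2/5 - η - ρ) + (2ℚ * ρ * (s ² * W) + (2ℚ * ε * (s ² * (1ℚ - W)) +
        (2ℚ * (ε * s) * ((p - s) + p) + ((+ 3 / 1 * (s * p * η) - 2ℚ * ε * N) +
        (s * (η * p) - s * (2ℚ * size n * s)))))))))
      0≤d : 0ℚ ≤ d
      0≤d =
        +-nonneg (p≤q⇒0≤q-p low)
        (+-nonneg (*-nonneg (*-nonneg (nonNegative⁻¹ (+ 4 / 1)) 0≤s) (p≤q⇒0≤q-p (<⇒≤ steep)))
        (+-nonneg (*-nonneg (²-nonneg s) (p≤q⇒0≤q-p (energy-δ≤ G a)))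
        (+-nonneg (*-nonneg (*-nonneg (nonNegative⁻¹ (+ 4 / 1)) (*-nonneg 0≤s (<⇒≤ 0<p))) (p≤q⇒0≤q-p ρ≤))
        (+-nonneg (*-nonneg (*-nonneg 0≤2 0≤ρ) (*-nonneg (²-nonneg s) (sum-nonneg λ i → ²-nonneg (δ a i - c))))
        (+-nonneg (*-nonneg (*-nonneg 0≤2 (<⇒≤ 0<ε)) (*-nonneg (²-nonneg s) 0≤1-W))
        (+-nonneg (*-nonneg (*-nonneg 0≤2 (*-nonneg (<⇒≤ 0<ε) 0≤s)) (+-nonneg (<⇒≤ 0<p-s) (<⇒≤ 0<p)))
        (+-nonneg N-small
        (≤-reflexive (sym balance)))))))))
        where
        0≤s : 0ℚ ≤ s
        0≤s = <⇒≤ 0<s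
        0≤2 : 0ℚ ≤ 2ℚ
        0≤2 = nonNegative⁻¹ 2ℚ
        0≤1-W : 0ℚ ≤ 1ℚ - W
        0≤1-W = subst (0ℚ ≤_) (trans (cancel c) (cong (λ t → 1ℚ - t) (sym W≡))) (<⇒≤ 0<c)
          where
          cancel : ∀ c → c ≡ 1ℚ - (1ℚ - c)
          cancel = solve-∀ ℚ-ring
      identity : ∀ E N g V W p s ρ η ε m →
        (E + (- (2ℚ * s) * (2ℚ * g) + s * s * V)) +
        ((2ℚ * ρ * N - E) + (+ 4 / 1 * s * (g - 2/5 * p) + (s * s * (2ℚ * m - V) +
        (+ 4 / 1 * (s * p) * (2/5 - η - ρ) + (2ℚ * ρ * (s * s * W) + (2ℚ * ε * (s * s * (1ℚ - W)) +
        (2ℚ * (ε * s) * ((p - s) + p) + ((+ 3 / 1 * (s * p * η) - 2ℚ * ε * N) +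
        (s * (η * p) - s * (2ℚ * m * s)))))))))) ≡
        2ℚ * (ρ - ε) * (N + (- (2ℚ * s) * p + s * s * W))
      identity = solve-∀ ℚ-ring

-- Every condition on a mode other than its range is homogeneous, so dividing by the range suffices.
normalise : ∀ {n} (G : Graph n) (x : Vector ℚ n) (a b : Fin n) → sum x ≡ 0ℚ →
  (∀ i → x i ≤ x a) → (∀ i → x b ≤ x i) → 0ℚ < x a → x b < 0ℚ →
  slope G x a ≤ 2/5 * x a → 2/5 * x b ≤ slope G x b → energy G x < 4/5 * norm² x → Mode G
normalise {n} G x a b mean-zero x≤xa xb≤x 0<xa xb<0 slope-a slope-b low = record
  { x          = λ i → c * x i
  ; top        = a
  ; bot        = b
  ; mean-zero  = trans (sum-*ˡ c x) (trans (cong (λ s → c * s) mean-zero) (*-zeroʳ c))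
  ; ≤top       = scale≤ ∘ x≤xa
  ; bot≤       = scale≤ ∘ xb≤x
  ; range      = trans (split c (x a) (x b)) (cong (λ t → c * x b + t) dc≡1)
  ; top-pos    = *-pos 0<c 0<xa
  ; bot-neg    = subst (c * x b <_) (*-zeroʳ c) (*-monoʳ-<-pos c {{positive 0<c}} xb<0)
  ; top-slope  = subst₂ _≤_ (slope-scale a) (swap c (x a)) (scale≤ slope-a)
  ; bot-slope  = subst₂ _≤_ (swap c (x b)) (slope-scale b) (scale≤ slope-b)
  ; low-energy = subst₂ _<_ energy-scale norm-scale (*-monoʳ-<-pos (c ²) {{positive (*-pos 0<c 0<c)}} low)
  }
  where
  inv : ∃[ c ] (0ℚ < c × (x a - x b) * c ≡ 1ℚ)
  inv = inverse (p<q⇒0<q-p (<-trans xb<0 0<xa))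
  c : ℚ
  c = proj₁ inv
  0<c : 0ℚ < c
  0<c = proj₁ (proj₂ inv)
  dc≡1 : (x a - x b) * c ≡ 1ℚ
  dc≡1 = proj₂ (proj₂ inv)
  scale≤ : ∀ {p q} → p ≤ q → c * p ≤ c * q
  scale≤ = *-monoˡ-≤-nonNeg c {{nonNegative (<⇒≤ 0<c)}}
  split : ∀ c p q → c * p ≡ c * q + (p - q) * c
  split = solve-∀ ℚ-ring
  swap : ∀ c p → c * (2/5 * p) ≡ 2/5 * (c * p)
  swap = solve-∀ ℚ-ring
  slope-scale : ∀ i → c * slope G x i ≡ slope G (λ j → c * x j) i
  slope-scale i = trans (sym (sum-*ˡ c (λ j → weight G i j * (x i - x j))))
    (sum-cong-≗ λ j → identity c (weight G i j) (x i) (x j))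
    where
    identity : ∀ c w p q → c * (w * (p - q)) ≡ w * (c * p - c * q)
    identity = solve-∀ ℚ-ring
  energy-scale : c ² * energy G x ≡ energy G (λ j → c * x j)
  energy-scale = trans (sym (sum-*ˡ (c ²) (sum ∘ edge-energy G x)))
    (sum-cong-≗ λ i → trans (sym (sum-*ˡ (c ²) (edge-energy G x i)))
      (sum-cong-≗ λ j → identity c (weight G i j) (x i) (x j)))
    where
    identity : ∀ c w p q → c * c * (w * ((p - q) * (p - q))) ≡ w * ((c * p - c * q) * (c * p - c * q))
    identity = solve-∀ ℚ-ring
  norm-scale : c ² * (4/5 * norm² x) ≡ 4/5 * norm² (λ j → c * x j)
  norm-scale = trans (shift c (norm² x)) (cong (λ s → 4/5 * s)
    (trans (sym (sum-*ˡ (c ²) (λ i → x i ²))) (sum-cong-≗ λ i → identity c (x i))))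
    where
    shift : ∀ c p → c * c * (4/5 * p) ≡ 4/5 * (c * c * p)
    shift = solve-∀ ℚ-ring
    identity : ∀ c p → c * c * (p * p) ≡ c * p * (c * p)
    identity = solve-∀ ℚ-ring

module Descent {m : ℕ} (G : Graph (suc m)) (η : ℚ) (0<η : 0ℚ < η) where
  n : ℕ
  n = suc m
  1≤n : 1ℚ ≤ size n
  1≤n = size-pos m
  inv : ∃[ c ] (0ℚ < c × size n * c ≡ 1ℚ)
  inv = inverse (<-≤-trans (positive⁻¹ 1ℚ) 1≤n)

  open Improve G (proj₁ inv) η 0<η (proj₁ (proj₂ inv)) (proj₂ (proj₂ inv)) 1≤n

  -- Each improvement lowers the quotient bound `ρ` by `ε`, while `ρ` stays nonnegative because the
  -- energy does. So ρ < k ε allows fewer than `k` improvements, and when none applies both slopes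
  -- are gentle.
  descend : ∀ k x ρ → sum x ≡ 0ℚ → 0ℚ < norm² x → ρ ≤ 2/5 - η → ρ < size k * ε →
    energy G x ≤ 2ℚ * ρ * norm² x → Mode G
  descend k x ρ mean-zero 0<norm ρ≤ ρ<kε low = step k ρ<kε (argmax x) (argmax (λ i → - x i))
    where
    0≤ρ : 0ℚ ≤ ρ
    0≤ρ = *-cancelʳ-≤-pos (norm² x) {{positive 0<norm}} (*-cancelˡ-≤-pos 2ℚ
      (subst₂ _≤_ (zero² (norm² x)) (*-assoc 2ℚ ρ (norm² x)) (≤-trans (energy-nonneg G x) low)))
      where
      zero² : ∀ p → 0ℚ ≡ 2ℚ * (0ℚ * p)
      zero² = solve-∀ ℚ-ring

    again : ∀ j → ρ < size (suc j) * ε →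
      ∃[ z ] (sum z ≡ 0ℚ × 0ℚ < norm² z × energy G z ≤ 2ℚ * (ρ - ε) * norm² z) → Mode G
    again j ρ< (z , sum-z , norm-z , low-z) = descend j z (ρ - ε) sum-z norm-z
      (≤-trans (≤-by ε (<⇒≤ 0<ε) (cancel ρ ε)) ρ≤)
      (subst (ρ - ε <_) (peel (size j) ε) (+-monoˡ-< (- ε) ρ<)) low-z
      where
      cancel : ∀ p e → (p - e) + e ≡ p
      cancel = solve-∀ ℚ-ring
      peel : ∀ s e → (1ℚ + s) * e - e ≡ s * e
      peel = solve-∀ ℚ-ring

    step : ∀ k → ρ < size k * ε → ∃[ a ] (∀ i → x i ≤ x a) → ∃[ b ] (∀ i → - x i ≤ - x b) → Mode G
    step zero ρ<0 _ _ = ⊥-elim (<-irrefl refl (≤-<-trans 0≤ρ (subst (ρ <_) (*-zeroˡ ε) ρ<0)))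
    step (suc j) ρ< (a , x≤xa) (b , -x≤-xb) with slope G x a ≤? 2/5 * x a | 2/5 * x b ≤? slope G x b
    ... | no steep  | _         = again j ρ< (improve x a ρ mean-zero x≤xa 0<norm 0≤ρ ρ≤ low (≰⇒> steep))
    ... | yes _     | no steep  = again j ρ< (improve (λ i → - x i) b ρ
      (trans (sum-neg x) (cong -_ mean-zero)) -x≤-xb
      (subst (0ℚ <_) (sym (norm²-neg x)) 0<norm) 0≤ρ ρ≤
      (subst₂ (λ e s → e ≤ 2ℚ * ρ * s) (sym (energy-neg G x)) (sym (norm²-neg x)) low)
      (subst₂ _<_ (neg-distribʳ-* 2/5 (x b)) (sym (slope-neg G x b)) (neg-antimono-< (≰⇒> steep))))
    ... | yes slow  | yes slow′ = normalise G x a b mean-zero x≤xa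
      (λ i → subst₂ _≤_ (neg-neg (x b)) (neg-neg (x i)) (neg-antimono-≤ (-x≤-xb i)))
      (Maximum.0<xa x a x≤xa mean-zero 1≤n 0<norm)
      (subst₂ _<_ (neg-neg (x b)) refl (neg-antimono-<
        (Maximum.0<xa (λ i → - x i) b -x≤-xb (trans (sum-neg x) (cong -_ mean-zero)) 1≤n
          (subst (0ℚ <_) (sym (norm²-neg x)) 0<norm))))
      slow slow′
      (≤-<-trans low (<-by (2ℚ * ((2/5 - η - ρ) + η) * norm² x)
        (*-pos (*-pos (positive⁻¹ 2ℚ) (+-mono-≤-< (p≤q⇒0≤q-p ρ≤) 0<η)) 0<norm) (identity ρ η (norm² x))))
      where
      identity : ∀ ρ η p → 2ℚ * ρ * p + 2ℚ * ((2/5 - η - ρ) + η) * p ≡ 4/5 * p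
      identity = solve-∀ ℚ-ring

  find-mode : ∀ x → sum x ≡ 0ℚ → 0ℚ < norm² x → energy G x ≤ 2ℚ * (2/5 - η) * norm² x → Mode G
  find-mode x mean-zero 0<norm low = descend (proj₁ k) x (2/5 - η) mean-zero 0<norm ≤-refl bound low
    where
    inv-ε : ∃[ e ] (0ℚ < e × ε * e ≡ 1ℚ)
    inv-ε = inverse 0<ε
    e : ℚ
    e = proj₁ inv-ε
    k : ∃[ k ] (2/5 - η) * e < size k
    k = archimedean ((2/5 - η) * e)
    bound : 2/5 - η < size (proj₁ k) * ε
    bound = subst (_< size (proj₁ k) * ε)
      (trans (*-assoc (2/5 - η) e ε) (trans (cong (λ t → (2/5 - η) * t) (trans (*-comm e ε) (proj₂ (proj₂ inv-ε)))) (*-identityʳ (2/5 - η))))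
      (*-monoˡ-<-pos ε {{positive 0<ε}} (proj₂ k))

-- Determinants over ℚ

sgn : ∀ {n} → Fin n → ℚ
sgn j = (- 1ℚ) ^ toℕ j

minor : ∀ {n} → Matrix ℚ (suc n) → Fin (suc n) → Matrix ℚ n
minor M j i k = M (suc i) (punchIn j k)

det-cong : ∀ {n} {M N : Matrix ℚ n} → (∀ i j → M i j ≡ N i j) → det M ≡ det N
det-cong {zero}  M≡N = refl
det-cong {suc n} M≡N = sum-cong-≗ λ j →
  cong₂ (λ m d → sgn j * m * d) (M≡N zero j) (det-cong λ i k → M≡N (suc i) (punchIn j k))

AgreeOff : ∀ {n} → Fin n → Matrix ℚ n → Matrix ℚ n → Set
AgreeOff i M N = ∀ k → k ≢ i → ∀ j → M k j ≡ N k j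

det-row-linear : ∀ {n} {A B C : Matrix ℚ n} i t → AgreeOff i A C → AgreeOff i B C →
  (∀ j → C i j ≡ A i j + t * B i j) → det C ≡ det A + t * det B
det-row-linear {suc n} {A} {B} {C} i t A≡C B≡C row = begin
  det C                                                 ≡⟨ sum-cong-≗ (expand i A≡C B≡C row) ⟩
  sum (λ j → cofactor A j + t * cofactor B j)           ≡⟨ ∑-distrib-+ (cofactor A) (λ j → t * cofactor B j) ⟩
  det A + sum (λ j → t * cofactor B j)                  ≡⟨ cong (λ s → det A + s) (sum-*ˡ t (cofactor B)) ⟩
  det A + t * det B                                     ∎
  where
  open ≡-Reasoning
  cofactor : Matrix ℚ (suc n) → Fin (suc n) → ℚ
  cofactor M j = sgn j * M zero j * det (minor M j)

  expand : ∀ i → AgreeOff i A C → AgreeOff i B C → (∀ j → C i j ≡ A i j + t * B i j) →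
    ∀ j → cofactor C j ≡ cofactor A j + t * cofactor B j
  expand zero A≡C B≡C row j = begin
    sgn j * C zero j * det (minor C j)
      ≡⟨ cong (λ m → sgn j * m * det (minor C j)) (row j) ⟩
    sgn j * (A zero j + t * B zero j) * det (minor C j)
      ≡⟨ distribute (sgn j) (A zero j) t (B zero j) (det (minor C j)) ⟩
    sgn j * A zero j * det (minor C j) + t * (sgn j * B zero j * det (minor C j))
      ≡⟨ cong₂ (λ d e → sgn j * A zero j * d + t * (sgn j * B zero j * e))
          (det-cong λ k l → sym (A≡C (suc k) (λ ()) (punchIn j l)))
          (det-cong λ k l → sym (B≡C (suc k) (λ ()) (punchIn j l))) ⟩
    cofactor A j + t * cofactor B j ∎
    where
    distribute : ∀ s a t b d → s * (a + t * b) * d ≡ s * a * d + t * (s * b * d)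
    distribute = solve-∀ ℚ-ring
  expand (suc i) A≡C B≡C row j = begin
    sgn j * C zero j * det (minor C j)
      ≡⟨ cong (λ d → sgn j * C zero j * d) (det-row-linear i t
          (λ k k≢i l → A≡C (suc k) (k≢i ∘ Fin.suc-injective) (punchIn j l))
          (λ k k≢i l → B≡C (suc k) (k≢i ∘ Fin.suc-injective) (punchIn j l))
          (row ∘ punchIn j)) ⟩
    sgn j * C zero j * (det (minor A j) + t * det (minor B j))
      ≡⟨ distribute (sgn j) (C zero j) (det (minor A j)) t (det (minor B j)) ⟩
    sgn j * C zero j * det (minor A j) + t * (sgn j * C zero j * det (minor B j))
      ≡⟨ cong₂ (λ a b → sgn j * a * det (minor A j) + t * (sgn j * b * det (minor B j)))
          (sym (A≡C zero (λ ()) j)) (sym (B≡C zero (λ ()) j)) ⟩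
    cofactor A j + t * cofactor B j ∎
    where
    distribute : ∀ s a d t e → s * a * (d + t * e) ≡ s * a * d + t * (s * a * e)
    distribute = solve-∀ ℚ-ring

-- Deleting two columns leaves the same columns in the same order, whichever is deleted first.
punchIn-comm : ∀ {n} {j k : Fin (suc (suc n))} (j≢k : j ≢ k) (k≢j : k ≢ j) (l : Fin n) →
  punchIn j (punchIn (punchOut j≢k) l) ≡ punchIn k (punchIn (punchOut k≢j) l)
punchIn-comm {j = zero}  {zero}  j≢k _   _       = contradiction refl j≢k
punchIn-comm {j = zero}  {suc k} _   _   _       = refl
punchIn-comm {j = suc j} {zero}  _   _   _       = refl
punchIn-comm {j = suc j} {suc k} _   _   zero    = refl
punchIn-comm {j = suc j} {suc k} j≢k k≢j (suc l) =
  cong suc (punchIn-comm (j≢k ∘ cong suc) (k≢j ∘ cong suc) l)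

-- The first deletion shifts the other index down only if that index is the larger one. This happens
-- in exactly one of the two orders, whence the sign.
sgn-punchOut : ∀ {n} {j k : Fin (suc (suc n))} (j≢k : j ≢ k) (k≢j : k ≢ j) →
  sgn j * sgn (punchOut j≢k) ≡ - (sgn k * sgn (punchOut k≢j))
sgn-punchOut {_}     {zero}  {zero}  j≢k _ = contradiction refl j≢k
sgn-punchOut {_}     {zero}  {suc k} _   _ = identity (sgn k)
  where
  identity : ∀ s → 1ℚ * s ≡ - (- 1ℚ * s * 1ℚ)
  identity = solve-∀ ℚ-ring
sgn-punchOut {_}     {suc j} {zero}  _   _ = identity (sgn j)
  where
  identity : ∀ s → - 1ℚ * s * 1ℚ ≡ - (1ℚ * s)
  identity = solve-∀ ℚ-ring
sgn-punchOut {zero}  {suc zero} {suc zero} j≢k _ = contradiction refl j≢k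
sgn-punchOut {suc n} {suc j} {suc k} j≢k k≢j = begin
  - 1ℚ * sgn j * (- 1ℚ * sgn (punchOut j≢k′))        ≡⟨ square (sgn j) (sgn (punchOut j≢k′)) ⟩
  sgn j * sgn (punchOut j≢k′)                        ≡⟨ sgn-punchOut j≢k′ k≢j′ ⟩
  - (sgn k * sgn (punchOut k≢j′))                    ≡⟨ cong -_ (sym (square (sgn k) (sgn (punchOut k≢j′)))) ⟩
  - (- 1ℚ * sgn k * (- 1ℚ * sgn (punchOut k≢j′)))    ∎
  where
  open ≡-Reasoning
  j≢k′ : j ≢ k
  j≢k′ = j≢k ∘ cong suc
  k≢j′ : k ≢ j
  k≢j′ = k≢j ∘ cong suc
  square : ∀ s t → - 1ℚ * s * (- 1ℚ * t) ≡ s * t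
  square = solve-∀ ℚ-ring

p≡-p⇒p≡0 : ∀ {p} → p ≡ - p → p ≡ 0ℚ
p≡-p⇒p≡0 {p} eq = begin
  p                 ≡⟨ halves p ⟩
  ½ * (p + p)       ≡⟨ cong (λ q → ½ * (p + q)) eq ⟩
  ½ * (p + - p)     ≡⟨ cancel p ⟩
  0ℚ                ∎
  where
  open ≡-Reasoning
  halves : ∀ p → p ≡ ½ * (p + p)
  halves = solve-∀ ℚ-ring
  cancel : ∀ p → ½ * (p + - p) ≡ 0ℚ
  cancel = solve-∀ ℚ-ring

-- In the Laplace expansion along both rows, the terms for the columns (j , k) and
-- (k , j) cancel.
det-first-rows-equal : ∀ {n} (M : Matrix ℚ (suc (suc n))) →
  (∀ j → M zero j ≡ M (suc zero) j) → det M ≡ 0ℚ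
det-first-rows-equal {n} M M₀≡M₁ = trans (sum-cong-≗ row-sum) (p≡-p⇒p≡0 (begin
  sum (λ j → sum λ k → g j k (j Fin.≟ k))
    ≡⟨ ∑-comm (λ j k → g j k (j Fin.≟ k)) ⟩
  sum (λ k → sum λ j → g j k (j Fin.≟ k))
    ≡⟨ sum-cong-≗ (λ k → trans (sum-cong-≗ λ j → antisymmetric j k (j Fin.≟ k) (k Fin.≟ j))
        (sum-neg (λ j → g k j (k Fin.≟ j)))) ⟩
  sum (λ k → - sum (λ j → g k j (k Fin.≟ j)))
    ≡⟨ sum-neg (λ k → sum λ j → g k j (k Fin.≟ j)) ⟩
  - sum (λ j → sum λ k → g j k (j Fin.≟ k)) ∎))
  where
  open ≡-Reasoning
  v : Fin (suc (suc n)) → ℚ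
  v = M zero

  D : Fin (suc (suc n)) → Fin (suc n) → ℚ
  D j l = det (λ i k → M (suc (suc i)) (punchIn j (punchIn l k)))

  -- The default 0 on the diagonal turns the sum over distinct columns into one over all pairs. The
  -- decision is an argument so that the two orders can be analysed independently.
  g : ∀ j k → Dec (j ≡ k) → ℚ
  g j k (yes _)  = 0ℚ
  g j k (no j≢k) = sgn j * sgn (punchOut j≢k) * (v j * v k * D j (punchOut j≢k))

  g-punchIn : ∀ j l (j≟ : Dec (j ≡ punchIn j l)) →
    g j (punchIn j l) j≟ ≡ sgn j * v j * (sgn l * v (punchIn j l) * D j l)
  g-punchIn j l (yes j≡) = contradiction (sym j≡) (Fin.punchInᵢ≢i j l)
  g-punchIn j l (no j≢)  = trans
    (cong (λ m → sgn j * sgn m * (v j * v (punchIn j l) * D j m))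
      (trans (Fin.punchOut-cong j refl) (Fin.punchOut-punchIn j)))
    (rearrange (sgn j) (sgn l) (v j) (v (punchIn j l)) (D j l))
    where
    rearrange : ∀ s t p q d → s * t * (p * q * d) ≡ s * p * (t * q * d)
    rearrange = solve-∀ ℚ-ring

  g-refl : ∀ j (j≟j : Dec (j ≡ j)) → g j j j≟j ≡ 0ℚ
  g-refl j (yes _)  = refl
  g-refl j (no j≢j) = contradiction refl j≢j

  row-sum : ∀ j → sgn j * v j * det (minor M j) ≡ sum (λ k → g j k (j Fin.≟ k))
  row-sum j = begin
    sgn j * v j * sum (λ l → sgn l * M (suc zero) (punchIn j l) * D j l)
      ≡⟨ sym (sum-*ˡ (sgn j * v j) (λ l → sgn l * M (suc zero) (punchIn j l) * D j l)) ⟩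
    sum (λ l → sgn j * v j * (sgn l * M (suc zero) (punchIn j l) * D j l))
      ≡⟨ sum-cong-≗ (λ l → trans
          (cong (λ q → sgn j * v j * (sgn l * q * D j l)) (sym (M₀≡M₁ (punchIn j l))))
          (sym (g-punchIn j l (j Fin.≟ punchIn j l)))) ⟩
    sum (λ l → g j (punchIn j l) (j Fin.≟ punchIn j l))
      ≡⟨ sym (+-identityˡ _) ⟩
    0ℚ + sum (λ l → g j (punchIn j l) (j Fin.≟ punchIn j l))
      ≡⟨ cong (_+ sum (λ l → g j (punchIn j l) (j Fin.≟ punchIn j l))) (sym (g-refl j (j Fin.≟ j))) ⟩
    g j j (j Fin.≟ j) + sum (λ l → g j (punchIn j l) (j Fin.≟ punchIn j l))
      ≡⟨ sym (sum-remove {i = j} (λ k → g j k (j Fin.≟ k))) ⟩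
    sum (λ k → g j k (j Fin.≟ k)) ∎

  antisymmetric : ∀ j k (j≟k : Dec (j ≡ k)) (k≟j : Dec (k ≡ j)) → g j k j≟k ≡ - g k j k≟j
  antisymmetric j k (yes _)   (yes _)   = refl
  antisymmetric j k (yes j≡k) (no k≢j)  = contradiction (sym j≡k) k≢j
  antisymmetric j k (no j≢k)  (yes k≡j) = contradiction (sym k≡j) j≢k
  antisymmetric j k (no j≢k)  (no k≢j)  = begin
    sgn j * sgn (punchOut j≢k) * (v j * v k * D j (punchOut j≢k))
      ≡⟨ cong₂ (λ s d → s * (v j * v k * d)) (sgn-punchOut j≢k k≢j)
          (det-cong λ i l → cong (M (suc (suc i))) (punchIn-comm j≢k k≢j l)) ⟩
    - (sgn k * sgn (punchOut k≢j)) * (v j * v k * D k (punchOut k≢j))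
      ≡⟨ rearrange (sgn k * sgn (punchOut k≢j)) (v j) (v k) (D k (punchOut k≢j)) ⟩
    - (sgn k * sgn (punchOut k≢j) * (v k * v j * D k (punchOut k≢j))) ∎
    where
    rearrange : ∀ s p q d → - s * (p * q * d) ≡ - (s * (q * p * d))
    rearrange = solve-∀ ℚ-ring

setRow : ∀ {n} → Matrix ℚ n → Fin n → Vector ℚ n → Matrix ℚ n
setRow M i p = updateAt M i (const p)

setRow-same : ∀ {n} (M : Matrix ℚ n) i p j → setRow M i p i j ≡ p j
setRow-same M i p j = cong (_$ j) (updateAt-updates i M)

setRow-other : ∀ {n} (M : Matrix ℚ n) i p → AgreeOff i (setRow M i p) M
setRow-other M i p k k≢i j = cong (_$ j) (updateAt-minimal k i M k≢i)

-- A predicate on the dimension, so that the cases of the induction in `det-equal-rows` can be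
-- separate lemmas.
Alternating : ℕ → Set
Alternating n = ∀ (M : Matrix ℚ n) {i k} → i ≢ k → (∀ j → M i j ≡ M k j) → det M ≡ 0ℚ

det-lower-rows-equal : ∀ {n} → Alternating n →
  ∀ (M : Matrix ℚ (suc n)) {i k} → i ≢ k → (∀ j → M (suc i) j ≡ M (suc k) j) → det M ≡ 0ℚ
det-lower-rows-equal alternating M i≢k Mi≡Mk = sum-zero λ j →
  trans (cong (λ d → sgn j * M zero j * d) (alternating (minor M j) i≢k (Mi≡Mk ∘ punchIn j)))
    (*-zeroʳ (sgn j * M zero j))

-- Rows 0 and k + 2 are reduced to rows 0 and 1: the determinant is antisymmetric in
-- rows 1 and k + 2, because it is alternating in them.
det-first-row-repeated : ∀ {n} → Alternating n →
  ∀ (M : Matrix ℚ (suc n)) k → (∀ j → M zero j ≡ M (suc k) j) → det M ≡ 0ℚ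
det-first-row-repeated {suc n} alternating M zero    M₀≡M₁ = det-first-rows-equal M M₀≡M₁
det-first-row-repeated {suc n} alternating M (suc k) M₀≡Mᵢ = begin
  det M                                  ≡⟨ det-cong (λ r j → sym (restore r j)) ⟩
  det (P u v)                            ≡⟨ sym (trans (cong (λ d → det (P u v) + d) P-v-u) (+-identityʳ (det (P u v)))) ⟩
  det (P u v) + det (P v u)              ≡⟨ sym P-w-w ⟩
  det (P w w)                            ≡⟨ P-same w ⟩
  0ℚ                                     ∎
  where
  open ≡-Reasoning
  one i : Fin (suc (suc n))
  one = suc zero
  i = suc (suc k)
  u v w : Vector ℚ (suc (suc n))
  u = M one
  v = M i
  w j = u j + v j
  P : Vector ℚ (suc (suc n)) → Vector ℚ (suc (suc n)) → Matrix ℚ (suc (suc n))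
  P p q = setRow (setRow M one p) i q

  P-1 : ∀ p q j → P p q one j ≡ p j
  P-1 p q j = trans (setRow-other (setRow M one p) i q one (λ ()) j) (setRow-same M one p j)

  P-i : ∀ p q j → P p q i j ≡ q j
  P-i p q j = setRow-same (setRow M one p) i q j

  P-else : ∀ p q r → r ≢ one → r ≢ i → ∀ j → P p q r j ≡ M r j
  P-else p q r r≢1 r≢i j = trans (setRow-other (setRow M one p) i q r r≢i j) (setRow-other M one p r r≢1 j)

  restore : ∀ r j → P u v r j ≡ M r j
  restore r j with r Fin.≟ one | r Fin.≟ i
  ... | yes refl | _        = P-1 u v j
  ... | no _     | yes refl = P-i u v j
  ... | no r≢1   | no r≢i   = P-else u v r r≢1 r≢i j

  agree-1 : ∀ p p′ q → AgreeOff one (P p q) (P p′ q)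
  agree-1 p p′ q r r≢1 j with r Fin.≟ i
  ... | yes refl = trans (P-i p q j) (sym (P-i p′ q j))
  ... | no r≢i   = trans (P-else p q r r≢1 r≢i j) (sym (P-else p′ q r r≢1 r≢i j))

  agree-i : ∀ p q q′ → AgreeOff i (P p q) (P p q′)
  agree-i p q q′ r r≢i j with r Fin.≟ one
  ... | yes refl = trans (P-1 p q j) (sym (P-1 p q′ j))
  ... | no r≢1   = trans (P-else p q r r≢1 r≢i j) (sym (P-else p q′ r r≢1 r≢i j))

  add-1 : ∀ q → det (P w q) ≡ det (P u q) + 1ℚ * det (P v q)
  add-1 q = det-row-linear one 1ℚ (agree-1 u w q) (agree-1 v w q) λ j →
    trans (P-1 w q j) (cong₂ _+_ (sym (P-1 u q j)) (trans (sym (*-identityˡ (v j))) (cong (λ t → 1ℚ * t) (sym (P-1 v q j)))))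

  add-i : ∀ p → det (P p w) ≡ det (P p u) + 1ℚ * det (P p v)
  add-i p = det-row-linear i 1ℚ (agree-i p u w) (agree-i p v w) λ j →
    trans (P-i p w j) (cong₂ _+_ (sym (P-i p u j)) (trans (sym (*-identityˡ (v j))) (cong (λ t → 1ℚ * t) (sym (P-i p v j)))))

  P-same : ∀ p → det (P p p) ≡ 0ℚ
  P-same p = det-lower-rows-equal alternating (P p p) {zero} {suc k} (λ ())
    (λ j → trans (P-1 p p j) (sym (P-i p p j)))

  P-v-u : det (P v u) ≡ 0ℚ
  P-v-u = det-first-rows-equal (P v u) λ j →
    trans (P-else v u zero (λ ()) (λ ()) j) (trans (M₀≡Mᵢ j) (sym (P-1 v u j)))

  P-w-w : det (P w w) ≡ det (P u v) + det (P v u)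
  P-w-w = begin
    det (P w w)                                                             ≡⟨ add-1 w ⟩
    det (P u w) + 1ℚ * det (P v w)                                          ≡⟨ cong₂ (λ d e → d + 1ℚ * e) (add-i u) (add-i v) ⟩
    det (P u u) + 1ℚ * det (P u v) + 1ℚ * (det (P v u) + 1ℚ * det (P v v))  ≡⟨ cong₂ (λ d e → d + 1ℚ * det (P u v) + 1ℚ * (det (P v u) + 1ℚ * e)) (P-same u) (P-same v) ⟩
    0ℚ + 1ℚ * det (P u v) + 1ℚ * (det (P v u) + 1ℚ * 0ℚ)                    ≡⟨ simplify (det (P u v)) (det (P v u)) ⟩
    det (P u v) + det (P v u)                                               ∎
    where
    simplify : ∀ d e → 0ℚ + 1ℚ * d + 1ℚ * (e + 1ℚ * 0ℚ) ≡ d + e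
    simplify = solve-∀ ℚ-ring

det-equal-rows : ∀ {n} → Alternating n
det-equal-rows {suc n} M {zero}  {zero}  i≢k Mi≡Mk = contradiction refl i≢k
det-equal-rows {suc n} M {zero}  {suc k} i≢k Mi≡Mk = det-first-row-repeated det-equal-rows M k Mi≡Mk
det-equal-rows {suc n} M {suc i} {zero}  i≢k Mi≡Mk = det-first-row-repeated det-equal-rows M i (sym ∘ Mi≡Mk)
det-equal-rows {suc n} M {suc i} {suc k} i≢k Mi≡Mk =
  det-lower-rows-equal det-equal-rows M (i≢k ∘ cong suc) Mi≡Mk

shear : ∀ {n} → Vector ℚ n → Matrix ℚ (suc n) → Matrix ℚ (suc n)
shear c M zero    j = M zero j
shear c M (suc i) j = M (suc i) j + c i * M zero j

-- Coefficients are removed one at a time, from the highest index allowed by `k`. By linearity in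
-- the affected row, a removal changes the determinant by a multiple of one in which row zero occurs
-- twice.
det-shear-supported : ∀ {n} (M : Matrix ℚ (suc n)) k (c : Vector ℚ n) →
  (∀ i → k ℕ.≤ toℕ i → c i ≡ 0ℚ) → det (shear c M) ≡ det M
det-shear-supported M zero c c≡0 = det-cong {M = shear c M} {N = M} λ
  { zero    j → refl
  ; (suc i) j → trans (cong (λ t → M (suc i) j + t * M zero j) (c≡0 i ℕ.z≤n)) (drop (M (suc i) j) (M zero j))
  }
  where
  drop : ∀ p q → p + 0ℚ * q ≡ p
  drop = solve-∀ ℚ-ring
det-shear-supported {n} M (suc k) c c≡0 with k ℕ.<? n
... | no k≮n  = det-shear-supported M k c
  λ i k≤i → contradiction (ℕ.≤-<-trans k≤i (Fin.toℕ<n i)) k≮n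
... | yes k<n = begin
  det (shear c M)                              ≡⟨ det-row-linear (suc i₀) (c i₀) agree-c′ agree-row row ⟩
  det (shear c′ M) + c i₀ * det R              ≡⟨ cong₂ (λ d e → d + c i₀ * e) (det-shear-supported M k c′ c′≡0) R-zero ⟩
  det M + c i₀ * 0ℚ                            ≡⟨ drop (det M) (c i₀) ⟩
  det M                                        ∎
  where
  open ≡-Reasoning
  i₀ : Fin n
  i₀ = Fin.fromℕ< k<n
  c′ : Vector ℚ n
  c′ = updateAt c i₀ (const 0ℚ)
  R : Matrix ℚ (suc n)
  R = setRow (shear c′ M) (suc i₀) (M zero)
  drop : ∀ p q → p + q * 0ℚ ≡ p
  drop = solve-∀ ℚ-ring
  c′≡c : ∀ {i} → i ≢ i₀ → c′ i ≡ c i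
  c′≡c {i} i≢ = updateAt-minimal i i₀ c i≢
  c′≡0 : ∀ i → k ℕ.≤ toℕ i → c′ i ≡ 0ℚ
  c′≡0 i k≤i with i Fin.≟ i₀
  ... | yes refl = updateAt-updates i₀ c
  ... | no i≢    = trans (c′≡c i≢) (c≡0 i (ℕ.≤∧≢⇒< k≤i λ k≡i →
    i≢ (Fin.toℕ-injective (trans (sym k≡i) (sym (Fin.toℕ-fromℕ< k<n))))))
  agree-c′ : AgreeOff (suc i₀) (shear c′ M) (shear c M)
  agree-c′ zero    _  j = refl
  agree-c′ (suc i) i≢ j = cong (λ t → M (suc i) j + t * M zero j) (c′≡c (i≢ ∘ cong suc))
  agree-row : AgreeOff (suc i₀) R (shear c M)
  agree-row i i≢ j = trans (setRow-other (shear c′ M) (suc i₀) (M zero) i i≢ j) (agree-c′ i i≢ j)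
  row : ∀ j → M (suc i₀) j + c i₀ * M zero j ≡ shear c′ M (suc i₀) j + c i₀ * R (suc i₀) j
  row j = trans (insert (M (suc i₀) j) (c i₀) (M zero j)) (cong₂ (λ t p → M (suc i₀) j + t * M zero j + c i₀ * p)
    (sym (updateAt-updates i₀ c)) (sym (setRow-same (shear c′ M) (suc i₀) (M zero) j)))
    where
    insert : ∀ p t q → p + t * q ≡ p + 0ℚ * q + t * q
    insert = solve-∀ ℚ-ring
  R-zero : det R ≡ 0ℚ
  R-zero = det-equal-rows R {zero} {suc i₀} (λ ()) λ j →
    trans (setRow-other (shear c′ M) (suc i₀) (M zero) zero (λ ()) j)
      (sym (setRow-same (shear c′ M) (suc i₀) (M zero) j))

det-shear : ∀ {n} (c : Vector ℚ n) M → det (shear c M) ≡ det M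
det-shear {n} c M = det-shear-supported M n c λ i n≤i → contradiction (Fin.toℕ<n i) (ℕ.≤⇒≯ n≤i)

det-zero-column : ∀ {n} (M : Matrix ℚ (suc n)) → (∀ i → M i zero ≡ 0ℚ) → det M ≡ 0ℚ
det-zero-column {n} M M₀≡0 = sum-zero (term≡0 n M M₀≡0)
  where
  term≡0 : ∀ n (M : Matrix ℚ (suc n)) → (∀ i → M i zero ≡ 0ℚ) → ∀ j → sgn j * M zero j * det (minor M j) ≡ 0ℚ
  term≡0 n M M₀≡0 zero = trans (cong (λ m → 1ℚ * m * det (minor M zero)) (M₀≡0 zero)) (vanish (det (minor M zero)))
    where
    vanish : ∀ d → 1ℚ * 0ℚ * d ≡ 0ℚ
    vanish = solve-∀ ℚ-ring
  term≡0 (suc n) M M₀≡0 (suc j) = trans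
    (cong (λ d → sgn (suc j) * M zero (suc j) * d) (det-zero-column (minor M (suc j)) (M₀≡0 ∘ suc)))
    (*-zeroʳ (sgn (suc j) * M zero (suc j)))

-- The minors for the other columns keep the cleared first column, so only the corner term survives.
det-pivot : ∀ {n} (M : Matrix ℚ (suc n)) → (∀ i → M (suc i) zero ≡ 0ℚ) →
  det M ≡ M zero zero * det (minor M zero)
det-pivot {zero} M M₀≡0 = one (M zero zero) (det (minor M zero))
  where
  one : ∀ m d → 1ℚ * m * d + 0ℚ ≡ m * d
  one = solve-∀ ℚ-ring
det-pivot {suc n} M M₀≡0 = trans
  (cong (λ s → 1ℚ * M zero zero * det (minor M zero) + s) (sum-zero λ j → trans
    (cong (λ d → sgn (suc j) * M zero (suc j) * d) (det-zero-column (minor M (suc j)) M₀≡0))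
    (*-zeroʳ (sgn (suc j) * M zero (suc j)))))
  (one (M zero zero) (det (minor M zero)))
  where
  one : ∀ m d → 1ℚ * m * d + 0ℚ ≡ m * d
  one = solve-∀ ℚ-ring

det-eliminate : ∀ {n} (M : Matrix ℚ (suc n)) (c : Vector ℚ n) →
  (∀ i → M (suc i) zero + c i * M zero zero ≡ 0ℚ) →
  det M ≡ M zero zero * det (λ i j → M (suc i) (suc j) + c i * M zero (suc j))
det-eliminate M c clears = trans (sym (det-shear c M)) (det-pivot (shear c M) clears)

-- Adding all rows to the first one makes it constant.
det-constant-column-sums : ∀ {n} (M : Matrix ℚ (suc n)) σ → (∀ j → sum (λ i → M i j) ≡ σ) →
  det M ≡ σ * det (λ i j → M (suc i) (suc j) - M (suc i) zero)
det-constant-column-sums {n} M σ column = begin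
  det M
    ≡⟨ sym (trans (cong (λ s → det M + s) (sum-zero repeated)) (+-identityʳ (det M))) ⟩
  det M + sum (λ k → det (withRow (M (suc k))))
    -- The minors along the first row do not involve that row, so all these expansions share them
    -- and join into one double sum.
    ≡⟨⟩
  sum (λ i → sum λ j → sgn j * M i j * det (minor M j))
    ≡⟨ ∑-comm (λ i j → sgn j * M i j * det (minor M j)) ⟩
  sum (λ j → sum λ i → sgn j * M i j * det (minor M j))
    ≡⟨ sum-cong-≗ (λ j → trans (sum-*ʳ (det (minor M j)) (λ i → sgn j * M i j))
        (trans (cong (_* det (minor M j)) (trans (sum-*ˡ (sgn j) (λ i → M i j)) (cong (λ s → sgn j * s) (column j))))
          (regroup (sgn j) σ (det (minor M j))))) ⟩
  sum (λ j → σ * (sgn j * 1ℚ * det (minor M j)))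
    ≡⟨ sum-*ˡ σ (λ j → sgn j * 1ℚ * det (minor M j)) ⟩
  σ * det (withRow (λ _ → 1ℚ))
    ≡⟨ cong (λ d → σ * d) (trans (det-eliminate (withRow (λ _ → 1ℚ)) (λ i → - M (suc i) zero) (λ i → cancel (M (suc i) zero)))
        (trans (*-identityˡ _) (det-cong λ i j → cong (λ m → M (suc i) (suc j) + m) (*-identityʳ (- M (suc i) zero))))) ⟩
  σ * det (λ i j → M (suc i) (suc j) - M (suc i) zero) ∎
  where
  open ≡-Reasoning
  withRow : Vector ℚ (suc n) → Matrix ℚ (suc n)
  withRow p zero    j = p j
  withRow p (suc i) j = M (suc i) j
  repeated : ∀ k → det (withRow (M (suc k))) ≡ 0ℚ
  repeated k = det-equal-rows (withRow (M (suc k))) {zero} {suc k} (λ ()) λ _ → refl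
  regroup : ∀ s t d → s * t * d ≡ t * (s * 1ℚ * d)
  regroup = solve-∀ ℚ-ring
  cancel : ∀ p → p + - p * 1ℚ ≡ 0ℚ
  cancel = solve-∀ ℚ-ring

-- Determinants of negative definite matrices

form : ∀ {n} → Matrix ℚ n → Vector ℚ n → ℚ
form M y = sum λ i → y i * sum λ j → M i j * y j

^-nonneg : ∀ {c} → 0ℚ ≤ c → ∀ n → 0ℚ ≤ c ^ n
^-nonneg 0≤c zero    = nonNegative⁻¹ 1ℚ
^-nonneg 0≤c (suc n) = *-nonneg 0≤c (^-nonneg 0≤c n)

-- By Schur complements with respect to the first entry.
negative-definite⇒det≥ : ∀ {n} (M : Matrix ℚ n) {c} → 0ℚ < c → (∀ i j → M i j ≡ M j i) →
  (∀ y → form M y ≤ - (c * norm² y)) → c ^ n ≤ ∣ det M ∣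
negative-definite⇒det≥ {zero}  M 0<c M-sym neg = ≤-refl
negative-definite⇒det≥ {suc n} M {c} 0<c M-sym neg = begin
  c * c ^ n              ≤⟨ *-monoʳ-≤-nonNeg (c ^ n) {{nonNegative (^-nonneg (<⇒≤ 0<c) n)}} c≤-a ⟩
  - a * c ^ n            ≤⟨ *-monoˡ-≤-nonNeg (- a) {{nonNegative (<⇒≤ 0<-a)}} (negative-definite⇒det≥ S 0<c S-sym S-neg) ⟩
  - a * ∣ det S ∣        ≡⟨ cong (_* ∣ det S ∣) (sym (trans (sym (∣-p∣≡∣p∣ a)) (0≤p⇒∣p∣≡p (<⇒≤ 0<-a)))) ⟩
  ∣ a ∣ * ∣ det S ∣      ≡⟨ sym (∣p*q∣≡∣p∣*∣q∣ a (det S)) ⟩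
  ∣ a * det S ∣          ≡⟨ cong ∣_∣ (sym (det-eliminate M (λ i → e * M (suc i) zero) clears)) ⟩
  ∣ det M ∣              ∎
  where
  open ≤-Reasoning
  a : ℚ
  a = M zero zero
  b : Vector ℚ n
  b j = M zero (suc j)

  extend : ℚ → Vector ℚ n → Vector ℚ (suc n)
  extend t y zero    = t
  extend t y (suc i) = y i

  lower : Vector ℚ n → ℚ
  lower y = sum λ i → y i * sum λ j → M (suc i) (suc j) * y j

  b·_ : Vector ℚ n → ℚ
  b· y = sum λ j → b j * y j

  form-extend : ∀ t y → form M (extend t y) ≡ t * (a * t + b· y) + (t * (b· y) + lower y)
  form-extend t y = cong (λ s → t * (a * t + b· y) + s) (trans
    (sum-cong-≗ λ i → trans (distribute (y i) (M (suc i) zero) t _)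
      (cong (λ m → t * (m * y i) + y i * sum (λ j → M (suc i) (suc j) * y j)) (M-sym (suc i) zero)))
    (trans (∑-distrib-+ (λ i → t * (b i * y i)) (λ i → y i * sum λ j → M (suc i) (suc j) * y j))
      (cong (_+ lower y) (sum-*ˡ t (λ i → b i * y i)))))
    where
    distribute : ∀ p m t s → p * (m * t + s) ≡ t * (m * p) + p * s
    distribute = solve-∀ ℚ-ring

  norm²-zeros : norm² {n} (λ _ → 0ℚ) ≡ 0ℚ
  norm²-zeros = sum-zero {n} λ _ → refl

  c≤-a : c ≤ - a
  c≤-a = subst₂ _≤_ (neg-neg c) refl (neg-antimono-≤ (subst₂ _≤_ form-e₀ norm-e₀ (neg (extend 1ℚ (λ _ → 0ℚ)))))
    where
    b·0 : b· (λ _ → 0ℚ) ≡ 0ℚ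
    b·0 = sum-zero λ j → *-zeroʳ (b j)
    lower-0 : lower (λ _ → 0ℚ) ≡ 0ℚ
    lower-0 = sum-zero λ i → *-zeroˡ (sum λ j → M (suc i) (suc j) * 0ℚ)
    first : ∀ a → 1ℚ * (a * 1ℚ + 0ℚ) + (1ℚ * 0ℚ + 0ℚ) ≡ a
    first = solve-∀ ℚ-ring
    form-e₀ : form M (extend 1ℚ (λ _ → 0ℚ)) ≡ a
    form-e₀ = trans (form-extend 1ℚ (λ _ → 0ℚ)) (trans
      (cong₂ (λ s l → 1ℚ * (a * 1ℚ + s) + (1ℚ * s + l)) b·0 lower-0) (first a))
    norm-e₀ : - (c * norm² (extend 1ℚ (λ _ → 0ℚ))) ≡ - c
    norm-e₀ = cong -_ (trans (cong (λ s → c * (1ℚ * 1ℚ + s)) norm²-zeros) (*-identityʳ c))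

  0<-a : 0ℚ < - a
  0<-a = <-≤-trans 0<c c≤-a

  inv : ∃[ e ] (0ℚ < e × - a * e ≡ 1ℚ)
  inv = inverse 0<-a
  e : ℚ
  e = proj₁ inv
  -ae≡1 : - a * e ≡ 1ℚ
  -ae≡1 = proj₂ (proj₂ inv)

  clears : ∀ i → M (suc i) zero + e * M (suc i) zero * a ≡ 0ℚ
  clears i = trans (factor (M (suc i) zero) e a) (trans (cong (λ t → M (suc i) zero * (1ℚ - t)) -ae≡1) (*-zeroʳ (M (suc i) zero)))
    where
    factor : ∀ m e a → m + e * m * a ≡ m * (1ℚ - - a * e)
    factor = solve-∀ ℚ-ring

  S : Matrix ℚ n
  S i j = M (suc i) (suc j) + e * M (suc i) zero * b j

  S-sym : ∀ i j → S i j ≡ S j i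
  S-sym i j = cong₂ _+_ (M-sym (suc i) (suc j)) (trans (cong₂ (λ p q → e * p * q) (M-sym (suc i) zero) (M-sym zero (suc j)))
    (swap e (b i) (M (suc j) zero)))
    where
    swap : ∀ e p q → e * p * q ≡ e * q * p
    swap = solve-∀ ℚ-ring

  form-S : ∀ y → form S y ≡ lower y + e * (b· y) * (b· y)
  form-S y = trans (sum-cong-≗ λ i → trans
      (cong (λ s → y i * s) (trans (sum-cong-≗ λ j → split (M (suc i) (suc j)) (e * M (suc i) zero) (b j) (y j))
        (trans (∑-distrib-+ (λ j → M (suc i) (suc j) * y j) (λ j → e * M (suc i) zero * (b j * y j)))
          (cong (λ s → sum (λ j → M (suc i) (suc j) * y j) + s) (sum-*ˡ (e * M (suc i) zero) (λ j → b j * y j))))))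
      (trans (regroup (y i) _ e (M (suc i) zero) (b· y))
        (cong (λ m → y i * sum (λ j → M (suc i) (suc j) * y j) + e * (b· y) * (m * y i)) (M-sym (suc i) zero))))
    (trans (∑-distrib-+ (λ i → y i * sum λ j → M (suc i) (suc j) * y j) (λ i → e * (b· y) * (b i * y i)))
      (cong (λ s → lower y + s) (sum-*ˡ (e * (b· y)) (λ i → b i * y i))))
    where
    split : ∀ m k b y → (m + k * b) * y ≡ m * y + k * (b * y)
    split = solve-∀ ℚ-ring
    regroup : ∀ y s e m t → y * (s + e * m * t) ≡ y * s + e * t * (m * y)
    regroup = solve-∀ ℚ-ring

  -- The form of S is that of M at the first entry e (b · y), which is stationary.
  S-neg : ∀ y → form S y ≤ - (c * norm² y)
  S-neg y = begin
    form S y                            ≡⟨ trans (form-S y) (sym (trans (form-extend t y) stationary)) ⟩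
    form M (extend t y)                 ≤⟨ neg (extend t y) ⟩
    - (c * (t ² + norm² y))             ≤⟨ neg-antimono-≤ (*-monoˡ-≤-nonNeg c {{nonNegative (<⇒≤ 0<c)}}
                                             (≤-by (t ²) (²-nonneg t) (+-comm (norm² y) (t ²)))) ⟩
    - (c * norm² y)                     ∎
    where
    t : ℚ
    t = e * (b· y)
    stationary : t * (a * t + b· y) + (t * (b· y) + lower y) ≡ lower y + e * (b· y) * (b· y)
    stationary = trans (collect e a (b· y) (lower y)) (trans
      (cong (λ u → lower y + e * (b· y) * (b· y) + e * (b· y) * (b· y) * (1ℚ - u)) -ae≡1) (drop (lower y + e * (b· y) * (b· y)) (e * (b· y) * (b· y))))
      where
      collect : ∀ e a s l → e * s * (a * (e * s) + s) + (e * s * s + l) ≡ l + e * s * s + e * s * s * (1ℚ - - a * e)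
      collect = solve-∀ ℚ-ring
      drop : ∀ p q → p + q * (1ℚ - 1ℚ) ≡ p
      drop = solve-∀ ℚ-ring

-- The determinant of r I − L

module _ {n : ℕ} (G : Graph n) where

  private
    w : Fin n → Fin n → ℚ
    w = weight G

  deg : Fin n → ℚ
  deg i = sum (w i)

  charMatrix : ℚ → Matrix ℚ n
  charMatrix r i j = δ i j * r - (δ i j * deg i - w i j)

  δ-transport : ∀ i j (f : Vector ℚ n) → δ i j * f i ≡ δ j i * f j
  δ-transport i j f with i Fin.≟ j
  ... | yes refl = cong (_* f i) (sym (δ-refl i))
  ... | no i≢j   = trans (*-zeroˡ (f i)) (sym (trans (cong (_* f j) (δ-≢ (i≢j ∘ sym))) (*-zeroˡ (f j))))

  charMatrix-sym : ∀ r i j → charMatrix r i j ≡ charMatrix r j i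
  charMatrix-sym r i j = cong₂ _-_ (δ-transport i j (λ _ → r))
    (cong₂ _-_ (δ-transport i j deg) (weight-sym G i j))

  charMatrix-row : ∀ r i y → sum (λ j → charMatrix r i j * y j) ≡ r * y i - slope G y i
  charMatrix-row r i y = begin
    sum (λ j → charMatrix r i j * y j)
      ≡⟨ sum-cong-≗ (λ j → expand (δ i j) r (deg i) (w i j) (y j)) ⟩
    sum (λ j → (r - deg i) * (δ i j * y j) + w i j * y j)
      ≡⟨ trans (∑-distrib-+ (λ j → (r - deg i) * (δ i j * y j)) (λ j → w i j * y j))
          (cong (_+ wy) (trans (sum-*ˡ (r - deg i) (λ j → δ i j * y j)) (cong (λ s → (r - deg i) * s) (sum-δ i y)))) ⟩
    (r - deg i) * y i + wy
      ≡⟨ collect r (deg i) (y i) wy ⟩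
    r * y i - (deg i * y i - wy)
      ≡⟨ cong (λ s → r * y i - s) (sym slope-split) ⟩
    r * y i - slope G y i ∎
    where
    open ≡-Reasoning
    wy : ℚ
    wy = sum (λ j → w i j * y j)
    expand : ∀ d r e w y → (d * r - (d * e - w)) * y ≡ (r - e) * (d * y) + w * y
    expand = solve-∀ ℚ-ring
    collect : ∀ r e y s → (r - e) * y + s ≡ r * y - (e * y - s)
    collect = solve-∀ ℚ-ring
    distribute : ∀ w p q → w * (p - q) ≡ w * p - w * q
    distribute = solve-∀ ℚ-ring
    slope-split : slope G y i ≡ deg i * y i - wy
    slope-split = trans (sum-cong-≗ λ j → distribute (w i j) (y i) (y j))
      (trans (sum-minus (λ j → w i j * y i) (λ j → w i j * y j)) (cong (_- wy) (sum-*ʳ (y i) (w i))))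

  -- By symmetry this is a row sum, the value at the constant vector 1, which the Laplacian
  -- annihilates.
  charMatrix-column-sum : ∀ r j → sum (λ i → charMatrix r i j) ≡ r
  charMatrix-column-sum r j = begin
    sum (λ i → charMatrix r i j)             ≡⟨ sum-cong-≗ (λ i → trans (charMatrix-sym r i j) (sym (*-identityʳ (charMatrix r j i)))) ⟩
    sum (λ i → charMatrix r j i * 1ℚ)        ≡⟨ charMatrix-row r j (λ _ → 1ℚ) ⟩
    r * 1ℚ - slope G (λ _ → 1ℚ) j            ≡⟨ cong (λ s → r * 1ℚ - s) (sum-zero λ i → *-zeroʳ (w j i)) ⟩
    r * 1ℚ - 0ℚ                              ≡⟨ simplify r ⟩
    r                                        ∎
    where
    open ≡-Reasoning
    simplify : ∀ r → r * 1ℚ - 0ℚ ≡ r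
    simplify = solve-∀ ℚ-ring

norm²-translate : ∀ {n} (y : Vector ℚ n) s →
  norm² (λ i → y i - s) ≡ norm² y + (- (2ℚ * s) * sum y + s ² * size n)
norm²-translate {n} y s = trans (sum-cong-≗ λ i → expand (y i) s)
  (sum-linear₃ (- (2ℚ * s)) (s ²) (λ i → y i ²) y (λ _ → 1ℚ))
  where
  expand : ∀ p s → (p - s) * (p - s) ≡ p * p + (- (2ℚ * s) * p + s * s * 1ℚ)
  expand = solve-∀ ℚ-ring

energy-translate : ∀ {n} (G : Graph n) (y : Vector ℚ n) s → energy G (λ i → y i - s) ≡ energy G y
energy-translate G y s = sum-cong-≗ λ i → sum-cong-≗ λ j → invariant (weight G i j) (y i) (y j) s
  where
  invariant : ∀ w p q s → w * (((p - s) - (q - s)) * ((p - s) - (q - s))) ≡ w * ((p - q) * (p - q))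
  invariant = solve-∀ ℚ-ring

-- On mean-zero vectors 2 q |y|² ≤ energy y says that λ₂ ≥ q.
SpectralGap : ∀ {n} → Graph n → ℚ → Set
SpectralGap G q = ∀ y → sum y ≡ 0ℚ → 2ℚ * q * norm² y ≤ energy G y

-- The matrix r I − L − (q / n) J is negative definite and its determinant differs
-- from that of r I − L by the factor (r − q) / r, since both have constant column sums.
module DetBound {m : ℕ} (G : Graph (suc m)) (q r : ℚ) (gap : SpectralGap G q) (r<q : r < q) where
  n : ℕ
  n = suc m
  inv : ∃[ c ] (0ℚ < c × size n * c ≡ 1ℚ)
  inv = inverse (<-≤-trans (positive⁻¹ 1ℚ) (size-pos m))
  c t : ℚ
  c = proj₁ inv
  t = q * c
  nc≡1 : size n * c ≡ 1ℚ
  nc≡1 = proj₂ (proj₂ inv)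

  K N : Matrix ℚ n
  K = charMatrix G r
  N i j = K i j - t

  0<q-r : 0ℚ < q - r
  0<q-r = p<q⇒0<q-p r<q

  N-sym : ∀ i j → N i j ≡ N j i
  N-sym i j = cong (_- t) (charMatrix-sym G r i j)

  form-N : ∀ y → form N y ≡ r * norm² y - ½ * energy G y - t * (sum y * sum y)
  form-N y = begin
    form N y
      ≡⟨ sum-cong-≗ (λ i → trans (cong (λ s → y i * s) (row i)) (expand (y i) r (slope G y i) t (sum y))) ⟩
    sum (λ i → r * y i ² + ((- 1ℚ) * (y i * slope G y i) + (- (t * sum y)) * y i))
      ≡⟨ sum-linear₃ (- 1ℚ) (- (t * sum y)) (λ i → r * y i ²) (λ i → y i * slope G y i) y ⟩
    sum (λ i → r * y i ²) + ((- 1ℚ) * s + (- (t * sum y)) * sum y)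
      ≡⟨ cong (λ p → p + ((- 1ℚ) * s + (- (t * sum y)) * sum y)) (sum-*ˡ r (λ i → y i ²)) ⟩
    r * norm² y + ((- 1ℚ) * s + (- (t * sum y)) * sum y)
      ≡⟨ collect r (norm² y) s t (sum y) ⟩
    r * norm² y - ½ * (2ℚ * s) - t * (sum y * sum y)
      ≡⟨ cong (λ e → r * norm² y - ½ * e - t * (sum y * sum y)) (sym (green G y y)) ⟩
    r * norm² y - ½ * energy G y - t * (sum y * sum y) ∎
    where
    open ≡-Reasoning
    s : ℚ
    s = sum (λ i → y i * slope G y i)
    row : ∀ i → sum (λ j → N i j * y j) ≡ r * y i - slope G y i - t * sum y
    row i = trans (sum-cong-≗ λ j → distribute (K i j) t (y j))
      (trans (sum-minus (λ j → K i j * y j) (λ j → t * y j)) (cong₂ _-_ (charMatrix-row G r i y) (sum-*ˡ t y)))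
      where
      distribute : ∀ k t y → (k - t) * y ≡ k * y - t * y
      distribute = solve-∀ ℚ-ring
    expand : ∀ p r g t u → p * (r * p - g - t * u) ≡ r * (p * p) + ((- 1ℚ) * (p * g) + (- (t * u)) * p)
    expand = solve-∀ ℚ-ring
    collect : ∀ r p s t u → r * p + ((- 1ℚ) * s + (- (t * u)) * u) ≡ r * p - ½ * (2ℚ * s) - t * (u * u)
    collect = solve-∀ ℚ-ring

  -- Subtracting the mean from `y` keeps its energy and lowers its squared norm by S²/n, where S = ∑
  -- y. The loss of q S²/n in the gap inequality is exactly what the term (q/n) J restores.
  N-negative : ∀ y → form N y ≤ - ((q - r) * norm² y)
  N-negative y = ≤-by _ (*-nonneg (nonNegative⁻¹ ½) (p≤q⇒0≤q-p centred)) (begin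
    form N y + ½ * (energy G y′ - 2ℚ * q * norm² y′)
      ≡⟨ cong₂ (λ f d → f + ½ * d) (form-N y) (cong₂ (λ e p → e - 2ℚ * q * p) (energy-translate G y μ) (norm²-translate y μ)) ⟩
    (r * norm² y - ½ * energy G y - t * (S * S)) + ½ * (energy G y - 2ℚ * q * (norm² y + (- (2ℚ * μ) * S + μ ² * size n)))
      ≡⟨ expand r q c (norm² y) (energy G y) S (size n) ⟩
    - ((q - r) * norm² y) + q * (c * (S * S)) * (1ℚ - size n * c)
      ≡⟨ cong (λ u → - ((q - r) * norm² y) + q * (c * (S * S)) * (1ℚ - u)) nc≡1 ⟩
    - ((q - r) * norm² y) + q * (c * (S * S)) * (1ℚ - 1ℚ)
      ≡⟨ drop (- ((q - r) * norm² y)) (q * (c * (S * S))) ⟩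
    - ((q - r) * norm² y) ∎)
    where
    open ≡-Reasoning
    S μ : ℚ
    S = sum y
    μ = S * c
    y′ : Vector ℚ n
    y′ i = y i - μ
    mean-zero : sum y′ ≡ 0ℚ
    mean-zero = trans (sum-minus y (λ _ → μ)) (trans (cong (λ s → S - s) (trans (sum-const n μ)
      (trans (*-assoc S c (size n)) (trans (cong (λ u → S * u) (trans (*-comm c (size n)) nc≡1)) (*-identityʳ S)))))
      (+-inverseʳ S))
    centred : 2ℚ * q * norm² y′ ≤ energy G y′
    centred = gap y′ mean-zero
    expand : ∀ r q c p e S m →
      (r * p - ½ * e - q * c * (S * S)) + ½ * (e - 2ℚ * q * (p + (- (2ℚ * (S * c)) * S + (S * c) * (S * c) * m))) ≡
      - ((q - r) * p) + q * (c * (S * S)) * (1ℚ - m * c)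
    expand = solve-∀ ℚ-ring
    drop : ∀ p q → p + q * (1ℚ - 1ℚ) ≡ p
    drop = solve-∀ ℚ-ring

  -- The factor common to both determinants: a constant added to all entries cancels in the
  -- differences of columns.
  R : ℚ
  R = det (λ i j → K (suc i) (suc j) - K (suc i) zero)

  det-K : det K ≡ r * R
  det-K = det-constant-column-sums K r (charMatrix-column-sum G r)

  det-N : det N ≡ (r - q) * R
  det-N = trans (det-constant-column-sums N (r - q) column)
    (cong (λ d → (r - q) * d) (det-cong λ i j → shift (K (suc i) (suc j)) (K (suc i) zero) t))
    where
    shift : ∀ p q t → (p - t) - (q - t) ≡ p - q
    shift = solve-∀ ℚ-ring
    column : ∀ j → sum (λ i → N i j) ≡ r - q
    column j = trans (sum-minus (λ i → K i j) (λ _ → t)) (cong₂ _-_ (charMatrix-column-sum G r j)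
      (trans (sum-const n t) (trans (*-assoc q c (size n)) (trans (cong (λ u → q * u) (trans (*-comm c (size n)) nc≡1)) (*-identityʳ q)))))

  -- The relation r det N = (r - q) det K is used in this product form because `r` may be 0; only
  -- the positive factor q - r is cancelled.
  det-charMatrix≥ : (q - r) ^ m * ∣ r ∣ ≤ ∣ det K ∣
  det-charMatrix≥ = *-cancelˡ-≤-pos (q - r) {{positive 0<q-r}} (begin
    (q - r) * ((q - r) ^ m * ∣ r ∣)        ≡⟨ sym (*-assoc (q - r) ((q - r) ^ m) ∣ r ∣) ⟩
    (q - r) ^ n * ∣ r ∣                    ≤⟨ *-monoʳ-≤-nonNeg ∣ r ∣ {{∣-∣-nonNeg r}} (negative-definite⇒det≥ N 0<q-r N-sym N-negative) ⟩
    ∣ det N ∣ * ∣ r ∣                      ≡⟨ sym (∣p*q∣≡∣p∣*∣q∣ (det N) r) ⟩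
    ∣ det N * r ∣                          ≡⟨ cong (λ d → ∣ d * r ∣) det-N ⟩
    ∣ (r - q) * R * r ∣                    ≡⟨ cong ∣_∣ (regroup r q R) ⟩
    ∣ - ((q - r) * (r * R)) ∣              ≡⟨ ∣-p∣≡∣p∣ ((q - r) * (r * R)) ⟩
    ∣ (q - r) * (r * R) ∣                  ≡⟨ ∣p*q∣≡∣p∣*∣q∣ (q - r) (r * R) ⟩
    ∣ q - r ∣ * ∣ r * R ∣                  ≡⟨ cong₂ _*_ (0≤p⇒∣p∣≡p (<⇒≤ 0<q-r)) (cong ∣_∣ (sym det-K)) ⟩
    (q - r) * ∣ det K ∣                    ∎)
    where
    open ≤-Reasoning
    regroup : ∀ r q R → (r - q) * R * r ≡ - ((q - r) * (r * R))
    regroup = solve-∀ ℚ-ring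

-- Real eigenvalues

module ℝ-semiring = RawSemiringDefs (RawRing.rawSemiring ℝ-rawRing)

product : ∀ {n} → Vector ℚ n → ℚ
product = RawSemiringDefs.product +-*-rawSemiring

-- At a fixed tolerance the order of ℝ has this form, so statements about reals become rational
-- inequalities at a common late index.
Eventually : (ℕ → Set) → Set
Eventually P = ∃[ N ] (∀ k → N ℕ.≤ k → P k)

infixr 4 _&_
_&_ : ∀ {P Q : ℕ → Set} → Eventually P → Eventually Q → Eventually (λ k → P k × Q k)
(M , p) & (N , q) = M ℕ.⊔ N , λ k MN≤k →
  p k (ℕ.≤-trans (ℕ.m≤m⊔n M N) MN≤k) , q k (ℕ.≤-trans (ℕ.m≤n⊔m M N) MN≤k)

eventually-map : ∀ {P Q : ℕ → Set} → (∀ k → P k → Q k) → Eventually P → Eventually Q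
eventually-map f (N , p) = N , λ k N≤k → f k (p k N≤k)

eventually-absurd : ∀ {P : ℕ → Set} → Eventually P → (∀ k → ¬ P k) → ⊥
eventually-absurd (N , p) ¬p = ¬p N (p N ℕ.≤-refl)

∣∣≤-by : ∀ p {e} → p ≤ e → - p ≤ e → ∣ p ∣ ≤ e
∣∣≤-by p {e} p≤e -p≤e with ∣p∣≡p∨∣p∣≡-p p
... | inj₁ eq = subst (_≤ e) (sym eq) p≤e
... | inj₂ eq = subst (_≤ e) (sym eq) -p≤e

p≤∣p∣ : ∀ p → p ≤ ∣ p ∣
p≤∣p∣ p with ≤-total 0ℚ p
... | inj₁ 0≤p = ≤-reflexive (sym (0≤p⇒∣p∣≡p 0≤p))
... | inj₂ p≤0 = ≤-trans p≤0 (0≤∣p∣ p)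

-p≤∣p∣ : ∀ p → - p ≤ ∣ p ∣
-p≤∣p∣ p = subst (- p ≤_) (∣-p∣≡∣p∣ p) (p≤∣p∣ (- p))

seq-sum : ∀ {n} (f : Vector ℝ n) k → seq (ℝ-semiring.sum f) k ≡ sum (λ i → seq (f i) k)
seq-sum {zero}  f k = refl
seq-sum {suc n} f k = cong (λ s → seq (f zero) k + s) (seq-sum (f ∘ suc) k)

seq-product : ∀ {n} (f : Vector ℝ n) k → seq (ℝ-semiring.product f) k ≡ product (λ i → seq (f i) k)
seq-product {zero}  f k = refl
seq-product {suc n} f k = cong (λ s → seq (f zero) k * s) (seq-product (f ∘ suc) k)

seq-^ : ∀ x n k → seq (x ℝ-semiring.^ n) k ≡ seq x k ^ n
seq-^ x zero    k = refl
seq-^ x (suc n) k = cong (λ s → seq x k * s) (seq-^ x n k)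

-- Arithmetic on ℝ is termwise, so the whole rational theory of determinants applies at each index.
seq-det : ∀ {n} (M : Matrix ℝ n) k → seq (Defs.det M) k ≡ det (λ i j → seq (M i j) k)
seq-det {zero}  M k = refl
seq-det {suc n} M k = trans
  (seq-sum (λ j → (((Defs.- Defs.1ℝ) ℝ-semiring.^ toℕ j) Defs.* M zero j) Defs.* Defs.det (λ i l → M (suc i) (punchIn j l))) k)
  (sum-cong-≗ λ j → cong₂ (λ s d → s * seq (M zero j) k * d)
    (seq-^ (Defs.- Defs.1ℝ) (toℕ j) k) (seq-det (λ i l → M (suc i) (punchIn j l)) k))

seq-diagonal : ∀ {n} (d : Vector ℝ n) i j k → seq (Defs.diagonal d i j) k ≡ δ i j * seq (d i) k
seq-diagonal d i j k with does (i Fin.≟ j)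
... | true  = sym (*-identityˡ (seq (d i) k))
... | false = sym (*-zeroˡ (seq (d i) k))

length-filter : ∀ {a} {A : Set a} {p} {P : Pred A p} (P? : Decidable P) {n} (f : Fin n → A) →
  + length (filter P? (tabulate f)) / 1 ≡ sum (λ i → if does (P? (f i)) then 1ℚ else 0ℚ)
length-filter P? {zero}  f = refl
length-filter P? {suc n} f with does (P? (f zero))
... | true  = trans (fromℕ-suc (length (filter P? (tabulate (f ∘ suc))))) (cong (λ s → 1ℚ + s) (length-filter P? (f ∘ suc)))
... | false = trans (length-filter P? (f ∘ suc)) (sym (+-identityˡ (sum λ i → if does (P? (f (suc i))) then 1ℚ else 0ℚ)))

module _ {n : ℕ} (G : Graph n) where
  open Graph G using (_~?_; adjacency)

  seq-adjacency : ∀ i j k → seq (adjacency i j) k ≡ weight G i j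
  seq-adjacency i j k with does (i ~? j)
  ... | true  = refl
  ... | false = refl

  seq-laplacian : ∀ i j k → seq (laplacian G i j) k ≡ δ i j * deg G i - weight G i j
  seq-laplacian i j k = cong₂ _-_
    (trans (seq-diagonal (Defs.fromℕ ∘ Graph.degree G) i j k) (cong (λ d → δ i j * d) (length-filter (i ~?_) (λ l → l))))
    (seq-adjacency i j k)

  seq-characteristic : ∀ x k → seq (characteristic (laplacian G) x) k ≡ det (charMatrix G (seq x k))
  seq-characteristic x k = trans
    (seq-det (λ i j → Defs.diagonal (λ _ → x) i j Defs.- laplacian G i j) k)
    (det-cong λ i j → cong₂ _-_ (seq-diagonal (λ _ → x) i j k) (seq-laplacian i j k))

product-zero : ∀ {n} (f : Vector ℚ n) i → f i ≡ 0ℚ → product f ≡ 0ℚ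
product-zero f zero    fi≡0 = trans (cong (_* product (f ∘ suc)) fi≡0) (*-zeroˡ (product (f ∘ suc)))
product-zero f (suc i) fi≡0 = trans (cong (λ s → f zero * s) (product-zero (f ∘ suc) i fi≡0)) (*-zeroʳ (f zero))

eventually-bounded : ∀ (x : ℝ) → ∃[ B ] (0ℚ < B × Eventually (λ k → ∣ seq x k ∣ ≤ B))
eventually-bounded x with cauchy x 1ℚ (positive⁻¹ 1ℚ)
... | N , close = 1ℚ + ∣ seq x N ∣ , +-pos-nonneg (positive⁻¹ 1ℚ) (0≤∣p∣ (seq x N)) , N , λ k N≤k → begin
  ∣ seq x k ∣                                   ≡⟨ cong ∣_∣ (split (seq x k) (seq x N)) ⟩
  ∣ (seq x k - seq x N) + seq x N ∣             ≤⟨ ∣p+q∣≤∣p∣+∣q∣ (seq x k - seq x N) (seq x N) ⟩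
  ∣ seq x k - seq x N ∣ + ∣ seq x N ∣           ≤⟨ +-monoˡ-≤ ∣ seq x N ∣ (<⇒≤ (close k N N≤k ℕ.≤-refl)) ⟩
  1ℚ + ∣ seq x N ∣                              ∎
  where
  open ≤-Reasoning
  split : ∀ p q → p ≡ (p - q) + q
  split = solve-∀ ℚ-ring

*-mono-≤-abs : ∀ {p q P Q} → ∣ p ∣ ≤ P → ∣ q ∣ ≤ Q → ∣ p * q ∣ ≤ P * Q
*-mono-≤-abs {p} {q} {P} {Q} p≤P q≤Q = begin
  ∣ p * q ∣          ≡⟨ ∣p*q∣≡∣p∣*∣q∣ p q ⟩
  ∣ p ∣ * ∣ q ∣      ≤⟨ *-monoʳ-≤-nonNeg ∣ q ∣ {{∣-∣-nonNeg q}} p≤P ⟩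
  P * ∣ q ∣          ≤⟨ *-monoˡ-≤-nonNeg P {{nonNegative (≤-trans (0≤∣p∣ p) p≤P)}} q≤Q ⟩
  P * Q              ∎
  where open ≤-Reasoning

-- The bound is uniform in `t` because the point of evaluation is chosen later, depending on `B`.
product-bounded : ∀ {n} (ev : Vector ℝ n) → ∃[ B ] (0ℚ < B ×
  Eventually (λ k → ∀ t → ∣ t ∣ ≤ 1ℚ → ∣ product (λ i → t - seq (ev i) k) ∣ ≤ B))
product-bounded {zero}  ev = 1ℚ , positive⁻¹ 1ℚ , 0 , λ _ _ _ _ → ≤-refl
product-bounded {suc n} ev = extend (eventually-bounded (ev zero)) (product-bounded (ev ∘ suc))
  where
  TailBound : ℚ → ℕ → Set
  TailBound B k = ∀ t → ∣ t ∣ ≤ 1ℚ → ∣ product (λ i → t - seq (ev (suc i)) k) ∣ ≤ B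
  extend : ∃[ A ] (0ℚ < A × Eventually (λ k → ∣ seq (ev zero) k ∣ ≤ A)) →
    ∃[ B ] (0ℚ < B × Eventually (TailBound B)) →
    ∃[ B ] (0ℚ < B × Eventually (λ k → ∀ t → ∣ t ∣ ≤ 1ℚ → ∣ product (λ i → t - seq (ev i) k) ∣ ≤ B))
  extend (A , 0<A , a) (B , 0<B , b) = (1ℚ + A) * B , *-pos (+-mono-< (positive⁻¹ 1ℚ) 0<A) 0<B ,
    eventually-map (λ k (hA , hB) t t≤1 → *-mono-≤-abs
      {t - seq (ev zero) k} {product (λ i → t - seq (ev (suc i)) k)}
      (≤-trans (∣p-q∣≤∣p∣+∣q∣ t (seq (ev zero) k)) (+-mono-≤ t≤1 hA)) (hB t t≤1))
      (_&_ {λ k → ∣ seq (ev zero) k ∣ ≤ A} {TailBound B} a b)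

^-pos : ∀ {c} → 0ℚ < c → ∀ n → 0ℚ < c ^ n
^-pos 0<c zero    = positive⁻¹ 1ℚ
^-pos 0<c (suc n) = *-pos 0<c (^-pos 0<c n)

^-mono : ∀ {c d} → 0ℚ ≤ c → c ≤ d → ∀ n → c ^ n ≤ d ^ n
^-mono 0≤c c≤d zero    = ≤-refl
^-mono {c} {d} 0≤c c≤d (suc n) = ≤-trans
  (*-monoʳ-≤-nonNeg (c ^ n) {{nonNegative (^-nonneg 0≤c n)}} c≤d)
  (*-monoˡ-≤-nonNeg d {{nonNegative (≤-trans 0≤c c≤d)}} (^-mono 0≤c c≤d n))

pos-lower-bound : ∀ {a b c} → 0ℚ < a → 0ℚ < b → 0ℚ < c → ∃[ t ] (0ℚ < t × t ≤ a × t ≤ b × t ≤ c)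
pos-lower-bound {a} {b} {c} 0<a 0<b 0<c = a ⊓ b ⊓ c , ⊓-pos (⊓-pos 0<a 0<b) 0<c
  , ≤-trans (p⊓q≤p (a ⊓ b) c) (p⊓q≤p a b) , ≤-trans (p⊓q≤p (a ⊓ b) c) (p⊓q≤q a b) , p⊓q≤q (a ⊓ b) c
  where
  ⊓-pos : ∀ {p q} → 0ℚ < p → 0ℚ < q → 0ℚ < p ⊓ q
  ⊓-pos {p} {q} 0<p 0<q with ⊓-sel p q
  ... | inj₁ eq = subst (0ℚ <_) (sym eq) 0<p
  ... | inj₂ eq = subst (0ℚ <_) (sym eq) 0<q

-- A spectral gap bounds |det (r I − L)| below by κ |r| for r ≤ q − h. Since the
-- determinant vanishes at the eigenvalues, the two smallest ones, if below q − h, are 0;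
-- but then the determinant is quadratically small near 0.
module Spectral {m : ℕ} (G : Graph (suc (suc m))) (ev : Vector ℝ (suc (suc m)))
  (spectrum : IsSpectrum (laplacian G) ev) (q h : ℚ) (0<h : 0ℚ < h) (gap : SpectralGap G q) where

  n : ℕ
  n = suc (suc m)
  open IsSpectrum spectrum

  D : ℚ → ℚ
  D r = det (charMatrix G r)

  P : ℕ → ℚ → ℚ
  P k r = product (λ i → r - seq (ev i) k)

  κ : ℚ
  κ = h ^ suc m

  0<κ : 0ℚ < κ
  0<κ = ^-pos 0<h (suc m)

  κ∣r∣≤∣D∣ : ∀ r → r ≤ q - h → κ * ∣ r ∣ ≤ ∣ D r ∣
  κ∣r∣≤∣D∣ r r≤ = ≤-trans
    (*-monoʳ-≤-nonNeg ∣ r ∣ {{∣-∣-nonNeg r}} (^-mono (<⇒≤ 0<h) h≤q-r (suc m)))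
    (DetBound.det-charMatrix≥ G q r gap r<q)
    where
    h≤q-r : h ≤ q - r
    h≤q-r = ≤-by (q - h - r) (p≤q⇒0≤q-p r≤) (identity h q r)
      where
      identity : ∀ h q r → h + (q - h - r) ≡ q - r
      identity = solve-∀ ℚ-ring
    r<q : r < q
    r<q = <-by (q - r) (<-≤-trans 0<h h≤q-r) (identity r q)
      where
      identity : ∀ r q → r + (q - r) ≡ q
      identity = solve-∀ ℚ-ring

  D≈P : ∀ x ζ → 0ℚ < ζ → Eventually (λ k → ∣ D (seq x k) - P k (seq x k) ∣ ≤ ζ)
  D≈P x ζ 0<ζ = eventually-map (λ k (below , above) → ∣∣≤-by (D (seq x k) - P k (seq x k))
      (transfer (subst₂ (λ d p → d ≤ p + ζ) (seq-characteristic G x k) (seq-product (λ i → x Defs.- ev i) k) below))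
      (subst (_≤ ζ) (flip (D (seq x k)) (P k (seq x k)))
        (transfer (subst₂ (λ d p → p ≤ d + ζ) (seq-characteristic G x k) (seq-product (λ i → x Defs.- ev i) k) above))))
    (proj₁ (roots x) ζ 0<ζ & proj₂ (roots x) ζ 0<ζ)
    where
    transfer : ∀ {d p} → d ≤ p + ζ → d - p ≤ ζ
    transfer {d} {p} d≤ = ≤-by (p + ζ - d) (p≤q⇒0≤q-p d≤) (identity d p ζ)
      where
      identity : ∀ d p z → d - p + (p + z - d) ≡ z
      identity = solve-∀ ℚ-ring
    flip : ∀ d p → p - d ≡ - (d - p)
    flip = solve-∀ ℚ-ring

  -- Evaluated at the eigenvalue itself, the product has a factor that is exactly 0 at every index.
  -- Hence D tends to 0 there, and κ |r| ≤ |D r| forces the eigenvalue to 0.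
  eigenvalue-small : ∀ i → Eventually (λ k → seq (ev i) k ≤ q - h) →
    ∀ τ → 0ℚ < τ → Eventually (λ k → ∣ seq (ev i) k ∣ ≤ τ)
  eigenvalue-small i low τ 0<τ = eventually-map
    (λ k (e≤ , close) → *-cancelˡ-≤-pos κ {{positive 0<κ}} (≤-trans (κ∣r∣≤∣D∣ (seq (ev i) k) e≤)
      (subst (λ d → ∣ d ∣ ≤ κ * τ) (vanish k) close)))
    (low & D≈P (ev i) (κ * τ) (*-pos 0<κ 0<τ))
    where
    vanish : ∀ k → D (seq (ev i) k) - P k (seq (ev i) k) ≡ D (seq (ev i) k)
    vanish k = trans (cong (λ p → D (seq (ev i) k) - p)
        (product-zero (λ j → seq (ev i) k - seq (ev j) k) i (+-inverseʳ (seq (ev i) k))))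
      (+-identityʳ (D (seq (ev i) k)))

  e₀ e₁ : ℕ → ℚ
  e₀ = seq (ev zero)
  e₁ = seq (ev (suc zero))

  -- Both smallest eigenvalues would be 0. At a small fixed t > 0 the product is then at most (2t)²
  -- B, up to an error B t², whereas the spectral gap demands at least κ t.
  second≰ : ¬ Eventually (λ k → e₁ k ≤ q - 2ℚ * h)
  second≰ low = eventually-absurd
    (e₀-small t 0<t & e₁-small t 0<t & e₁-small (½ * h) 0<½h & low & tail-bounded & D≈P (Defs.fromℚ t) (B * t ²) (*-pos 0<B (*-pos 0<t 0<t)))
    contradictory
    where
    shift : ∀ q h → q - 2ℚ * h + h ≡ q - h
    shift = solve-∀ ℚ-ring

    e₁-low : Eventually (λ k → e₁ k ≤ q - h)
    e₁-low = eventually-map (λ k e₁≤ → ≤-trans e₁≤ (≤-by h (<⇒≤ 0<h) (shift q h))) low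

    -- `sorted` compares terms only up to a tolerance; the second `h` in the margin of `low` pays
    -- for it.
    e₀-low : Eventually (λ k → e₀ k ≤ q - h)
    e₀-low = eventually-map
      (λ k (e₁≤ , e₀≤) → ≤-trans e₀≤ (subst (e₁ k + h ≤_) (shift q h) (+-monoˡ-≤ h e₁≤)))
      (low & sorted {zero} {suc zero} ℕ.z≤n h 0<h)

    e₀-small : ∀ τ → 0ℚ < τ → Eventually (λ k → ∣ e₀ k ∣ ≤ τ)
    e₀-small = eigenvalue-small zero e₀-low

    e₁-small : ∀ τ → 0ℚ < τ → Eventually (λ k → ∣ e₁ k ∣ ≤ τ)
    e₁-small = eigenvalue-small (suc zero) e₁-low

    0<½h : 0ℚ < ½ * h
    0<½h = *-pos (positive⁻¹ ½) 0<h

    bounded : ∃[ B ] (0ℚ < B × Eventually (λ k → ∀ t → ∣ t ∣ ≤ 1ℚ →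
      ∣ product (λ i → t - seq (ev (suc (suc i))) k) ∣ ≤ B))
    bounded = product-bounded (λ i → ev (suc (suc i)))

    B : ℚ
    B = proj₁ bounded
    0<B : 0ℚ < B
    0<B = proj₁ (proj₂ bounded)
    tail-bounded : Eventually (λ k → ∀ t → ∣ t ∣ ≤ 1ℚ → ∣ product (λ i → t - seq (ev (suc (suc i))) k) ∣ ≤ B)
    tail-bounded = proj₂ (proj₂ bounded)

    -- Four from (2t)(2t) B, one from the tolerance between D and P, and one more to make the
    -- inequality strict.
    6ℚ : ℚ
    6ℚ = + 6 / 1

    inv : ∃[ c ] (0ℚ < c × 6ℚ * B * c ≡ 1ℚ)
    inv = inverse (*-pos (positive⁻¹ 6ℚ) 0<B)
    c : ℚ
    c = proj₁ inv

    choice : ∃[ t ] (0ℚ < t × t ≤ 1ℚ × t ≤ ½ * h × t ≤ κ * c)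
    choice = pos-lower-bound (positive⁻¹ 1ℚ) 0<½h (*-pos 0<κ (proj₁ (proj₂ inv)))
    t : ℚ
    t = proj₁ choice
    0<t : 0ℚ < t
    0<t = proj₁ (proj₂ choice)
    t≤1 : t ≤ 1ℚ
    t≤1 = proj₁ (proj₂ (proj₂ choice))
    t≤½h : t ≤ ½ * h
    t≤½h = proj₁ (proj₂ (proj₂ (proj₂ choice)))
    t≤κc : t ≤ κ * c
    t≤κc = proj₂ (proj₂ (proj₂ (proj₂ choice)))

    ∣t∣≡t : ∣ t ∣ ≡ t
    ∣t∣≡t = 0≤p⇒∣p∣≡p (<⇒≤ 0<t)

    6Bt≤κ : 6ℚ * B * t ≤ κ
    6Bt≤κ = begin
      6ℚ * B * t             ≤⟨ *-monoˡ-≤-nonNeg (6ℚ * B) {{nonNegative (*-nonneg (nonNegative⁻¹ 6ℚ) (<⇒≤ 0<B))}} t≤κc ⟩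
      6ℚ * B * (κ * c)       ≡⟨ regroup (6ℚ * B) κ c ⟩
      κ * (6ℚ * B * c)       ≡⟨ cong (λ u → κ * u) (proj₂ (proj₂ inv)) ⟩
      κ * 1ℚ                 ≡⟨ *-identityʳ κ ⟩
      κ                      ∎
      where
      open ≤-Reasoning
      regroup : ∀ b k c → b * (k * c) ≡ k * (b * c)
      regroup = solve-∀ ℚ-ring

    near-0 : ∀ {e} → ∣ e ∣ ≤ t → ∣ t - e ∣ ≤ t + t
    near-0 {e} e≤t = ≤-trans (∣p-q∣≤∣p∣+∣q∣ t e) (+-mono-≤ (≤-reflexive ∣t∣≡t) e≤t)

    contradictory : ∀ k → ¬ (∣ e₀ k ∣ ≤ t × ∣ e₁ k ∣ ≤ t × ∣ e₁ k ∣ ≤ ½ * h × e₁ k ≤ q - 2ℚ * h ×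
      (∀ t → ∣ t ∣ ≤ 1ℚ → ∣ product (λ i → t - seq (ev (suc (suc i))) k) ∣ ≤ B) ×
      ∣ D t - P k t ∣ ≤ B * t ²)
    contradictory k (e₀≤t , e₁≤t , e₁≤½h , e₁≤ , tail≤B , close) = <-irrefl refl (begin-strict
      κ * t                                       ≡⟨ cong (λ u → κ * u) (sym ∣t∣≡t) ⟩
      κ * ∣ t ∣                                   ≤⟨ κ∣r∣≤∣D∣ t t≤q-h ⟩
      ∣ D t ∣                                     ≡⟨ cong ∣_∣ (split (D t) (P k t)) ⟩
      ∣ (D t - P k t) + P k t ∣                   ≤⟨ ∣p+q∣≤∣p∣+∣q∣ (D t - P k t) (P k t) ⟩
      ∣ D t - P k t ∣ + ∣ P k t ∣                 ≤⟨ +-mono-≤ close P-small ⟩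
      B * t ² + (t + t) * ((t + t) * B)           <⟨ <-by (B * t ²) (*-pos 0<B (*-pos 0<t 0<t)) (collect B t) ⟩
      6ℚ * B * t * t                              ≤⟨ *-monoʳ-≤-nonNeg t {{nonNegative (<⇒≤ 0<t)}} 6Bt≤κ ⟩
      κ * t                                       ∎)
      where
      open ≤-Reasoning
      split : ∀ d p → d ≡ (d - p) + p
      split = solve-∀ ℚ-ring
      collect : ∀ b t → b * (t * t) + (t + t) * ((t + t) * b) + b * (t * t) ≡ 6ℚ * b * t * t
      collect = solve-∀ ℚ-ring
      P-small : ∣ P k t ∣ ≤ (t + t) * ((t + t) * B)
      P-small = *-mono-≤-abs {t - e₀ k} (near-0 e₀≤t) (*-mono-≤-abs {t - e₁ k} (near-0 e₁≤t)
        (tail≤B t (≤-trans (≤-reflexive ∣t∣≡t) t≤1)))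
      -- Room above 0 comes from the eigenvalue: -h/2 ≤ e₁ ≤ q - 2h gives q - h ≥ h/2 ≥ t.
      t≤q-h : t ≤ q - h
      t≤q-h = ≤-by ((½ * h - t) + ((q - 2ℚ * h - e₁ k) + (½ * h - - e₁ k)))
        (+-nonneg (p≤q⇒0≤q-p t≤½h) (+-nonneg (p≤q⇒0≤q-p e₁≤) (p≤q⇒0≤q-p (≤-trans (-p≤∣p∣ (e₁ k)) e₁≤½h))))
        (identity t h q (e₁ k))
        where
        identity : ∀ t h q e → t + ((½ * h - t) + ((q - 2ℚ * h - e) + (½ * h - - e))) ≡ q - h
        identity = solve-∀ ℚ-ring

-- A vector violating the gap would descend to a mode. The gap is an inequality between rationals,
-- so refuting its failure proves it.
mode-from-no-gap : ∀ {m} (G : Graph (suc m)) η → 0ℚ < η → (Mode G → ⊥) → SpectralGap G (2/5 - η)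
mode-from-no-gap G η 0<η no-mode y mean-zero = ≮⇒≥ λ low →
  no-mode (Descent.find-mode G η 0<η y mean-zero (0<norm low) (<⇒≤ low))
  where
  0<norm : energy G y < 2ℚ * (2/5 - η) * norm² y → 0ℚ < norm² y
  0<norm low = ≰⇒> λ norm≤0 → <-irrefl refl (≤-<-trans (energy-nonneg G y)
    (subst (energy G y <_) (trans (cong (λ s → 2ℚ * (2/5 - η) * s)
      (≤-antisym norm≤0 (sum-nonneg λ i → ²-nonneg (y i)))) (*-zeroʳ (2ℚ * (2/5 - η)))) low))

-- The order of ℝ is not decidable, but one late term can be compared with p - ε/2. All later terms
-- move by less than ε/4, so they stay above p - ε in one case and below p - ε/4 in the other, which
-- gives η = ε/8.
≥-by-contradiction : ∀ (w : ℝ) p →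
  (∀ η → 0ℚ < η → ¬ Eventually (λ k → seq w k ≤ p - η - η)) → w Defs.≥ Defs.fromℚ p
≥-by-contradiction w p not-below ε 0<ε = conclude (cauchy w (¼ * ε) (*-pos (positive⁻¹ ¼) 0<ε))
  where
  ¼ : ℚ
  ¼ = + 1 / 4
  ⅛ : ℚ
  ⅛ = + 1 / 8
  Close : ℕ → Set
  Close N = ∀ m n → N ℕ.≤ m → N ℕ.≤ n → ∣ seq w m - seq w n ∣ < ¼ * ε

  above : ∀ N → Close N → p ≤ seq w N + ½ * ε → ∀ k → N ℕ.≤ k → p ≤ seq w k + ε
  above N close p≤ k N≤k = ≤-by
    ((seq w N + ½ * ε - p) + ((¼ * ε - (seq w N - seq w k)) + ¼ * ε))
    (+-nonneg (p≤q⇒0≤q-p p≤) (+-nonneg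
      (p≤q⇒0≤q-p (≤-trans (p≤∣p∣ (seq w N - seq w k)) (<⇒≤ (close N k ℕ.≤-refl N≤k))))
      (*-nonneg (nonNegative⁻¹ ¼) (<⇒≤ 0<ε))))
    (identity p (seq w N) (seq w k) ε)
    where
    identity : ∀ p v u e → p + ((v + ½ * e - p) + ((+ 1 / 4 * e - (v - u)) + + 1 / 4 * e)) ≡ u + e
    identity = solve-∀ ℚ-ring

  below : ∀ N → Close N → seq w N + ½ * ε < p → ∀ k → N ℕ.≤ k → seq w k ≤ p - ⅛ * ε - ⅛ * ε
  below N close <p k N≤k = ≤-by
    ((p - (seq w N + ½ * ε)) + (¼ * ε - (seq w k - seq w N)))
    (+-nonneg (p≤q⇒0≤q-p (<⇒≤ <p))
      (p≤q⇒0≤q-p (≤-trans (p≤∣p∣ (seq w k - seq w N)) (<⇒≤ (close k N N≤k ℕ.≤-refl)))))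
    (identity p (seq w N) (seq w k) ε)
    where
    identity : ∀ p v u e → u + ((p - (v + ½ * e)) + (+ 1 / 4 * e - (u - v))) ≡ p - + 1 / 8 * e - + 1 / 8 * e
    identity = solve-∀ ℚ-ring

  decide : ∀ N → Close N → Dec (p ≤ seq w N + ½ * ε) → Eventually (λ k → p ≤ seq w k + ε)
  decide N close (yes p≤) = N , above N close p≤
  decide N close (no  p≰) = ⊥-elim (not-below (⅛ * ε) (*-pos (positive⁻¹ ⅛) 0<ε) (N , below N close (≰⇒> p≰)))

  conclude : ∃[ N ] Close N → Eventually (λ k → p ≤ seq w k + ε)
  conclude (N , close) = decide N close (p ≤? seq w N + ½ * ε)

-- A mode of `G` would exclude modes of the complement and so give it a spectral gap, against the
-- smallness of its second eigenvalue. Hence `G` has no mode and has a gap itself, with the same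
-- conflict. Of the margin 2η, one half is the distance from 2/5 required by the descent, and the
-- other is the 2h of `second≰`.
max-second-eigenvalue≥2/5 : ∀ {m} (G : Graph (suc (suc m))) (ev ev′ : Vector ℝ (suc (suc m))) →
  IsSpectrum (laplacian G) ev → IsSpectrum (laplacian (complement G)) ev′ →
  (ev (suc zero) Defs.⊔ ev′ (suc zero)) Defs.≥ Defs.fromℚ 2/5
max-second-eigenvalue≥2/5 G ev ev′ spectrum spectrum′ = ≥-by-contradiction w 2/5 not-below
  where
  w : ℝ
  w = ev (suc zero) Defs.⊔ ev′ (suc zero)

  not-below : ∀ η → 0ℚ < η → ¬ Eventually (λ k → seq w k ≤ 2/5 - η - η)
  not-below η 0<η low = Spectral.second≰ G ev spectrum (2/5 - η) (½ * η) 0<½η gap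
    (eventually-map (λ k w≤ → below k (≤-trans (p≤p⊔q (seq (ev (suc zero)) k) (seq (ev′ (suc zero)) k)) w≤)) low)
    where
    0<½η : 0ℚ < ½ * η
    0<½η = *-pos (positive⁻¹ ½) 0<η
    below : ∀ k {e} → e ≤ 2/5 - η - η → e ≤ 2/5 - η - 2ℚ * (½ * η)
    below k {e} = subst (e ≤_) (identity 2/5 η)
      where
      identity : ∀ p η → p - η - η ≡ p - η - 2ℚ * (½ * η)
      identity = solve-∀ ℚ-ring
    gap′ : Mode G → SpectralGap (complement G) (2/5 - η)
    gap′ X = mode-from-no-gap (complement G) η 0<η (modes-incompatible X)
    gap : SpectralGap G (2/5 - η)
    gap = mode-from-no-gap G η 0<η λ X →
      Spectral.second≰ (complement G) ev′ spectrum′ (2/5 - η) (½ * η) 0<½η (gap′ X)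
        (eventually-map (λ k w≤ → below k (≤-trans (p≤q⊔p (seq (ev (suc zero)) k) (seq (ev′ (suc zero)) k)) w≤)) low)

open import Defs

theorem2 : ∀ (n : ℕ) (n≥2 : n ℕ.≥ 2) (G : Graph n) (ev ev′ : Vector ℝ n) →
    IsSpectrum (laplacian G) ev →
    IsSpectrum (laplacian (complement G)) ev′ →
    second n≥2 ev ⊔ second n≥2 ev′ ≥ fromℚ (+ 2 ℚ./ 5)
theorem2 (suc (suc m)) n≥2 G ev ev′ spectrum spectrum′ =
  max-second-eigenvalue≥2/5 G ev ev′ spectrum spectrum′
theorem2 (suc zero) (ℕ.s≤s ()) G ev ev′ spectrum spectrum′
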